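{- Let $p$ be a prime, let $m \ge 2$ be an integer, and let $\delta>0$, $\nu>0$, $\epsilon>0$. Then there exists $C_{\mathrm{cor}}(\delta,\nu,\epsilon,p,m)>0$ such that the following holds. If $s$ is a positive integer and $\mathcal{A}_1,\dots,\mathcal{A}_s$ are non-empty subsets of $\{0,1\}^n$ each with density at least $\delta$ inside $\{0,1\}^n$, then there exists a subset $R \subset [s]$ with $|R| \ge s/(n+1)^{C_{\mathrm{cor}}(\delta,\nu,\epsilon,p,m)}$ such that for at least $(1-\epsilon)|R|^m$ of the $m$-tuples $(i_1,\dots,i_m) \in R^m$ we have \[\mathrm{cor}_{\mathcal{A}_{i_1},\dots,\mathcal{A}_{i_m}}\phi \ge -\nu\] for every mod-$p$ form $\phi$.
   Context: A mod-$p$ form is a linear form $\phi:\mathbb{F}_p^n\to\mathbb{F}_p$, $\phi(x)=a_1x_1+\dots+a_nx_n$; it is evaluated on $\{0,1\}^n$ by identifying $\{0,1\}$ with the elements $0,1$ of $\mathbb{F}_p$. The density of $\mathcal{A}\subset\{0,1\}^n$ is $|\mathcal{A}|/2^n$. For random variables $X_1,\dots,X_m$ taking values in a finite set $D$, the correlation is $\mathrm{cor}(X_1,\dots,X_m)=\big(\sum_{d\in D}\mathbb{P}[X_1=d]\cdots\mathbb{P}[X_m=d]\big)-1/|D|^{m-1}$. For a function $F$ on $\{0,1\}^n$ and non-empty $\mathcal{A}_1,\dots,\mathcal{A}_m\subset\{0,1\}^n$, $\mathrm{cor}_{\mathcal{A}_1,\dots,\mathcal{A}_m}(F)$ denotes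 $\mathrm{cor}(X_1,\dots,X_m)$ where $X_i$ is distributed as $F(x)$ for $x$ uniform in $\mathcal{A}_i$ (for a mod-$p$ form, $D=\mathbb{F}_p$). -}

module Defs where

open import Data.Bool using (Bool; true; false; if_then_else_; _∧_)
open import Data.Nat using (ℕ; zero; suc; _+_; _*_; _^_; _∸_; NonZero)
open import Data.Nat.DivMod using (_mod_)
open import Data.Fin using (Fin; toℕ; _≟_)
open import Data.Vec using (Vec; []; _∷_; zipWith; foldr)
open import Data.List using (List; [_]; map; concatMap; allFin)
open import Data.Nat.ListAction using (sum)
import Data.List as L
open import Data.Integer using (+_)
open import Data.Rational using (ℚ; 0ℚ; 1ℚ; _/_; _-_)
import Data.Rational as Q
open import Relation.Nullary.Decidable using (⌊_⌋)

allVec : {A : Set} → List A → (n : ℕ) → List (Vec A n)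
allVec xs zero = [ [] ]
allVec xs (suc n) = concatMap (λ x → map (x ∷_) (allVec xs n)) xs

cube : (n : ℕ) → List (Vec Bool n)
cube n = allVec (true L.∷ false L.∷ L.[]) n

SubCube : ℕ → Set
SubCube n = Vec Bool n → Bool

bit : Bool → ℕ
bit true = 1
bit false = 0

size : {n : ℕ} → SubCube n → ℕ
size {n} A = sum (map (λ x → bit (A x)) (cube n))

-- a / b as a rational (b = 0 gives 0; only used with b ≠ 0)
frac : ℕ → ℕ → ℚ
frac a zero = 0ℚ
frac a (suc b) = (+ a) / suc b

density : {n : ℕ} → SubCube n → ℚ
density {n} A = frac (size A) (2 ^ n)

-- a mod-p form, given by its coefficient vector (a_1,...,a_n) in F_p^n
Form : ℕ → ℕ → Set
Form p n = Vec (Fin p) n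

evalForm : {p n : ℕ} .{{_ : NonZero p}} → Form p n → Vec Bool n → Fin p
evalForm {p} a x = foldr (λ _ → ℕ) _+_ 0 (zipWith (λ c b → toℕ c * bit b) a x) mod p

prob : {p n : ℕ} .{{_ : NonZero p}} → SubCube n → Form p n → Fin p → ℚ
prob {p} {n} A φ d =
  frac (sum (map (λ x → bit (A x ∧ ⌊ evalForm φ x ≟ d ⌋)) (cube n))) (size A)

sumℚ : List ℚ → ℚ
sumℚ = L.foldr Q._+_ 0ℚ

prodℚ : List ℚ → ℚ
prodℚ = L.foldr Q._*_ 1ℚ

cor : {p n : ℕ} .{{_ : NonZero p}} (m : ℕ) → (Fin m → SubCube n) → Form p n → ℚ
cor {p} m As φ =
  sumℚ (map (λ d → prodℚ (map (λ i → prob (As i) φ d) (allFin m))) (allFin p))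
  - frac 1 (p ^ (m ∸ 1))

{-# OPTIONS --safe #-}

-- On the cube, a form with many nonzero coefficients is almost equidistributed modulo p, so biases of
-- forms whose nontrivial combinations all have many nonzero coefficients are almost orthogonal. By
-- Bessel's inequality the forms that are biased on a given dense set are covered by boundedly many
-- centres, up to multiples and to few coordinates.
--
-- Call a pair of sets bad if some form is biased on both with different distributions. If a family has
-- many bad pairs, one of its sets has many bad partners, and many of these share a biased form near
-- a common centre e. The distributions of the forms near e on a set A are determined by the Walsh
-- coefficients of low degree of the sets A ∩ {e = d}. Only boundedly many of them are large, hence
-- a polynomial pigeonhole makes them agree on a subfamily, and e can no longer cause bad pairs. Every
-- step lengthens a chain of independent biased forms on each remaining set, so after boundedly many
-- steps there are few bad pairs.
--
-- On a tuple without bad pairs the distributions of a form are, up to small errors, each uniform or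
-- equal to one common distribution q, and the correlation is nonnegative because ∑ q(d)^r ≥ p^(1-r).

module Submission where

open import Defs
open import Algebra.Structures using (IsCommutativeSemiring)
open import Data.Nat using (ℕ)
open import Data.Nat.Primality using (Prime)
open import Relation.Binary.PropositionalEquality using (_≡_)

-- The centre `e` found in a step comes from the spectrum of one set and need not be biased on the
-- others; each of them only has some form of its own near `e`. The chain of a remaining set
-- therefore consists of its own forms, matched with the common centres. A new form cannot be
-- covered by an old one near a centre c: it would then lie near c itself, at twice the radius,
-- where the distributions already agree. Hence chains use the radius `k₀` and agreement is enforced
-- at `K = k₀ + k₀`.
--
-- No roots of unity occur. A form is tested against 1 - p 1[v·x + b = 0], and equidistribution
-- comes from a spectral gap on the cyclic group: a nonzero coefficient averages the distribution
-- with a shift of itself, which contracts the variance by a fixed factor. One-sided bounds suffice: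
-- a distribution that is not uniform has a deficient residue, and the correlation is estimated from
-- below.
--
-- A single natural number D with 1/D at most δ, ν and ε replaces the three parameters, so that the
-- counting is done with integer inequalities whose denominators are cleared.

-- Finite sums in an ordered commutative semiring

module BigSum {A : Set} (_≤_ : A → A → Set) (_+_ _*_ : A → A → A) (0# 1# : A)
  (isCS : IsCommutativeSemiring _≡_ _+_ _*_ 0# 1#)
  (≤-refl : ∀ {x} → x ≤ x)
  (+-mono-≤ : ∀ {x y u v} → x ≤ y → u ≤ v → (x + u) ≤ (y + v)) where

  open import Data.List using (List; []; _∷_; map; foldr; _++_; concatMap; applyUpTo; upTo)
  open import Data.List.Membership.Propositional using (_∈_)
  open import Data.List.Relation.Unary.Any using (here; there)
  open import Data.Nat using (zero; suc)
  open import Function using (id; _∘_)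
  open import Relation.Binary.PropositionalEquality using (refl; sym; trans; cong; cong₂; module ≡-Reasoning)
  open IsCommutativeSemiring isCS using (+-assoc; +-comm; +-identityˡ; +-identityʳ; zeroʳ; distribˡ; *-comm)

  private
    variable
      X Y : Set

  Σ : List X → (X → A) → A
  Σ xs f = foldr _+_ 0# (map f xs)

  Σ-cong∈ : {f g : X → A} (xs : List X) → (∀ {x} → x ∈ xs → f x ≡ g x) → Σ xs f ≡ Σ xs g
  Σ-cong∈ [] f≡g = refl
  Σ-cong∈ (x ∷ xs) f≡g = cong₂ _+_ (f≡g (here refl)) (Σ-cong∈ xs (f≡g ∘ there))

  Σ-cong : {f g : X → A} (xs : List X) → (∀ x → f x ≡ g x) → Σ xs f ≡ Σ xs g
  Σ-cong xs f≡g = Σ-cong∈ xs (λ {x} _ → f≡g x)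

  Σ-mono∈ : {f g : X → A} (xs : List X) → (∀ {x} → x ∈ xs → f x ≤ g x) → Σ xs f ≤ Σ xs g
  Σ-mono∈ [] f≤g = ≤-refl
  Σ-mono∈ (x ∷ xs) f≤g = +-mono-≤ (f≤g (here refl)) (Σ-mono∈ xs (f≤g ∘ there))

  Σ-mono : {f g : X → A} (xs : List X) → (∀ x → f x ≤ g x) → Σ xs f ≤ Σ xs g
  Σ-mono xs f≤g = Σ-mono∈ xs (λ {x} _ → f≤g x)

  Σ-zero : (xs : List X) → Σ xs (λ _ → 0#) ≡ 0#
  Σ-zero [] = refl
  Σ-zero (x ∷ xs) = trans (+-identityˡ _) (Σ-zero xs)

  private
    interchange : ∀ a b c d → (a + b) + (c + d) ≡ (a + c) + (b + d)
    interchange a b c d = begin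
      (a + b) + (c + d) ≡⟨ +-assoc a b (c + d) ⟩
      a + (b + (c + d)) ≡⟨ cong (a +_) (+-assoc b c d) ⟨
      a + ((b + c) + d) ≡⟨ cong (λ z → a + (z + d)) (+-comm b c) ⟩
      a + ((c + b) + d) ≡⟨ cong (a +_) (+-assoc c b d) ⟩
      a + (c + (b + d)) ≡⟨ +-assoc a c (b + d) ⟨
      (a + c) + (b + d) ∎
      where open ≡-Reasoning

  Σ-+ : (xs : List X) (f g : X → A) → Σ xs (λ x → f x + g x) ≡ Σ xs f + Σ xs g
  Σ-+ [] f g = sym (+-identityˡ 0#)
  Σ-+ (x ∷ xs) f g = trans (cong ((f x + g x) +_) (Σ-+ xs f g)) (interchange _ _ _ _)

  Σ-* : (c : A) (xs : List X) (f : X → A) → Σ xs (λ x → c * f x) ≡ c * Σ xs f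
  Σ-* c [] f = sym (zeroʳ c)
  Σ-* c (x ∷ xs) f = trans (cong ((c * f x) +_) (Σ-* c xs f)) (sym (distribˡ c _ _))

  Σ-*ʳ : (c : A) (xs : List X) (f : X → A) → Σ xs (λ x → f x * c) ≡ Σ xs f * c
  Σ-*ʳ c xs f = trans (Σ-cong xs (λ x → *-comm (f x) c)) (trans (Σ-* c xs f) (*-comm c _))

  Σ-swap : (xs : List X) (ys : List Y) (f : X → Y → A) →
           Σ xs (λ x → Σ ys (f x)) ≡ Σ ys (λ y → Σ xs (λ x → f x y))
  Σ-swap [] ys f = sym (Σ-zero ys)
  Σ-swap (x ∷ xs) ys f = trans (cong (Σ ys (f x) +_) (Σ-swap xs ys f)) (sym (Σ-+ ys _ _))

  Σ-++ : (xs ys : List X) (f : X → A) → Σ (xs ++ ys) f ≡ Σ xs f + Σ ys f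
  Σ-++ [] ys f = sym (+-identityˡ _)
  Σ-++ (x ∷ xs) ys f = trans (cong (f x +_) (Σ-++ xs ys f)) (sym (+-assoc _ _ _))

  Σ-map : (g : X → Y) (xs : List X) (f : Y → A) → Σ (map g xs) f ≡ Σ xs (f ∘ g)
  Σ-map g [] f = refl
  Σ-map g (x ∷ xs) f = cong (f (g x) +_) (Σ-map g xs f)

  Σ-concatMap : (g : X → List Y) (xs : List X) (f : Y → A) →
                Σ (concatMap g xs) f ≡ Σ xs (λ x → Σ (g x) f)
  Σ-concatMap g [] f = refl
  Σ-concatMap g (x ∷ xs) f =
    trans (Σ-++ (g x) (concatMap g xs) f) (cong (Σ (g x) f +_) (Σ-concatMap g xs f))

  Σ-upTo-suc : (k : ℕ) (f : ℕ → A) → Σ (upTo (suc k)) f ≡ f 0 + Σ (upTo k) (f ∘ suc)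
  Σ-upTo-suc k f = cong (f 0 +_) (shift k id)
    where
    shift : (k : ℕ) (g : ℕ → ℕ) → Σ (applyUpTo (suc ∘ g) k) f ≡ Σ (applyUpTo g k) (f ∘ suc)
    shift zero g = refl
    shift (suc k) g = cong (f (suc (g 0)) +_) (shift k (g ∘ suc))

  Σ-upTo-last : (k : ℕ) (f : ℕ → A) → Σ (upTo (suc k)) f ≡ Σ (upTo k) f + f k
  Σ-upTo-last zero f = trans (+-identityʳ _) (sym (+-identityˡ _))
  Σ-upTo-last (suc k) f = begin
    Σ (upTo (suc (suc k))) f              ≡⟨ Σ-upTo-suc (suc k) f ⟩
    f 0 + Σ (upTo (suc k)) (f ∘ suc)      ≡⟨ cong (f 0 +_) (Σ-upTo-last k (f ∘ suc)) ⟩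
    f 0 + (Σ (upTo k) (f ∘ suc) + f (suc k)) ≡⟨ +-assoc _ _ _ ⟨
    (f 0 + Σ (upTo k) (f ∘ suc)) + f (suc k) ≡⟨ cong (_+ f (suc k)) (Σ-upTo-suc k f) ⟨
    Σ (upTo (suc k)) f + f (suc k)        ∎
    where open ≡-Reasoning

-- Sums and inequalities over the integers

module ℤΣ where
  open import Data.Integer
  open import Data.Integer.Properties
  open import Data.Nat using (z≤n)
  open import Data.List using (List; []; _∷_; length)
  open import Relation.Binary.PropositionalEquality

  open BigSum _≤_ _+_ _*_ 0ℤ 1ℤ +-*-isCommutativeSemiring ≤-refl +-mono-≤ public

  -- Long inequalities are proved by certificates: the ring solver rewrites the difference of the
  -- two sides as an expression that is nonnegative term by term.
  ≤-cert : ∀ {x y e} → 0ℤ ≤ e → y - x ≡ e → x ≤ y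
  ≤-cert 0≤e eq = 0≤i-j⇒j≤i (subst (0ℤ ≤_) (sym eq) 0≤e)

  0≤-* : ∀ {x y} → 0ℤ ≤ x → 0ℤ ≤ y → 0ℤ ≤ x * y
  0≤-* {x} {y} 0≤x 0≤y = subst (_≤ x * y) (*-zeroʳ x) (*-monoˡ-≤-nonNeg x {{nonNegative 0≤x}} 0≤y)

  0≤-+ : ∀ {x y} → 0ℤ ≤ x → 0ℤ ≤ y → 0ℤ ≤ x + y
  0≤-+ = +-mono-≤

  0≤-sq : ∀ x → 0ℤ ≤ x * x
  0≤-sq (+ n) = 0≤-* {+ n} {+ n} (+≤+ z≤n) (+≤+ z≤n)
  0≤-sq -[1+ n ] = +≤+ z≤n

  0≤+ : ∀ n → 0ℤ ≤ + n
  0≤+ n = +≤+ z≤n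

  *-monoˡ : ∀ {c x y} → 0ℤ ≤ c → x ≤ y → c * x ≤ c * y
  *-monoˡ {c} 0≤c = *-monoˡ-≤-nonNeg c {{nonNegative 0≤c}}

  private
    variable
      X : Set

  Σ-nonneg : {f : X → ℤ} (xs : List X) → (∀ x → 0ℤ ≤ f x) → 0ℤ ≤ Σ xs f
  Σ-nonneg xs 0≤f = subst (_≤ Σ xs _) (Σ-zero xs) (Σ-mono xs 0≤f)

  Σ-const : (c : ℤ) (xs : List X) → Σ xs (λ _ → c) ≡ + length xs * c
  Σ-const c [] = refl
  Σ-const c (x ∷ xs) = trans (cong (λ z → c + z) (Σ-const c xs)) (sym (suc-* (+ length xs) c))

  Σ-neg : (xs : List X) (f : X → ℤ) → Σ xs (λ x → - f x) ≡ - Σ xs f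
  Σ-neg xs f = begin
    Σ xs (λ x → - f x)       ≡⟨ Σ-cong xs (λ x → sym (-1*i≡-i (f x))) ⟩
    Σ xs (λ x → -1ℤ * f x)   ≡⟨ Σ-* -1ℤ xs f ⟩
    -1ℤ * Σ xs f             ≡⟨ -1*i≡-i _ ⟩
    - Σ xs f                 ∎
    where open ≡-Reasoning

  Σ-- : (xs : List X) (f g : X → ℤ) → Σ xs (λ x → f x - g x) ≡ Σ xs f - Σ xs g
  Σ-- xs f g = trans (Σ-+ xs f (λ x → - g x)) (cong (λ z → Σ xs f + z) (Σ-neg xs g))

-- Congruences modulo p between natural numbers

module Residues (p : ℕ) (p-prime : Prime p) where
  open import Data.Nat
  open import Data.Nat.Properties
  open import Data.Nat.Divisibility
  open import Data.Nat.DivMod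
  open import Data.Nat.Coprimality using (Coprime; coprime-Bézout)
  open import Data.Nat.GCD using (module Bézout)
  open import Data.Nat.Tactic.RingSolver using (solve-∀)
  open import Data.Nat.Primality
  open import Data.Integer using (ℤ; 0ℤ; 1ℤ)
  open import Data.Bool using (if_then_else_)
  open import Data.Product
  open import Data.Sum using (inj₁; inj₂)
  open import Relation.Nullary
  open import Relation.Binary.PropositionalEquality

  private instance
    p≢0 : NonZero p
    p≢0 = prime⇒nonZero p-prime

  ∣-cancel : ∀ {m n} → p ∣ m + n → p ∣ m → p ∣ n
  ∣-cancel = ∣m+n∣m⇒∣n

  private
    coprime : ∀ {a} → p ∤ a → Coprime a p
    coprime {a} p∤a {d} (d∣a , d∣p) with prime⇒irreducible p-prime d∣p
    ... | inj₁ d≡1 = d≡1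
    ... | inj₂ refl = contradiction d∣a p∤a

    minus : ∃ λ q → p ≡ suc q
    minus = pred p , sym (suc-pred p)

  p-1 : ℕ
  p-1 = proj₁ minus

  p≡ : p ≡ suc p-1
  p≡ = proj₂ minus

  -- Bézout's identity gives an inverse of `a` up to sign; since residues are natural numbers, `p-1`
  -- stands for minus one.
  solvable : ∀ {a} → p ∤ a → ∀ β → ∃ λ u → u < p × p ∣ β + u * a
  solvable {a} p∤a β = reduce (unreduced (coprime-Bézout (coprime p∤a)))
    where
    unreduced : Bézout.Identity 1 a p → ∃ λ u → p ∣ β + u * a
    unreduced (Bézout.-+ x y eq) = β * x , divides (β * y)
      (trans (lhs β x a) (trans (cong (β *_) eq) (sym (*-assoc β y p))))
      where
      lhs : ∀ β x a → β + β * x * a ≡ β * (1 + x * a)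
      lhs = solve-∀
    unreduced (Bézout.+- x y eq) = β * p-1 * x , divides (β * (1 + p-1 * y)) (begin
      β + β * p-1 * x * a           ≡⟨ lhs β p-1 x a ⟩
      β + β * p-1 * (x * a)         ≡⟨ cong (λ z → β + β * p-1 * z) (sym eq) ⟩
      β + β * p-1 * (1 + y * p)     ≡⟨ mid β p-1 y p ⟩
      β * (suc p-1 + p-1 * y * p)   ≡⟨ cong (λ z → β * (z + p-1 * y * p)) (sym p≡) ⟩
      β * (p + p-1 * y * p)         ≡⟨ rhs β p-1 y p ⟩
      β * (1 + p-1 * y) * p         ∎)
      where
      open ≡-Reasoning
      lhs : ∀ β q x a → β + β * q * x * a ≡ β + β * q * (x * a)
      lhs = solve-∀
      mid : ∀ β q y p → β + β * q * (1 + y * p) ≡ β * ((1 + q) + q * y * p)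
      mid = solve-∀
      rhs : ∀ β q y p → β * (p + q * y * p) ≡ β * (1 + q * y) * p
      rhs = solve-∀
    reduce : (∃ λ u → p ∣ β + u * a) → ∃ λ u → u < p × p ∣ β + u * a
    reduce (u , p∣) = u % p , m%n<n u p , ∣-cancel {u / p * a * p} (subst (p ∣_) eq p∣) (divides (u / p * a) refl)
      where
      rearr : ∀ β r q a p → β + (r + q * p) * a ≡ q * a * p + (β + r * a)
      rearr = solve-∀
      eq : β + u * a ≡ u / p * a * p + (β + u % p * a)
      eq = trans (cong (λ z → β + z * a) (m≡m%n+[m/n]*n u p)) (rearr β (u % p) (u / p) a p)

  private
    unique-solution-≤ : ∀ {a β u v} → p ∤ a → u ≤ v → v < p → p ∣ β + u * a → p ∣ β + v * a → u ≡ v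
    unique-solution-≤ {a} {β} {u} {v} p∤a u≤v v<p p∣u p∣v with euclidsLemma (v ∸ u) a p-prime
          (∣-cancel {β + u * a} (subst (p ∣_) (trans (cong (λ z → β + z * a) (sym (m+[n∸m]≡n u≤v))) (rearr β u (v ∸ u) a)) p∣v) p∣u)
      where
      rearr : ∀ β u w a → β + (u + w) * a ≡ (β + u * a) + w * a
      rearr = solve-∀
    ... | inj₂ p∣a = contradiction p∣a p∤a
    ... | inj₁ p∣w with v ∸ u in eq
    ...   | zero = ≤-antisym u≤v (m∸n≡0⇒m≤n eq)
    ...   | suc w = contradiction (∣⇒≤ p∣w) (<⇒≱ (≤-<-trans (subst (_≤ v) eq (m∸n≤m v u)) v<p))

  unique-solution : ∀ {a β u v} → p ∤ a → u < p → v < p → p ∣ β + u * a → p ∣ β + v * a → u ≡ v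
  unique-solution {u = u} {v = v} p∤a u<p v<p p∣u p∣v with ≤-total u v
  ... | inj₁ u≤v = unique-solution-≤ p∤a u≤v v<p p∣u p∣v
  ... | inj₂ v≤u = sym (unique-solution-≤ p∤a v≤u u<p p∣v p∣u)

  δ : ℕ → ℤ
  δ z = if does (p ∣? z) then 1ℤ else 0ℤ

  δ-yes : ∀ {z} → p ∣ z → δ z ≡ 1ℤ
  δ-yes {z} p∣z with p ∣? z
  ... | yes _ = refl
  ... | no p∤z = contradiction p∣z p∤z

  δ-no : ∀ {z} → p ∤ z → δ z ≡ 0ℤ
  δ-no {z} p∤z with p ∣? z
  ... | yes p∣z = contradiction p∣z p∤z
  ... | no _ = refl

  δ-cong : ∀ {y z} → (p ∣ y → p ∣ z) → (p ∣ z → p ∣ y) → δ y ≡ δ z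
  δ-cong {y} {z} f g with p ∣? z
  ... | yes p∣z = δ-yes (g p∣z)
  ... | no p∤z = δ-no (λ p∣y → p∤z (f p∣y))

  δ-+ : ∀ {a} → p ∣ a → ∀ z → δ (a + z) ≡ δ z
  δ-+ p∣a z = δ-cong (λ d → ∣-cancel d p∣a) (∣m∣n⇒∣m+n p∣a)

  δ-periodic : ∀ z → δ (z + p) ≡ δ z
  δ-periodic z = trans (cong δ (+-comm z p)) (δ-+ ∣-refl z)

-- Variance and energy of functions on the cyclic group of order p

module CyclicFunctions (p : ℕ) (p-prime : Prime p) where
  open import Data.Integer hiding (suc)
  open import Data.Integer.Properties
  open import Data.Integer.Tactic.RingSolver using (solve-∀)
  import Data.Nat as ℕ
  import Data.Nat.Properties as ℕₚ
  import Data.Nat.Tactic.RingSolver as ℕ-Solver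
  open import Data.Nat using (zero; suc)
  open import Data.Nat.Divisibility using (_∣_; _∤_; divides)
  open import Data.List using (upTo)
  open import Data.List.Properties using (length-upTo)
  open import Data.Product using (_,_; ∃; _×_)
  open import Function using (_∘_)
  open import Relation.Binary.PropositionalEquality
  open ℤΣ
  open Residues p p-prime

  P : ℤ
  P = + p

  0≤P : 0ℤ ≤ P
  0≤P = 0≤+ p

  S : (ℕ → ℤ) → ℤ
  S = Σ (upTo p)

  S-const : ∀ c → S (λ _ → c) ≡ P * c
  S-const c = trans (Σ-const c (upTo p)) (cong (λ k → + k * c) (length-upTo p))

  Periodic : (ℕ → ℤ) → Set
  Periodic f = ∀ b → f (b ℕ.+ p) ≡ f b

  periodic-* : ∀ {f} → Periodic f → ∀ b k → f (b ℕ.+ k ℕ.* p) ≡ f b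
  periodic-* {f} per b zero = cong f (ℕₚ.+-identityʳ b)
  periodic-* {f} per b (suc k) = trans (cong f (rearr b p (k ℕ.* p))) (trans (per _) (periodic-* per b k))
    where
    rearr : ∀ b p q → b ℕ.+ (p ℕ.+ q) ≡ b ℕ.+ q ℕ.+ p
    rearr = ℕ-Solver.solve-∀

  -- Under a shift by one, the sum over a period loses the value at 0 and gains the equal value at
  -- `p`.
  S-shift : ∀ {f} → Periodic f → ∀ a → S (λ b → f (b ℕ.+ a)) ≡ S f
  S-shift {f} per zero = Σ-cong (upTo p) (λ b → cong f (ℕₚ.+-identityʳ b))
  S-shift {f} per (suc a) = begin
    S (λ b → f (b ℕ.+ suc a))  ≡⟨ Σ-cong (upTo p) (λ b → cong f (ℕₚ.+-suc b a)) ⟩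
    S (λ b → f (suc b ℕ.+ a))  ≡⟨ step (λ b → f (b ℕ.+ a)) (λ b → trans (cong f (swap b p a)) (per (b ℕ.+ a))) ⟩
    S (λ b → f (b ℕ.+ a))      ≡⟨ S-shift per a ⟩
    S f                        ∎
    where
    open ≡-Reasoning
    swap : ∀ b p a → b ℕ.+ p ℕ.+ a ≡ b ℕ.+ a ℕ.+ p
    swap = ℕ-Solver.solve-∀
    step : ∀ g → Periodic g → S (g ∘ suc) ≡ S g
    step g per-g = begin
      S (g ∘ suc)              ≡⟨ cancel (g 0) (S (g ∘ suc)) ⟨
      (g 0 + S (g ∘ suc)) - g 0 ≡⟨ cong (_- g 0) (Σ-upTo-suc p g) ⟨
      Σ (upTo (suc p)) g - g 0 ≡⟨ cong (_- g 0) (Σ-upTo-last p g) ⟩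
      (S g + g p) - g 0        ≡⟨ cong (λ z → (S g + z) - g 0) (per-g 0) ⟩
      (S g + g 0) - g 0        ≡⟨ cancel′ (g 0) (S g) ⟩
      S g                      ∎
      where
      cancel : ∀ x y → (x + y) - x ≡ y
      cancel = solve-∀
      cancel′ : ∀ x y → (y + x) - x ≡ y
      cancel′ = solve-∀

  -- p² times the variance of f on ℤ/p.
  V : (ℕ → ℤ) → ℤ
  V f = P * S (λ b → f b * f b) - S f * S f

  -- The Dirichlet energy of `f` on the Cayley graph of the step `d`.
  E : ℕ → (ℕ → ℤ) → ℤ
  E d f = S (λ b → (f b - f (b ℕ.+ d)) * (f b - f (b ℕ.+ d)))

  E-nonneg : ∀ d f → 0ℤ ≤ E d f
  E-nonneg d f = Σ-nonneg (upTo p) (λ b → 0≤-sq (f b - f (b ℕ.+ d)))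

  sq-periodic : ∀ {f} → Periodic f → Periodic (λ b → f b * f b)
  sq-periodic per b = cong₂ _*_ (per b) (per b)

  E-expand : ∀ {f} → Periodic f → ∀ d →
             E d f ≡ + 2 * S (λ b → f b * f b) - + 2 * S (λ b → f b * f (b ℕ.+ d))
  E-expand {f} per d = begin
    E d f
      ≡⟨ Σ-cong (upTo p) (λ b → expand (f b) (f (b ℕ.+ d))) ⟩
    S (λ b → (f b * f b + f (b ℕ.+ d) * f (b ℕ.+ d)) - + 2 * (f b * f (b ℕ.+ d)))
      ≡⟨ Σ-- (upTo p) _ _ ⟩
    S (λ b → f b * f b + f (b ℕ.+ d) * f (b ℕ.+ d)) - S (λ b → + 2 * (f b * f (b ℕ.+ d)))
      ≡⟨ cong₂ _-_ (Σ-+ (upTo p) _ _) (Σ-* (+ 2) (upTo p) _) ⟩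
    (S (λ b → f b * f b) + S (λ b → f (b ℕ.+ d) * f (b ℕ.+ d))) - + 2 * S (λ b → f b * f (b ℕ.+ d))
      ≡⟨ cong (λ z → (S (λ b → f b * f b) + z) - + 2 * S (λ b → f b * f (b ℕ.+ d))) (S-shift (sq-periodic per) d) ⟩
    (S (λ b → f b * f b) + S (λ b → f b * f b)) - + 2 * S (λ b → f b * f (b ℕ.+ d))
      ≡⟨ collect (S (λ b → f b * f b)) (S (λ b → f b * f (b ℕ.+ d))) ⟩
    + 2 * S (λ b → f b * f b) - + 2 * S (λ b → f b * f (b ℕ.+ d)) ∎
    where
    open ≡-Reasoning
    expand : ∀ x y → (x - y) * (x - y) ≡ (x * x + y * y) - + 2 * (x * y)
    expand = solve-∀
    collect : ∀ x y → (x + x) - + 2 * y ≡ + 2 * x - + 2 * y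
    collect = solve-∀

  -- The variance is an average of squared differences over all pairs. Pairs at distance `j`
  -- contribute `E j f`, and the mixed products add up to the square of `S f`.
  2V≡ΣE : ∀ {f} → Periodic f → S (λ j → E j f) ≡ + 2 * V f
  2V≡ΣE {f} per = begin
    S (λ j → E j f)
      ≡⟨ Σ-cong (upTo p) (E-expand per) ⟩
    S (λ j → + 2 * S2 - + 2 * S (λ b → f b * f (b ℕ.+ j)))
      ≡⟨ Σ-- (upTo p) _ _ ⟩
    S (λ j → + 2 * S2) - S (λ j → + 2 * S (λ b → f b * f (b ℕ.+ j)))
      ≡⟨ cong₂ _-_ (S-const (+ 2 * S2)) (Σ-* (+ 2) (upTo p) _) ⟩
    P * (+ 2 * S2) - + 2 * S (λ j → S (λ b → f b * f (b ℕ.+ j)))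
      ≡⟨ cong (λ z → P * (+ 2 * S2) - + 2 * z) (Σ-swap (upTo p) (upTo p) _) ⟩
    P * (+ 2 * S2) - + 2 * S (λ b → S (λ j → f b * f (b ℕ.+ j)))
      ≡⟨ cong (λ z → P * (+ 2 * S2) - + 2 * z) (trans (Σ-cong (upTo p) inner) (Σ-*ʳ (S f) (upTo p) f)) ⟩
    P * (+ 2 * S2) - + 2 * (S f * S f)
      ≡⟨ collect P S2 (S f) ⟩
    + 2 * V f ∎
    where
    open ≡-Reasoning
    S2 : ℤ
    S2 = S (λ b → f b * f b)
    inner : ∀ b → S (λ j → f b * f (b ℕ.+ j)) ≡ f b * S f
    inner b = trans (Σ-* (f b) (upTo p) _) (cong (λ z → f b * z)
      (trans (Σ-cong (upTo p) (λ j → cong f (ℕₚ.+-comm b j))) (S-shift per b)))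
    collect : ∀ P x y → P * (+ 2 * x) - + 2 * (y * y) ≡ + 2 * (P * x - y * y)
    collect = solve-∀

  -- A further coordinate with coefficient `a` turns the hit counts `f` of a form into exactly this
  -- sum (see `hits-cons`). The parallelogram law identifies the variance that is lost as an energy.
  V-average : ∀ {f} → Periodic f → ∀ a → V (λ b → f (b ℕ.+ a) + f b) ≡ + 4 * V f - P * E a f
  V-average {f} per a = begin
    P * S (λ b → (f (b ℕ.+ a) + f b) * (f (b ℕ.+ a) + f b)) - S g * S g
      ≡⟨ cong₂ (λ y z → P * y - z * z) squares sums ⟩
    P * ((+ 2 * S2 + + 2 * S2) - E a f) - (S f + S f) * (S f + S f)
      ≡⟨ collect P S2 (E a f) (S f) ⟩
    + 4 * V f - P * E a f ∎
    where
    open ≡-Reasoning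
    g : ℕ → ℤ
    g b = f (b ℕ.+ a) + f b
    S2 : ℤ
    S2 = S (λ b → f b * f b)
    sums : S g ≡ S f + S f
    sums = trans (Σ-+ (upTo p) _ f) (cong (_+ S f) (S-shift per a))
    parallelogram : ∀ x y → (x + y) * (x + y) ≡ (+ 2 * (x * x) + + 2 * (y * y)) - (y - x) * (y - x)
    parallelogram = solve-∀
    squares : S (λ b → (f (b ℕ.+ a) + f b) * (f (b ℕ.+ a) + f b)) ≡ (+ 2 * S2 + + 2 * S2) - E a f
    squares = begin
      S (λ b → (f (b ℕ.+ a) + f b) * (f (b ℕ.+ a) + f b))
        ≡⟨ Σ-cong (upTo p) (λ b → parallelogram (f (b ℕ.+ a)) (f b)) ⟩
      S (λ b → (+ 2 * (f (b ℕ.+ a) * f (b ℕ.+ a)) + + 2 * (f b * f b)) - (f b - f (b ℕ.+ a)) * (f b - f (b ℕ.+ a)))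
        ≡⟨ Σ-- (upTo p) _ _ ⟩
      S (λ b → + 2 * (f (b ℕ.+ a) * f (b ℕ.+ a)) + + 2 * (f b * f b)) - E a f
        ≡⟨ cong (_- E a f) (Σ-+ (upTo p) _ _) ⟩
      (S (λ b → + 2 * (f (b ℕ.+ a) * f (b ℕ.+ a))) + S (λ b → + 2 * (f b * f b))) - E a f
        ≡⟨ cong (_- E a f) (cong₂ _+_ (trans (Σ-* (+ 2) (upTo p) _) (cong (λ z → + 2 * z) (S-shift (sq-periodic per) a))) (Σ-* (+ 2) (upTo p) _)) ⟩
      (+ 2 * S2 + + 2 * S2) - E a f ∎
    collect : ∀ P x e y → P * ((+ 2 * x + + 2 * x) - e) - (y + y) * (y + y) ≡ + 4 * (P * x - y * y) - P * e
    collect = solve-∀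

  E-triangle : ∀ {f} → Periodic f → ∀ c d → E (c ℕ.+ d) f ≤ + 2 * E c f + + 2 * E d f
  E-triangle {f} per c d = begin
    E (c ℕ.+ d) f
      ≤⟨ Σ-mono (upTo p) (λ b → pointwise (f b) (f (b ℕ.+ c)) (f (b ℕ.+ (c ℕ.+ d)))) ⟩
    S (λ b → + 2 * ((f b - f (b ℕ.+ c)) * (f b - f (b ℕ.+ c))) + + 2 * ((f (b ℕ.+ c) - f (b ℕ.+ (c ℕ.+ d))) * (f (b ℕ.+ c) - f (b ℕ.+ (c ℕ.+ d)))))
      ≡⟨ Σ-+ (upTo p) _ _ ⟩
    S (λ b → + 2 * ((f b - f (b ℕ.+ c)) * (f b - f (b ℕ.+ c)))) + S (λ b → + 2 * ((f (b ℕ.+ c) - f (b ℕ.+ (c ℕ.+ d))) * (f (b ℕ.+ c) - f (b ℕ.+ (c ℕ.+ d)))))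
      ≡⟨ cong₂ _+_ (Σ-* (+ 2) (upTo p) _) (trans (Σ-* (+ 2) (upTo p) _) (cong (λ z → + 2 * z) moved)) ⟩
    + 2 * E c f + + 2 * E d f ∎
    where
    open ≤-Reasoning
    slack : ∀ x y z → (+ 2 * ((x - y) * (x - y)) + + 2 * ((y - z) * (y - z))) - (x - z) * (x - z)
                      ≡ (x - y - (y - z)) * (x - y - (y - z))
    slack = solve-∀
    pointwise : ∀ x y z → (x - z) * (x - z) ≤ + 2 * ((x - y) * (x - y)) + + 2 * ((y - z) * (y - z))
    pointwise x y z = ≤-cert (0≤-sq (x - y - (y - z))) (slack x y z)
    swap : ∀ b p d → b ℕ.+ p ℕ.+ d ≡ b ℕ.+ d ℕ.+ p
    swap = ℕ-Solver.solve-∀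
    G : ℕ → ℤ
    G b = (f b - f (b ℕ.+ d)) * (f b - f (b ℕ.+ d))
    G-per : Periodic G
    G-per b = cong₂ (λ y z → (y - z) * (y - z)) (per b) (trans (cong f (swap b p d)) (per _))
    moved : S (λ b → (f (b ℕ.+ c) - f (b ℕ.+ (c ℕ.+ d))) * (f (b ℕ.+ c) - f (b ℕ.+ (c ℕ.+ d)))) ≡ E d f
    moved = trans
      (Σ-cong (upTo p) (λ b → cong (λ z → (f (b ℕ.+ c) - f z) * (f (b ℕ.+ c) - f z)) (sym (ℕₚ.+-assoc b c d))))
      (S-shift G-per c)

  -- Walk from `b` to `b + k a` in steps of length `a`, using `E-triangle` at each step. The crude
  -- factor 4 per step is affordable, since fewer than p steps are ever taken.
  E-multiple : ∀ {f} → Periodic f → ∀ a k → E (k ℕ.* a) f ≤ + (4 ℕ.^ k) * E a f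
  E-multiple {f} per a zero = begin
    E 0 f                  ≡⟨ Σ-cong (upTo p) (λ b → trans (cong (λ z → (f b - f z) * (f b - f z)) (ℕₚ.+-identityʳ b)) (vanish (f b))) ⟩
    S (λ _ → 0ℤ)           ≡⟨ Σ-zero (upTo p) ⟩
    0ℤ                     ≤⟨ E-nonneg a f ⟩
    E a f                  ≡⟨ *-identityˡ _ ⟨
    + 1 * E a f            ∎
    where
    open ≤-Reasoning
    vanish : ∀ x → (x - x) * (x - x) ≡ 0ℤ
    vanish = solve-∀
  E-multiple {f} per a (suc k) = begin
    E (a ℕ.+ k ℕ.* a) f                              ≤⟨ E-triangle per a (k ℕ.* a) ⟩
    + 2 * E a f + + 2 * E (k ℕ.* a) f                 ≤⟨ +-mono-≤ (*-monoˡ (0≤+ 2) grow) (*-monoˡ (0≤+ 2) (E-multiple per a k)) ⟩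
    + 2 * (+ (4 ℕ.^ k) * E a f) + + 2 * (+ (4 ℕ.^ k) * E a f) ≡⟨ collect (+ (4 ℕ.^ k)) (E a f) ⟩
    + 4 * + (4 ℕ.^ k) * E a f                         ≡⟨ cong (_* E a f) (pos-* 4 (4 ℕ.^ k)) ⟨
    + (4 ℕ.^ suc k) * E a f                          ∎
    where
    open ≤-Reasoning
    collect : ∀ x y → + 2 * (x * y) + + 2 * (x * y) ≡ + 4 * x * y
    collect = solve-∀
    grow : E a f ≤ + (4 ℕ.^ k) * E a f
    grow = subst (_≤ + (4 ℕ.^ k) * E a f) (*-identityˡ _)
      (*-monoʳ-≤-nonNeg (E a f) {{nonNegative (E-nonneg a f)}} (+≤+ (ℕ.>-nonZero⁻¹ _ {{ℕₚ.m^n≢0 4 k}})))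

  E-bound : ∀ {f} → Periodic f → ∀ {a} → p ∤ a → ∀ j → E j f ≤ + (4 ℕ.^ p) * E a f
  -- `p-1 * j` is minus `j` modulo p, so the solution `k` satisfies k a = j modulo p: every distance
  -- is a multiple of `a`.
  E-bound {f} per {a} p∤a j = go (solvable p∤a (p-1 ℕ.* j))
    where
    go : (∃ λ k → k ℕ.< p × p ∣ p-1 ℕ.* j ℕ.+ k ℕ.* a) → E j f ≤ + (4 ℕ.^ p) * E a f
    go (k , k<p , divides q eq) = begin
      E j f                ≡⟨ Σ-cong (upTo p) (λ b → cong (λ z → (f b - z) * (f b - z)) (same b)) ⟩
      E (k ℕ.* a) f        ≤⟨ E-multiple per a k ⟩
      + (4 ℕ.^ k) * E a f  ≤⟨ *-monoʳ-≤-nonNeg (E a f) {{nonNegative (E-nonneg a f)}} (+≤+ (ℕₚ.^-monoʳ-≤ 4 (ℕₚ.<⇒≤ k<p))) ⟩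
      + (4 ℕ.^ p) * E a f  ∎
      where
      open ≤-Reasoning
      rearr : ∀ q j k → q ℕ.* j ℕ.+ k ℕ.+ j ≡ k ℕ.+ j ℕ.* (1 ℕ.+ q)
      rearr = ℕ-Solver.solve-∀
      arith : k ℕ.* a ℕ.+ j ℕ.* p ≡ j ℕ.+ q ℕ.* p
      arith = trans (cong (λ z → k ℕ.* a ℕ.+ j ℕ.* z) p≡)
        (trans (sym (rearr p-1 j (k ℕ.* a))) (trans (cong (ℕ._+ j) eq) (ℕₚ.+-comm (q ℕ.* p) j)))
      same : ∀ b → f (b ℕ.+ j) ≡ f (b ℕ.+ k ℕ.* a)
      same b = begin-equality
        f (b ℕ.+ j)                       ≡⟨ periodic-* per (b ℕ.+ j) q ⟨
        f (b ℕ.+ j ℕ.+ q ℕ.* p)           ≡⟨ cong f (ℕₚ.+-assoc b j _) ⟩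
        f (b ℕ.+ (j ℕ.+ q ℕ.* p))         ≡⟨ cong (λ z → f (b ℕ.+ z)) arith ⟨
        f (b ℕ.+ (k ℕ.* a ℕ.+ j ℕ.* p))   ≡⟨ cong f (ℕₚ.+-assoc b _ _) ⟨
        f (b ℕ.+ k ℕ.* a ℕ.+ j ℕ.* p)     ≡⟨ periodic-* per (b ℕ.+ k ℕ.* a) j ⟩
        f (b ℕ.+ k ℕ.* a)                 ∎

  -- Poincaré inequality on the cycle generated by a.
  V-bound : ∀ {f} → Periodic f → ∀ {a} → p ∤ a → + 2 * V f ≤ P * (+ (4 ℕ.^ p) * E a f)
  V-bound {f} per {a} p∤a = begin
    + 2 * V f                            ≡⟨ 2V≡ΣE per ⟨
    S (λ j → E j f)                      ≤⟨ Σ-mono (upTo p) (E-bound per p∤a) ⟩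
    S (λ _ → + (4 ℕ.^ p) * E a f)        ≡⟨ S-const _ ⟩
    P * (+ (4 ℕ.^ p) * E a f)            ∎
    where open ≤-Reasoning

  V-nonneg : ∀ {f} → Periodic f → 0ℤ ≤ V f
  V-nonneg {f} per = *-cancelˡ-≤-pos (0ℤ) (V f) (+ 2)
    (subst (0ℤ ≤_) (2V≡ΣE per) (Σ-nonneg (upTo p) (λ j → E-nonneg j f)))

  -- `P * V f` is the sum of (P f(c) - S f)² over a period, and the left side is one of its terms;
  -- starting the period at `b` makes it the first one.
  deviation-bound : ∀ {f} → Periodic f → ∀ b → (P * f b - S f) * (P * f b - S f) ≤ P * V f
  deviation-bound {f} per b = begin
    G b                        ≤⟨ first ⟩
    S (λ c → G (c ℕ.+ b))      ≡⟨ S-shift G-per b ⟩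
    S G                        ≡⟨ Σ-cong (upTo p) (λ c → expand P (f c) (S f)) ⟩
    S (λ c → P * P * (f c * f c) - (+ 2 * P * S f * f c - S f * S f)) ≡⟨ Σ-- (upTo p) _ _ ⟩
    S (λ c → P * P * (f c * f c)) - S (λ c → + 2 * P * S f * f c - S f * S f)
      ≡⟨ cong₂ _-_ (Σ-* (P * P) (upTo p) _) (trans (Σ-- (upTo p) _ _) (cong₂ _-_ (Σ-* (+ 2 * P * S f) (upTo p) f) (S-const _))) ⟩
    P * P * S (λ c → f c * f c) - (+ 2 * P * S f * S f - P * (S f * S f)) ≡⟨ collect P (S (λ c → f c * f c)) (S f) ⟩
    P * V f                    ∎
    where
    open ≤-Reasoning
    G : ℕ → ℤ
    G c = (P * f c - S f) * (P * f c - S f)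
    G-per : Periodic G
    G-per c = cong (λ z → (P * z - S f) * (P * z - S f)) (per c)
    expand : ∀ P x s → (P * x - s) * (P * x - s) ≡ P * P * (x * x) - (+ 2 * P * s * x - s * s)
    expand = solve-∀
    collect : ∀ P x s → P * P * x - (+ 2 * P * s * s - P * (s * s)) ≡ P * (P * x - s * s)
    collect = solve-∀
    first : G b ≤ S (λ c → G (c ℕ.+ b))
    first = subst (λ k → G b ≤ Σ (upTo k) (λ c → G (c ℕ.+ b))) (sym p≡) (begin
      G b                                        ≡⟨ +-identityʳ _ ⟨
      G b + 0ℤ                                   ≤⟨ +-monoʳ-≤ (G b) (Σ-nonneg (upTo p-1) (λ c → 0≤-sq (P * f (suc c ℕ.+ b) - S f))) ⟩
      G b + Σ (upTo p-1) (λ c → G (suc c ℕ.+ b)) ≡⟨ Σ-upTo-suc p-1 (λ c → G (c ℕ.+ b)) ⟨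
      Σ (upTo (suc p-1)) (λ c → G (c ℕ.+ b))     ∎)

-- Sums over the cube, split by the first coordinate

module CubeSums where
  open import Data.Bool using (Bool; true; false)
  open import Data.Integer hiding (suc)
  open import Data.Integer.Properties
  import Data.Nat as ℕ
  open import Data.Nat using (zero; suc)
  open import Data.List using ([]; _∷_)
  import Data.List as List
  open import Data.Vec using (Vec; _∷_)
  open import Relation.Binary.PropositionalEquality
  open import Defs using (cube)
  open ℤΣ

  Σ-cube-suc : ∀ {n} (f : Vec Bool (suc n) → ℤ) →
               Σ (cube (suc n)) f ≡ Σ (cube n) (λ x → f (true ∷ x)) + Σ (cube n) (λ x → f (false ∷ x))
  Σ-cube-suc {n} f = begin
    Σ (cube (suc n)) f
      ≡⟨ Σ-concatMap (λ x → List.map (x ∷_) (cube n)) (true ∷ false ∷ []) f ⟩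
    Σ (List.map (true ∷_) (cube n)) f + (Σ (List.map (false ∷_) (cube n)) f + 0ℤ)
      ≡⟨ cong₂ _+_ (Σ-map (true ∷_) (cube n) f) (trans (+-identityʳ _) (Σ-map (false ∷_) (cube n) f)) ⟩
    Σ (cube n) (λ x → f (true ∷ x)) + Σ (cube n) (λ x → f (false ∷ x)) ∎
    where open ≡-Reasoning

  Σ-cube-1 : ∀ n → Σ (cube n) (λ _ → 1ℤ) ≡ + (2 ℕ.^ n)
  Σ-cube-1 zero = refl
  Σ-cube-1 (suc n) = begin
    Σ (cube (suc n)) (λ _ → 1ℤ)   ≡⟨ Σ-cube-suc {n} (λ _ → 1ℤ) ⟩
    Σ (cube n) (λ _ → 1ℤ) + Σ (cube n) (λ _ → 1ℤ) ≡⟨ cong (λ z → z + z) (Σ-cube-1 n) ⟩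
    + (2 ℕ.^ n) + + (2 ℕ.^ n)     ≡⟨ pos-+ (2 ℕ.^ n) (2 ℕ.^ n) ⟨
    + (2 ℕ.^ n ℕ.+ 2 ℕ.^ n)       ≡⟨ cong (λ z → + (2 ℕ.^ n ℕ.+ z)) (ℕₚ.+-identityʳ _) ⟨
    + (2 ℕ.^ suc n)               ∎
    where
    open ≡-Reasoning
    import Data.Nat.Properties as ℕₚ

-- Equidistribution of forms with many nonzero coefficients

module Equidistribution (p : ℕ) (p-prime : Prime p) where
  open import Data.Bool using (Bool; if_then_else_)
  open import Data.Integer hiding (suc)
  open import Data.Integer.Properties
  open import Data.Integer.Tactic.RingSolver using (solve-∀)
  import Data.Nat as ℕ
  import Data.Nat.Properties as ℕₚ
  import Data.Nat.Tactic.RingSolver as ℕ-Solver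
  open import Data.Nat using (zero; suc)
  open import Data.Nat.Divisibility using (_∣_; _∤_; _∣?_; ∣1⇒≡1)
  open import Data.Nat.Primality using (¬prime[1])
  open import Data.List using (upTo)
  open import Data.Vec using (Vec; []; _∷_)
  open import Data.Product using (_,_; ∃; _×_)
  open import Function using (_∘_)
  open import Relation.Nullary
  open import Relation.Binary.PropositionalEquality
  open import Defs using (cube; bit)
  open ℤΣ
  open CubeSums
  open Residues p p-prime
  open CyclicFunctions p p-prime

  private
    variable
      n : ℕ

  Σ-single : ∀ k {f : ℕ → ℤ} {u} → u ℕ.< k → f u ≡ 1ℤ → (∀ {v} → v ℕ.< k → v ≢ u → f v ≡ 0ℤ) →
             Σ (upTo k) f ≡ 1ℤ
  Σ-single (suc k) {f} {u} u<1+k fu≡1 others = trans (Σ-upTo-last k f) (by-cases (u ℕ.≟ k))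
    where
    all-zero : ∀ j → (∀ {v} → v ℕ.< j → f v ≡ 0ℤ) → Σ (upTo j) f ≡ 0ℤ
    all-zero zero _ = refl
    all-zero (suc j) z = trans (Σ-upTo-last j f)
      (cong₂ _+_ (all-zero j (λ v<j → z (ℕₚ.m<n⇒m<1+n v<j))) (z (ℕₚ.n<1+n j)))
    by-cases : Dec (u ≡ k) → Σ (upTo k) f + f k ≡ 1ℤ
    by-cases (yes refl) = cong₂ _+_ (all-zero k (λ v<k → others (ℕₚ.m<n⇒m<1+n v<k) (ℕₚ.<⇒≢ v<k))) fu≡1
    by-cases (no u≢k) = cong₂ _+_
      (Σ-single k (ℕₚ.≤∧≢⇒< (ℕ.s≤s⁻¹ u<1+k) u≢k) fu≡1 (λ v<k → others (ℕₚ.m<n⇒m<1+n v<k)))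
      (others (ℕₚ.n<1+n k) (u≢k ∘ sym))

  S-δ-line : ∀ {a} → p ∤ a → ∀ β → S (λ u → δ (β ℕ.+ u ℕ.* a)) ≡ 1ℤ
  S-δ-line {a} p∤a β = go (solvable p∤a β)
    where
    go : (∃ λ u → u ℕ.< p × p ∣ β ℕ.+ u ℕ.* a) → S (λ u → δ (β ℕ.+ u ℕ.* a)) ≡ 1ℤ
    go (u , u<p , p∣) = Σ-single p u<p (δ-yes p∣)
      (λ v<p v≢u → δ-no (λ p∣v → v≢u (unique-solution p∤a v<p u<p p∣v p∣)))

  S-δ : ∀ β → S (λ b → δ (β ℕ.+ b)) ≡ 1ℤ
  S-δ β = trans (Σ-cong (upTo p) (λ b → cong (λ z → δ (β ℕ.+ z)) (sym (ℕₚ.*-identityʳ b))))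
    (S-δ-line (λ p∣1 → ¬prime[1] (subst Prime (∣1⇒≡1 p∣1) p-prime)) β)

  δ-idem : ∀ z → δ z * δ z ≡ δ z
  δ-idem z = by-cases (p ∣? z)
    where
    by-cases : Dec (p ∣ z) → δ z * δ z ≡ δ z
    by-cases (yes d) = trans (cong₂ _*_ (δ-yes d) (δ-yes d)) (sym (δ-yes d))
    by-cases (no d) = trans (cong₂ _*_ (δ-no d) (δ-no d)) (sym (δ-no d))

  dot : Vec ℕ n → Vec Bool n → ℕ
  dot [] [] = 0
  dot (a ∷ v) (x ∷ xs) = a ℕ.* bit x ℕ.+ dot v xs

  wt : Vec ℕ n → ℕ
  wt [] = 0
  wt (a ∷ v) = (if does (p ∣? a) then 0 else 1) ℕ.+ wt v

  hits : Vec ℕ n → ℕ → ℤ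
  hits {n} v b = Σ (cube n) (λ x → δ (dot v x ℕ.+ b))

  -- If the first bit is 1, its coefficient can be moved into the residue. This recursion drives the
  -- induction on the coefficients.
  hits-cons : ∀ a (v : Vec ℕ n) b → hits (a ∷ v) b ≡ hits v (b ℕ.+ a) + hits v b
  hits-cons {n} a v b = trans (Σ-cube-suc {n} _) (cong₂ _+_
    (Σ-cong (cube n) (λ x → cong δ (move a (dot v x) b)))
    (Σ-cong (cube n) (λ x → cong δ (drop a (dot v x) b))))
    where
    move : ∀ a d b → a ℕ.* 1 ℕ.+ d ℕ.+ b ≡ d ℕ.+ (b ℕ.+ a)
    move = ℕ-Solver.solve-∀
    drop : ∀ a d b → a ℕ.* 0 ℕ.+ d ℕ.+ b ≡ d ℕ.+ b
    drop = ℕ-Solver.solve-∀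

  hits-periodic : (v : Vec ℕ n) → Periodic (hits v)
  hits-periodic {n} v b = Σ-cong (cube n) (λ x →
    trans (cong δ (sym (ℕₚ.+-assoc (dot v x) b p))) (δ-periodic (dot v x ℕ.+ b)))

  N : ℕ → ℤ
  N n = + (2 ℕ.^ n)

  0≤N : ∀ n → 0ℤ ≤ N n
  0≤N n = 0≤+ (2 ℕ.^ n)

  S-hits : (v : Vec ℕ n) → S (hits v) ≡ N n
  S-hits {n} v = trans (Σ-swap (upTo p) (cube n) _) (trans (Σ-cong (cube n) (λ x → S-δ (dot v x))) (Σ-cube-1 n))

  -- Chosen so that `V-bound` becomes 4 V ≤ B P E, hence 4 V - P E ≤ 4 (1 - 1/B) V.
  B : ℤ
  B = + 2 * + (4 ℕ.^ p)

  0<B : 0ℤ < B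
  0<B = subst (0ℤ <_) (pos-* 2 (4 ℕ.^ p)) (+<+ (ℕₚ.≤-trans (ℕ.>-nonZero⁻¹ _ {{ℕₚ.m^n≢0 4 p}}) (ℕₚ.m≤m+n _ _)))

  private
    V-cong : ∀ {f g} → (∀ b → f b ≡ g b) → V f ≡ V g
    V-cong eq = cong₂ (λ y z → P * y - z * z) (Σ-cong (upTo p) (λ b → cong₂ _*_ (eq b) (eq b))) (Σ-cong (upTo p) eq)

    V-hits-cons : ∀ a (v : Vec ℕ n) → V (hits (a ∷ v)) ≡ + 4 * V (hits v) - P * E a (hits v)
    V-hits-cons a v = trans (V-cong (hits-cons a v)) (V-average (hits-periodic v) a)

    N-suc : ∀ n → N (suc n) * N (suc n) ≡ + 4 * (N n * N n)
    N-suc n = trans (cong (λ z → z * z) (pos-* 2 (2 ℕ.^ n))) (four (N n))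
      where
      four : ∀ x → (+ 2 * x) * (+ 2 * x) ≡ + 4 * (x * x)
      four = solve-∀

  -- The shift of wt v by B makes the bound inductive: each nonzero coefficient multiplies V by
  -- at most 4 (1 − 1/B), and (w + 1 + B)(1 − 1/B) ≤ w + B.
  variance-bound : (v : Vec ℕ n) → (+ wt v + B) * V (hits v) ≤ B * P * (N n * N n)
  variance-bound [] = begin
    (+ 0 + B) * V (hits [])        ≡⟨ cong₂ _*_ (+-identityˡ B) V-base ⟩
    B * (P * 1ℤ - 1ℤ * 1ℤ)         ≤⟨ *-monoˡ (<⇒≤ 0<B) (≤-cert (0≤+ 1) (slack P)) ⟩
    B * P                          ≡⟨ *-identityʳ (B * P) ⟨
    B * P * (1ℤ * 1ℤ)              ∎
    where
    open ≤-Reasoning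
    slack : ∀ x → x - (x * 1ℤ - 1ℤ * 1ℤ) ≡ 1ℤ
    slack = solve-∀
    one : ∀ b → hits [] b ≡ δ b
    one b = +-identityʳ _
    V-base : V (hits []) ≡ P * 1ℤ - 1ℤ * 1ℤ
    V-base = trans (V-cong one) (cong₂ (λ y z → P * y - z * z)
      (trans (Σ-cong (upTo p) δ-idem) (S-δ 0)) (S-δ 0))
  variance-bound {suc n} (a ∷ v) = by-cases (p ∣? a) refl
    where
    open ≤-Reasoning
    W : ℤ
    W = + wt v
    Vv E′ : ℤ
    Vv = V (hits v)
    E′ = E a (hits v)
    IH : (W + B) * Vv ≤ B * P * (N n * N n)
    IH = variance-bound v
    goal : ℤ → Set
    goal w = (w + B) * V (hits (a ∷ v)) ≤ B * P * (N (suc n) * N (suc n))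
    0≤W : 0ℤ ≤ W
    0≤W = 0≤+ (wt v)
    0≤V : 0ℤ ≤ Vv
    0≤V = V-nonneg (hits-periodic v)
    rhs : + 4 * (B * P * (N n * N n)) ≡ B * P * (N (suc n) * N (suc n))
    rhs = trans (rearr (B * P) (N n * N n)) (cong (λ z → B * P * z) (sym (N-suc n)))
      where
      rearr : ∀ x y → + 4 * (x * y) ≡ x * (+ 4 * y)
      rearr = solve-∀
    zero-coefficient : goal W
    zero-coefficient = begin
      (W + B) * V (hits (a ∷ v))   ≡⟨ cong (λ z → (W + B) * z) (V-hits-cons a v) ⟩
      (W + B) * (+ 4 * Vv - P * E′) ≤⟨ ≤-cert (0≤-* (0≤-+ 0≤W (<⇒≤ 0<B)) (0≤-* 0≤P (E-nonneg a (hits v)))) (slack (W + B) Vv P E′) ⟩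
      + 4 * ((W + B) * Vv)         ≤⟨ *-monoˡ (0≤+ 4) IH ⟩
      + 4 * (B * P * (N n * N n))  ≡⟨ rhs ⟩
      B * P * (N (suc n) * N (suc n)) ∎
      where
      slack : ∀ c x P e → + 4 * (c * x) - c * (+ 4 * x - P * e) ≡ c * (P * e)
      slack = solve-∀
    nonzero-coefficient : p ∤ a → goal (1ℤ + W)
    nonzero-coefficient p∤a = *-cancelˡ-≤-pos _ _ B {{positive 0<B}} (begin
      B * ((1ℤ + W + B) * V (hits (a ∷ v)))    ≡⟨ cong (λ z → B * ((1ℤ + W + B) * z)) (V-hits-cons a v) ⟩
      B * ((1ℤ + W + B) * (+ 4 * Vv - P * E′)) ≤⟨ ≤-cert nonneg (slack Q W Vv P E′) ⟩
      + 4 * (B * ((W + B) * Vv))               ≤⟨ *-monoˡ (0≤+ 4) (*-monoˡ (<⇒≤ 0<B) IH) ⟩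
      + 4 * (B * (B * P * (N n * N n)))        ≡⟨ rearr B (B * P * (N n * N n)) ⟩
      B * (+ 4 * (B * P * (N n * N n)))        ≡⟨ cong (λ z → B * z) rhs ⟩
      B * (B * P * (N (suc n) * N (suc n)))    ∎)
      where
      Q : ℤ
      Q = + (4 ℕ.^ p)
      rearr : ∀ x y → + 4 * (x * y) ≡ x * (+ 4 * y)
      rearr = solve-∀
      nonneg : 0ℤ ≤ + 2 * ((1ℤ + W + B) * (P * (Q * E′) - + 2 * Vv)) + + 4 * ((1ℤ + W) * Vv)
      nonneg = 0≤-+
        (0≤-* (0≤+ 2) (0≤-* (0≤-+ (0≤-+ (0≤+ 1) 0≤W) (<⇒≤ 0<B)) (i≤j⇒0≤j-i (V-bound (hits-periodic v) p∤a))))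
        (0≤-* (0≤+ 4) (0≤-* (0≤-+ (0≤+ 1) 0≤W) 0≤V))
      slack : ∀ Q W x P e →
        + 4 * (+ 2 * Q * ((W + + 2 * Q) * x)) - + 2 * Q * ((1ℤ + W + + 2 * Q) * (+ 4 * x - P * e))
        ≡ + 2 * ((1ℤ + W + + 2 * Q) * (P * (Q * e) - + 2 * x)) + + 4 * ((1ℤ + W) * x)
      slack = solve-∀
    by-cases : (d : Dec (p ∣ a)) → d ≡ (p ∣? a) → goal (+ wt (a ∷ v))
    by-cases (yes p∣a) eq = subst (λ d → goal (+ ((if does d then 0 else 1) ℕ.+ wt v))) eq zero-coefficient
    by-cases (no p∤a) eq = subst (λ d → goal (+ ((if does d then 0 else 1) ℕ.+ wt v))) eq (nonzero-coefficient p∤a)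

  sq-≤⇒≤ : ∀ {x y} → 0ℤ ≤ y → x * x ≤ y * y → x ≤ y
  sq-≤⇒≤ {x} {y} 0≤y xx≤yy = by-cases (x ≤? y)
    where
    by-cases : Dec (x ≤ y) → x ≤ y
    by-cases (yes x≤y) = x≤y
    by-cases (no x≰y) = contradiction xx≤yy (<⇒≱ (begin-strict
      y * y ≤⟨ *-monoˡ 0≤y (<⇒≤ y<x) ⟩
      y * x <⟨ *-monoʳ-<-pos x {{positive (≤-<-trans 0≤y y<x)}} y<x ⟩
      x * x ∎))
      where
      open ≤-Reasoning
      y<x : y < x
      y<x = ≰⇒> x≰y

  -- By `deviation-bound` and `variance-bound` the squared deviation is at most P² B N² / wt v, and
  -- this is below (N / Θ)² once the weight exceeds Θ² P² B. The upper bound on the hits is the side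
  -- that `bessel` asks for, as its inner products are bounded from above.
  equidistribution : ∀ {Θ} (v : Vec ℕ n) b → + Θ * + Θ * (P * P * B) < + wt v →
                     + Θ * (P * hits v b - N n) ≤ N n
  equidistribution {n} {Θ} v b heavy = sq-≤⇒≤ (0≤N n) (*-cancelˡ-≤-pos _ _ W {{positive 0<W}} (begin
    W * (T * y * (T * y))            ≡⟨ rearr W T y ⟩
    T * T * (W * (y * y))            ≤⟨ *-monoˡ (0≤-sq T) (*-monoˡ 0≤W deviation) ⟩
    T * T * (W * (P * Vv))           ≤⟨ ≤-cert (0≤-* (0≤-* (0≤-sq T) 0≤P) (0≤-+ (i≤j⇒0≤j-i (variance-bound v)) (0≤-* (<⇒≤ 0<B) 0≤V))) (slack T W P Vv B (N n)) ⟩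
    T * T * (P * P * B) * (N n * N n) ≤⟨ *-monoʳ-≤-nonNeg (N n * N n) {{nonNegative (0≤-sq (N n))}} (<⇒≤ heavy) ⟩
    W * (N n * N n)                  ∎))
    where
    open ≤-Reasoning
    T W y Vv : ℤ
    T = + Θ
    W = + wt v
    y = P * hits v b - N n
    Vv = V (hits v)
    0≤W : 0ℤ ≤ W
    0≤W = 0≤+ (wt v)
    0≤V : 0ℤ ≤ Vv
    0≤V = V-nonneg (hits-periodic v)
    0<W : 0ℤ < W
    0<W = ≤-<-trans (0≤-* (0≤-sq T) (0≤-* (0≤-sq P) (<⇒≤ 0<B))) heavy
    deviation : y * y ≤ P * Vv
    deviation = subst (λ z → (P * hits v b - z) * (P * hits v b - z) ≤ P * Vv) (S-hits v)
      (deviation-bound (hits-periodic v) b)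
    rearr : ∀ W T y → W * (T * y * (T * y)) ≡ T * T * (W * (y * y))
    rearr = solve-∀
    slack : ∀ T W P x B N → T * T * (P * P * B) * (N * N) - T * T * (W * (P * x))
            ≡ T * T * P * ((B * P * (N * N) - (W + B) * x) + B * x)
    slack = solve-∀

-- Bessel's inequality for almost orthogonal functions

module Bessel where
  open import Data.Integer hiding (suc)
  open import Data.Integer.Properties
  open import Data.Integer.Tactic.RingSolver using (solve-∀)
  open import Data.List using (List; []; _∷_; length)
  open import Data.List.Relation.Unary.All using (All; []; _∷_)
  open import Data.List.Relation.Unary.AllPairs using (AllPairs; []; _∷_)
  open import Data.Sum using (_⊎_; inj₁; inj₂)
  open import Relation.Binary.PropositionalEquality
  open ℤΣ

  -- A set correlating with many almost orthogonal functions: bound the correlation with their sum F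
  -- through 2 r L F ≤ r² + L² F², where r is the number of functions.
  bessel : {X : Set} (xs : List X) (B : X → ℤ) → (∀ x → B x ≡ 0ℤ ⊎ B x ≡ 1ℤ) →
           (M : ℤ) → Σ xs (λ _ → 1ℤ) ≡ M → 0ℤ < M → (L q : ℤ) → 0ℤ ≤ q → (hs : List (X → ℤ)) →
           All (λ h → M ≤ L * Σ xs (λ x → B x * h x)) hs →
           All (λ h → Σ xs (λ x → h x * h x) ≤ q * M) hs →
           AllPairs (λ h k → + 2 * (L * L) * Σ xs (λ x → h x * k x) ≤ M) hs →
           + length hs ≤ + 2 * (L * L) * q
  bessel xs B B01 M M≡ 0<M L q 0≤q [] _ _ _ = 0≤-* (0≤-* (0≤+ 2) (0≤-sq L)) 0≤q
  bessel {X} xs B B01 M M≡ 0<M L q 0≤q hs@(_ ∷ _) correlated norms orthogonal =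
    -- In L² times the sum of F², the cross terms amount to at most r² M / 2, because of the factor
    -- 2 in the orthogonality hypothesis. Against the 2 r² M supplied by `lower` and the r² M lost
    -- in `upper`, half of r² M remains and is bounded by L² q r M. The list is non-empty, so r M
    -- can be cancelled.
    *-cancelˡ-≤-pos _ _ r (*-cancelʳ-≤-pos _ _ M {{positive 0<M}} (≤-cert
      (0≤-+ (0≤-+ (0≤-* (0≤+ 2) (i≤j⇒0≤j-i upper)) (i≤j⇒0≤j-i (energy hs norms orthogonal)))
            (0≤-* (0≤-* (0≤+ 4) (0≤+ (length hs))) (i≤j⇒0≤j-i (lower hs correlated))))
      (combine r M L q (Σ xs (λ x → B x * F hs x)) (Σ xs (λ x → F hs x * F hs x)))))
    where
    open ≤-Reasoning
    r : ℤ
    r = + length hs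
    F : List (X → ℤ) → X → ℤ
    F gs x = Σ gs (λ h → h x)

    combine : ∀ r M L q b e →
      r * (+ 2 * (L * L) * q) * M - r * r * M
      ≡ + 2 * ((r * r * M + L * L * e) - + 2 * r * L * b)
        + ((+ 2 * (L * L) * (r * q * M) + r * r * M) - + 2 * (L * L) * e)
        + + 4 * r * (L * b - r * M)
    combine = solve-∀

    pointwise : ∀ b f → b ≡ 0ℤ ⊎ b ≡ 1ℤ → + 2 * r * L * (b * f) ≤ r * r * 1ℤ + L * L * (f * f)
    pointwise b f (inj₁ refl) = ≤-cert (0≤-+ (0≤-sq r) (0≤-sq (L * f))) (slack r L f)
      where
      slack : ∀ r L f → (r * r * 1ℤ + L * L * (f * f)) - + 2 * r * L * (0ℤ * f) ≡ r * r + (L * f) * (L * f)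
      slack = solve-∀
    pointwise b f (inj₂ refl) = ≤-cert (0≤-sq (r - L * f)) (slack r L f)
      where
      slack : ∀ r L f → (r * r * 1ℤ + L * L * (f * f)) - + 2 * r * L * (1ℤ * f) ≡ (r - L * f) * (r - L * f)
      slack = solve-∀

    upper : + 2 * r * L * Σ xs (λ x → B x * F hs x) ≤ r * r * M + L * L * Σ xs (λ x → F hs x * F hs x)
    upper = begin
      + 2 * r * L * Σ xs (λ x → B x * F hs x)
        ≡⟨ Σ-* (+ 2 * r * L) xs (λ x → B x * F hs x) ⟨
      Σ xs (λ x → + 2 * r * L * (B x * F hs x))
        ≤⟨ Σ-mono xs (λ x → pointwise (B x) (F hs x) (B01 x)) ⟩
      Σ xs (λ x → r * r * 1ℤ + L * L * (F hs x * F hs x))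
        ≡⟨ Σ-+ xs (λ x → r * r * 1ℤ) (λ x → L * L * (F hs x * F hs x)) ⟩
      Σ xs (λ x → r * r * 1ℤ) + Σ xs (λ x → L * L * (F hs x * F hs x))
        ≡⟨ cong₂ _+_ (trans (Σ-* (r * r) xs (λ _ → 1ℤ)) (cong (λ z → r * r * z) M≡)) (Σ-* (L * L) xs (λ x → F hs x * F hs x)) ⟩
      r * r * M + L * L * Σ xs (λ x → F hs x * F hs x) ∎

    lower : ∀ gs → All (λ h → M ≤ L * Σ xs (λ x → B x * h x)) gs →
            + length gs * M ≤ L * Σ xs (λ x → B x * F gs x)
    lower gs correlated = begin
      + length gs * M                              ≡⟨ Σ-const M gs ⟨
      Σ gs (λ _ → M)                               ≤⟨ Σ-mono∈ gs (All.lookup correlated) ⟩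
      Σ gs (λ h → L * Σ xs (λ x → B x * h x))      ≡⟨ Σ-* L gs (λ h → Σ xs (λ x → B x * h x)) ⟩
      L * Σ gs (λ h → Σ xs (λ x → B x * h x))      ≡⟨ cong (λ z → L * z) (Σ-swap gs xs (λ h x → B x * h x)) ⟩
      L * Σ xs (λ x → Σ gs (λ h → B x * h x))      ≡⟨ cong (λ z → L * z) (Σ-cong xs (λ x → Σ-* (B x) gs (λ h → h x))) ⟩
      L * Σ xs (λ x → B x * F gs x)                ∎
      where import Data.List.Relation.Unary.All as All

    energy : ∀ gs → All (λ h → Σ xs (λ x → h x * h x) ≤ q * M) gs →
             AllPairs (λ h k → + 2 * (L * L) * Σ xs (λ x → h x * k x) ≤ M) gs →
             + 2 * (L * L) * Σ xs (λ x → F gs x * F gs x) ≤ + 2 * (L * L) * (+ length gs * q * M) + + length gs * + length gs * M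
    energy [] [] [] = ≤-reflexive (trans (cong (λ z → + 2 * (L * L) * z) (Σ-zero xs)) (vanish L q M))
      where
      vanish : ∀ L q M → + 2 * (L * L) * 0ℤ ≡ + 2 * (L * L) * (0ℤ * q * M) + 0ℤ * 0ℤ * M
      vanish = solve-∀
    energy (h ∷ gs) (norm ∷ norms) (cross ∷ orthogonal) = ≤-cert
      (0≤-+ (0≤-+ (0≤-+ (0≤-* (0≤-* (0≤+ 2) (0≤-sq L)) (i≤j⇒0≤j-i norm)) (0≤-* (0≤+ 2) (i≤j⇒0≤j-i crossed))) (i≤j⇒0≤j-i (energy gs norms orthogonal))) (<⇒≤ 0<M))
      (trans (cong (λ e → (+ 2 * (L * L) * ((1ℤ + + length gs) * q * M) + (1ℤ + + length gs) * (1ℤ + + length gs) * M) - + 2 * (L * L) * e) expand)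
             (slack L q M (+ length gs) ⟨h,h⟩ ⟨h,F⟩ ⟨F,F⟩))
      where
      ⟨h,h⟩ ⟨h,F⟩ ⟨F,F⟩ : ℤ
      ⟨h,h⟩ = Σ xs (λ x → h x * h x)
      ⟨h,F⟩ = Σ xs (λ x → h x * F gs x)
      ⟨F,F⟩ = Σ xs (λ x → F gs x * F gs x)
      square : ∀ a b → (a + b) * (a + b) ≡ a * a + (+ 2 * (a * b) + b * b)
      square = solve-∀
      expand : Σ xs (λ x → (h x + F gs x) * (h x + F gs x)) ≡ ⟨h,h⟩ + (+ 2 * ⟨h,F⟩ + ⟨F,F⟩)
      expand = trans (Σ-cong xs (λ x → square (h x) (F gs x)))
        (trans (Σ-+ xs (λ x → h x * h x) (λ x → + 2 * (h x * F gs x) + F gs x * F gs x))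
          (cong (λ z → ⟨h,h⟩ + z) (trans (Σ-+ xs (λ x → + 2 * (h x * F gs x)) (λ x → F gs x * F gs x))
            (cong (λ z → z + ⟨F,F⟩) (Σ-* (+ 2) xs (λ x → h x * F gs x))))))
      crossed : + 2 * (L * L) * ⟨h,F⟩ ≤ + length gs * M
      crossed = begin
        + 2 * (L * L) * ⟨h,F⟩                                 ≡⟨ cong (λ z → + 2 * (L * L) * z) (Σ-cong xs (λ x → sym (Σ-* (h x) gs (λ k → k x)))) ⟩
        + 2 * (L * L) * Σ xs (λ x → Σ gs (λ k → h x * k x))   ≡⟨ cong (λ z → + 2 * (L * L) * z) (Σ-swap xs gs (λ x k → h x * k x)) ⟩
        + 2 * (L * L) * Σ gs (λ k → Σ xs (λ x → h x * k x))   ≡⟨ Σ-* (+ 2 * (L * L)) gs (λ k → Σ xs (λ x → h x * k x)) ⟨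
        Σ gs (λ k → + 2 * (L * L) * Σ xs (λ x → h x * k x))   ≤⟨ Σ-mono∈ gs (All.lookup cross) ⟩
        Σ gs (λ _ → M)                                        ≡⟨ Σ-const M gs ⟩
        + length gs * M                                       ∎
        where import Data.List.Relation.Unary.All as All
      slack : ∀ L q M k a b c →
        (+ 2 * (L * L) * ((1ℤ + k) * q * M) + (1ℤ + k) * (1ℤ + k) * M) - + 2 * (L * L) * (a + (+ 2 * b + c))
        ≡ ((+ 2 * (L * L) * (q * M - a) + + 2 * (k * M - + 2 * (L * L) * b))
           + ((+ 2 * (L * L) * (k * q * M) + k * k * M) - + 2 * (L * L) * c)) + M
      slack = solve-∀

-- Walsh characters and Parseval's bound

module Walsh where
  open import Data.Bool using (Bool; true; false; _≟_)
  open import Data.Integer hiding (suc; _≟_)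
  open import Data.Integer.Properties hiding (_≟_)
  open import Data.Integer.Tactic.RingSolver using (solve-∀)
  import Data.Nat as ℕ
  import Data.Nat.Properties as ℕₚ
  open import Data.Nat using (suc)
  open import Data.List using (List; length; map)
  open import Data.List.Properties using (length-map)
  open import Data.List.Relation.Unary.All as All using (All)
  import Data.List.Relation.Unary.All.Properties as All
  open import Data.List.Relation.Unary.AllPairs as AllPairs using (AllPairs)
  import Data.List.Relation.Unary.AllPairs.Properties as AllPairs
  open import Data.List.Relation.Unary.Unique.Propositional using (Unique)
  open import Data.Vec using (Vec; []; _∷_)
  open import Data.Product using (_,_; ∃; _×_; proj₁; proj₂)
  open import Data.Sum using (_⊎_)
  open import Relation.Nullary
  open import Relation.Binary.PropositionalEquality
  open import Defs using (cube)
  open ℤΣ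
  open CubeSums
  open Bessel

  private
    variable
      n : ℕ

  sgn : Bool → Bool → ℤ
  sgn true true = -1ℤ
  sgn true false = 1ℤ
  sgn false _ = 1ℤ

  -- The Walsh character that maps x to -1 raised to the number of i in S with x_i = 1, where S is
  -- given by its indicator vector.
  χ : Vec Bool n → Vec Bool n → ℤ
  χ [] [] = 1ℤ
  χ (s ∷ S) (x ∷ xs) = sgn s x * χ S xs

  sgn-sq : ∀ s x → sgn s x * sgn s x ≡ 1ℤ
  sgn-sq true true = refl
  sgn-sq true false = refl
  sgn-sq false x = refl

  private
    interchange : ∀ a b c d → a * b * (c * d) ≡ a * c * (b * d)
    interchange = solve-∀

  χ-sq : (S x : Vec Bool n) → χ S x * χ S x ≡ 1ℤ
  χ-sq [] [] = refl
  χ-sq (s ∷ S) (x ∷ xs) = trans (interchange (sgn s x) (χ S xs) (sgn s x) (χ S xs)) (cong₂ _*_ (sgn-sq s x) (χ-sq S xs))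

  sgn-cancel : ∀ {s t} → s ≢ t → ∀ z → sgn s true * sgn t true * z + sgn s false * sgn t false * z ≡ 0ℤ
  sgn-cancel {true} {true} s≢t z = contradiction refl s≢t
  sgn-cancel {false} {false} s≢t z = contradiction refl s≢t
  sgn-cancel {true} {false} s≢t z = opposite z
    where
    opposite : ∀ z → -1ℤ * z + 1ℤ * z ≡ 0ℤ
    opposite = solve-∀
  sgn-cancel {false} {true} s≢t z = opposite z
    where
    opposite : ∀ z → -1ℤ * z + 1ℤ * z ≡ 0ℤ
    opposite = solve-∀

  χ-orthogonal : (S T : Vec Bool n) → S ≢ T → Σ (cube n) (λ x → χ S x * χ T x) ≡ 0ℤ
  χ-orthogonal [] [] S≢T = contradiction refl S≢T
  χ-orthogonal {suc n} (s ∷ S) (t ∷ T) S≢T = begin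
    Σ (cube (suc n)) (λ x → χ (s ∷ S) x * χ (t ∷ T) x)
      ≡⟨ Σ-cube-suc {n} (λ x → χ (s ∷ S) x * χ (t ∷ T) x) ⟩
    Σ (cube n) (λ x → sgn s true * χ S x * (sgn t true * χ T x)) + Σ (cube n) (λ x → sgn s false * χ S x * (sgn t false * χ T x))
      ≡⟨ cong₂ _+_ (factor true) (factor false) ⟩
    sgn s true * sgn t true * I + sgn s false * sgn t false * I
      ≡⟨ by-cases (s ≟ t) ⟩
    0ℤ ∎
    where
    open ≡-Reasoning
    I : ℤ
    I = Σ (cube n) (λ x → χ S x * χ T x)
    factor : ∀ b → Σ (cube n) (λ x → sgn s b * χ S x * (sgn t b * χ T x)) ≡ sgn s b * sgn t b * I
    factor b = trans (Σ-cong (cube n) (λ x → interchange (sgn s b) (χ S x) (sgn t b) (χ T x)))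
                     (Σ-* (sgn s b * sgn t b) (cube n) (λ x → χ S x * χ T x))
    equal : s ≡ t → I ≡ 0ℤ
    equal refl = χ-orthogonal S T (λ S≡T → S≢T (cong (s ∷_) S≡T))
    by-cases : Dec (s ≡ t) → sgn s true * sgn t true * I + sgn s false * sgn t false * I ≡ 0ℤ
    by-cases (yes s≡t) = trans (cong (λ z → sgn s true * sgn t true * z + sgn s false * sgn t false * z) (equal s≡t))
      (vanish (sgn s true * sgn t true) (sgn s false * sgn t false))
      where
      vanish : ∀ a b → a * 0ℤ + b * 0ℤ ≡ 0ℤ
      vanish = solve-∀
    by-cases (no s≢t) = sgn-cancel s≢t I

  private
    signed : ∀ w → ∃ λ σ → σ * σ ≡ 1ℤ × σ * w ≡ + ∣ w ∣
    signed (+ k) = 1ℤ , refl , *-identityˡ (+ k)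
    signed -[1+ k ] = -1ℤ , refl , -1*i≡-i -[1+ k ]

  coefficient : (Vec Bool n → ℤ) → Vec Bool n → ℤ
  coefficient {n} B S = Σ (cube n) (λ x → B x * χ S x)

  -- An instance of `bessel`: multiplying each character by the sign of its coefficient makes all
  -- correlations positive. Distinct characters are exactly orthogonal and their squares are 1, so q
  -- = 1.
  few-large-coefficients : (B : Vec Bool n → ℤ) → (∀ x → B x ≡ 0ℤ ⊎ B x ≡ 1ℤ) → (L : ℕ) (U : List (Vec Bool n)) → Unique U →
    All (λ S → + (2 ℕ.^ n) ≤ + L * + ∣ coefficient B S ∣) U → length U ℕ.≤ 2 ℕ.* (L ℕ.* L)
  few-large-coefficients {n} B B01 L U unique large = drop‿+≤+ (begin
    + length U                ≡⟨ cong +_ (length-map h U) ⟨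
    + length (map h U)        ≤⟨ bessel (cube n) B B01 (+ (2 ℕ.^ n)) (Σ-cube-1 n) (+<+ (ℕ.>-nonZero⁻¹ _ {{ℕₚ.m^n≢0 2 n}})) (+ L) 1ℤ (0≤+ 1) (map h U)
                                   (All.map⁺ (All.map (λ {S} → correlated S) large)) (All.map⁺ (All.universal norm U)) (AllPairs.map⁺ (AllPairs.map (λ {S} {T} → orthogonal S T) unique)) ⟩
    + 2 * (+ L * + L) * 1ℤ    ≡⟨ *-identityʳ _ ⟩
    + 2 * (+ L * + L)         ≡⟨ cong (λ z → + 2 * z) (pos-* L L) ⟨
    + 2 * + (L ℕ.* L)         ≡⟨ pos-* 2 (L ℕ.* L) ⟨
    + (2 ℕ.* (L ℕ.* L))       ∎)
    where
    open ≤-Reasoning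
    σ : Vec Bool n → ℤ
    σ S = proj₁ (signed (coefficient B S))
    h : Vec Bool n → Vec Bool n → ℤ
    h S x = σ S * χ S x
    swap : ∀ b s c → b * (s * c) ≡ s * (b * c)
    swap = solve-∀
    correlated : ∀ S → + (2 ℕ.^ n) ≤ + L * + ∣ coefficient B S ∣ → + (2 ℕ.^ n) ≤ + L * Σ (cube n) (λ x → B x * h S x)
    correlated S large = subst (λ z → + (2 ℕ.^ n) ≤ + L * z) (sym (trans
      (Σ-cong (cube n) (λ x → swap (B x) (σ S) (χ S x)))
      (trans (Σ-* (σ S) (cube n) (λ x → B x * χ S x)) (proj₂ (proj₂ (signed (coefficient B S))))))) large
    norm : ∀ S → Σ (cube n) (λ x → h S x * h S x) ≤ 1ℤ * + (2 ℕ.^ n)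
    norm S = ≤-reflexive (trans
      (Σ-cong (cube n) (λ x → trans (interchange (σ S) (χ S x) (σ S) (χ S x)) (cong₂ _*_ (proj₁ (proj₂ (signed (coefficient B S)))) (χ-sq S x))))
      (trans (Σ-cube-1 n) (sym (*-identityˡ _))))
    orthogonal : ∀ S T → S ≢ T → + 2 * (+ L * + L) * Σ (cube n) (λ x → h S x * h T x) ≤ + (2 ℕ.^ n)
    orthogonal S T S≢T = begin
      + 2 * (+ L * + L) * Σ (cube n) (λ x → h S x * h T x)
        ≡⟨ cong (λ z → + 2 * (+ L * + L) * z) (Σ-cong (cube n) (λ x → interchange (σ S) (χ S x) (σ T) (χ T x))) ⟩
      + 2 * (+ L * + L) * Σ (cube n) (λ x → σ S * σ T * (χ S x * χ T x))
        ≡⟨ cong (λ z → + 2 * (+ L * + L) * z) (Σ-* (σ S * σ T) (cube n) (λ x → χ S x * χ T x)) ⟩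
      + 2 * (+ L * + L) * (σ S * σ T * Σ (cube n) (λ x → χ S x * χ T x))
        ≡⟨ cong (λ z → + 2 * (+ L * + L) * (σ S * σ T * z)) (χ-orthogonal S T S≢T) ⟩
      + 2 * (+ L * + L) * (σ S * σ T * 0ℤ)
        ≡⟨ vanish (+ L) (σ S * σ T) ⟩
      0ℤ
        ≤⟨ 0≤+ (2 ℕ.^ n) ⟩
      + (2 ℕ.^ n) ∎
      where
      vanish : ∀ L s → + 2 * (L * L) * (s * 0ℤ) ≡ 0ℤ
      vanish = solve-∀

-- Closeness of a form to the multiples of a centre

module Covering (p : ℕ) (p-prime : Prime p) where
  open import Data.Bool using (if_then_else_)
  open import Data.Nat
  open import Data.Nat.Properties
  open import Data.Nat.Divisibility
  open import Data.Nat.DivMod using (_%_; _/_; m≡m%n+[m/n]*n; m%n<n)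
  open import Data.Nat.Primality using (prime⇒nonZero)
  open import Data.Nat.Tactic.RingSolver using (solve-∀)
  open import Data.Fin using (Fin; toℕ; fromℕ<)
  open import Data.Fin.Properties using (any?; toℕ-fromℕ<)
  open import Data.Vec using (Vec; []; _∷_; replicate)
  open import Data.Product using (_,_; ∃)
  open import Relation.Nullary
  open import Relation.Binary.PropositionalEquality
  open Residues p p-prime
  open Equidistribution p p-prime using (dot; wt)
  open import Defs using (bit)

  private
    variable
      n : ℕ
    instance
      p≢0 : NonZero p
      p≢0 = prime⇒nonZero p-prime

  comb : ℕ → Vec ℕ n → Vec ℕ n → Vec ℕ n
  comb u [] [] = []
  comb u (c ∷ cs) (a ∷ as) = (a + u * c) ∷ comb u cs as

  dot-comb : ∀ u (c a : Vec ℕ n) x → dot (comb u c a) x ≡ dot a x + u * dot c x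
  dot-comb u [] [] [] = sym (*-zeroʳ u)
  dot-comb u (c ∷ cs) (a ∷ as) (x ∷ xs) =
    trans (cong ((a + u * c) * bit x +_) (dot-comb u cs as xs)) (rearr u c a (bit x) (dot as xs) (dot cs xs))
    where
    rearr : ∀ u c a b y z → (a + u * c) * b + (y + u * z) ≡ a * b + y + u * (c * b + z)
    rearr = solve-∀

  -- The multiple 0 is allowed, so a form of weight at most `k` is covered by every centre. The
  -- relation is therefore not symmetric in general, and the order of a chain matters.
  Covers : ℕ → Vec ℕ n → Vec ℕ n → Set
  Covers k c a = ∃ λ (u : Fin p) → wt (comb (toℕ u) c a) ≤ k

  covers? : ∀ k (c a : Vec ℕ n) → Dec (Covers k c a)
  covers? k c a = any? (λ u → wt (comb (toℕ u) c a) ≤? k)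

  [_]₀ : ℕ → ℕ
  [ a ]₀ = if does (p ∣? a) then 0 else 1

  private
    digit≤1 : ∀ a → [ a ]₀ ≤ 1
    digit≤1 a with p ∣? a
    ... | yes _ = z≤n
    ... | no _ = ≤-refl

    digit-+ : ∀ a b c → (p ∣ b → p ∣ c → p ∣ a) → [ a ]₀ ≤ [ b ]₀ + [ c ]₀
    digit-+ a b c f with p ∣? b | p ∣? c
    ... | no _  | _ = ≤-trans (digit≤1 a) (s≤s z≤n)
    ... | yes _ | no _ = digit≤1 a
    ... | yes d | yes e with p ∣? a
    ...   | yes _ = z≤n
    ...   | no p∤a = contradiction (f d e) p∤a

    wt-zero : ∀ n → wt (replicate n 0) ≡ 0
    wt-zero zero = refl
    wt-zero (suc n) with p ∣? 0
    ... | yes _ = wt-zero n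
    ... | no p∤0 = contradiction (p ∣0) p∤0

    wt-comb-% : ∀ w (c a : Vec ℕ n) → wt (comb (w % p) c a) ≤ wt (comb w c a)
    wt-comb-% w [] [] = z≤n
    wt-comb-% w (c ∷ cs) (a ∷ as) = +-mono-≤
      (≤-trans (digit-+ (a + w % p * c) (a + w * c) 0 divisible) (≤-reflexive (trans (cong ([ a + w * c ]₀ +_) zero-digit) (+-identityʳ _))))
      (wt-comb-% w cs as)
      where
      zero-digit : [ 0 ]₀ ≡ 0
      zero-digit with p ∣? 0
      ... | yes _ = refl
      ... | no p∤0 = contradiction (p ∣0) p∤0
      rearr : ∀ a r q p c → a + (r + q * p) * c ≡ q * c * p + (a + r * c)
      rearr = solve-∀
      divisible : p ∣ a + w * c → p ∣ 0 → p ∣ a + w % p * c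
      divisible p∣ _ = ∣-cancel {w / p * c * p}
        (subst (p ∣_) (trans (cong (λ z → a + z * c) (m≡m%n+[m/n]*n w p)) (rearr a (w % p) (w / p) p c)) p∣)
        (divides (w / p * c) refl)

    -- Modulo p, a - u′ u c = (a + u′ b) - u′ (b + u c), so a coordinate of the left side can be
    -- nonzero only where one of the two combinations on the right is.
    wt-comb-comb : ∀ u u′ (c b a : Vec ℕ n) → wt (comb (p-1 * u′ * u) c a) ≤ wt (comb u c b) + wt (comb u′ b a)
    wt-comb-comb u u′ [] [] [] = z≤n
    wt-comb-comb u u′ (c ∷ cs) (b ∷ bs) (a ∷ as) = ≤-trans
      (+-mono-≤ (digit-+ (a + p-1 * u′ * u * c) (b + u * c) (a + u′ * b) divisible) (wt-comb-comb u u′ cs bs as))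
      (≤-reflexive (interchange [ b + u * c ]₀ [ a + u′ * b ]₀ (wt (comb u cs bs)) (wt (comb u′ bs as))))
      where
      interchange : ∀ w x y z → (w + x) + (y + z) ≡ (w + y) + (x + z)
      interchange = solve-∀
      rearr : ∀ q u u′ a b c → (a + u′ * b) + q * u′ * (b + u * c) ≡ u′ * b * (1 + q) + (a + q * u′ * u * c)
      rearr = solve-∀
      divisible : p ∣ b + u * c → p ∣ a + u′ * b → p ∣ a + p-1 * u′ * u * c
      divisible p∣b p∣a = ∣-cancel {u′ * b * suc p-1}
        (subst (p ∣_) (rearr p-1 u u′ a b c) (∣m∣n⇒∣m+n p∣a (∣n⇒∣m*n (p-1 * u′) p∣b)))
        (divides (u′ * b) (cong (u′ * b *_) (sym p≡)))

  covers-trans : ∀ {k l} {c b a : Vec ℕ n} → Covers k c b → Covers l b a → Covers (k + l) c a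
  covers-trans {c = c} {b} {a} (u , cb) (u′ , ba) = fromℕ< (m%n<n w p) , (begin
    wt (comb (toℕ (fromℕ< (m%n<n w p))) c a)   ≡⟨ cong (λ z → wt (comb z c a)) (toℕ-fromℕ< (m%n<n w p)) ⟩
    wt (comb (w % p) c a)                      ≤⟨ wt-comb-% w c a ⟩
    wt (comb w c a)                            ≤⟨ wt-comb-comb (toℕ u) (toℕ u′) c b a ⟩
    wt (comb (toℕ u) c b) + wt (comb (toℕ u′) b a) ≤⟨ +-mono-≤ cb ba ⟩
    _                                          ∎)
    where
    open ≤-Reasoning
    w : ℕ
    w = p-1 * toℕ u′ * toℕ u

  -- The count of the zero form at residue 0 is the size of a set. As every centre covers this form,
  -- agreement around a centre includes agreement of the sizes.
  covers-zero : ∀ k (c : Vec ℕ n) → Covers k c (replicate n 0)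
  covers-zero {n} k c = fromℕ< (>-nonZero⁻¹ p) , subst (λ z → wt (comb z c (replicate _ 0)) ≤ k) (sym (toℕ-fromℕ< (>-nonZero⁻¹ p)))
    (subst (_≤ k) (sym (trans (cong wt (comb-0 c (replicate n 0))) (wt-zero n))) z≤n)
    where
    comb-0 : ∀ {n} (c a : Vec ℕ n) → comb 0 c a ≡ a
    comb-0 [] [] = refl
    comb-0 (c ∷ cs) (a ∷ as) = cong₂ _∷_ (+-identityʳ a) (comb-0 cs as)

-- Biased forms and the length of their chains

module Spectrum (p : ℕ) (p-prime : Prime p) where
  open import Data.Bool using (Bool)
  open import Data.Integer hiding (suc)
  open import Data.Integer.Properties
  open import Data.Integer.Tactic.RingSolver using (solve-∀)
  import Data.Nat as ℕ
  import Data.Nat.Properties as ℕₚ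
  import Data.Nat.Tactic.RingSolver as ℕ-Solver
  open import Data.Nat using (suc)
  open import Data.Nat.Divisibility using (_∣_; _∣?_; ∣n⇒∣m*n)
  open import Data.Nat.Primality using (prime⇒nonZero)
  open import Data.Fin using (fromℕ<)
  open import Data.Fin.Properties using (toℕ-fromℕ<)
  open import Data.List using (List; []; _∷_; length; upTo)
  open import Data.List.Properties using (length-upTo)
  open import Data.List.Membership.Propositional.Properties using (∈-upTo⁻)
  open import Data.List.Relation.Unary.All using (All; []; _∷_)
  open import Data.List.Relation.Unary.AllPairs using (AllPairs; []; _∷_)
  open import Data.Vec using (Vec)
  open import Data.Product using (_,_; ∃)
  open import Data.Sum using (_⊎_)
  open import Relation.Nullary
  open import Relation.Binary.PropositionalEquality
  open import Defs using (cube)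
  open ℤΣ
  open CubeSums
  open Bessel
  open Residues p p-prime
  open CyclicFunctions p p-prime
  open Equidistribution p p-prime
  open Covering p p-prime

  private
    variable
      n : ℕ

  0<P : 0ℤ < P
  0<P = +<+ (ℕ.>-nonZero⁻¹ p {{prime⇒nonZero p-prime}})

  0<N : ∀ n → 0ℤ < N n
  0<N n = +<+ (ℕ.>-nonZero⁻¹ _ {{ℕₚ.m^n≢0 2 n}})

  -- An integer substitute for a nontrivial character of the form: its mean over the cube vanishes
  -- when the form is equidistributed. A positive correlation with a set says that one residue is
  -- deficient on it.
  bias : Vec ℕ n → ℕ → Vec Bool n → ℤ
  bias v b x = 1ℤ - P * δ (dot v x ℕ.+ b)

  -- Every nonzero point of 𝔽ₚ² lies on exactly one of the p + 1 lines through the origin.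
  product-of-biases : ∀ α β → (1ℤ - P * δ β) * (1ℤ - P * δ α) ≡ Σ (upTo p-1) (λ u → P * δ (β ℕ.+ suc u ℕ.* α) - 1ℤ)
  product-of-biases α β = begin
    (1ℤ - P * δ β) * (1ℤ - P * δ α)
      ≡⟨ complete P (δ α) (δ β) ⟩
    ((1ℤ - P * δ β) * (1ℤ - P * δ α) + (P * δ β - 1ℤ)) - (P * δ β - 1ℤ)
      ≡⟨ cong (_- (P * δ β - 1ℤ)) (whole (p ∣? α)) ⟨
    S f - (P * δ β - 1ℤ)
      ≡⟨ cong₂ _-_ (cong (λ k → Σ (upTo k) f) p≡) (cong (λ z → P * δ z - 1ℤ) (sym (ℕₚ.+-identityʳ β))) ⟩
    Σ (upTo (suc p-1)) f - f 0
      ≡⟨ cong (_- f 0) (Σ-upTo-suc p-1 f) ⟩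
    (f 0 + Σ (upTo p-1) (λ u → f (suc u))) - f 0
      ≡⟨ cancel (f 0) (Σ (upTo p-1) (λ u → f (suc u))) ⟩
    Σ (upTo p-1) (λ u → f (suc u)) ∎
    where
    open ≡-Reasoning
    f : ℕ → ℤ
    f u = P * δ (β ℕ.+ u ℕ.* α) - 1ℤ
    complete : ∀ P a b → (1ℤ - P * b) * (1ℤ - P * a) ≡ ((1ℤ - P * b) * (1ℤ - P * a) + (P * b - 1ℤ)) - (P * b - 1ℤ)
    complete = solve-∀
    cancel : ∀ x y → (x + y) - x ≡ y
    cancel = solve-∀
    linear : S f ≡ P * S (λ u → δ (β ℕ.+ u ℕ.* α)) - P * 1ℤ
    linear = trans (Σ-- (upTo p) (λ u → P * δ (β ℕ.+ u ℕ.* α)) (λ _ → 1ℤ)) (cong₂ _-_ (Σ-* P (upTo p) (λ u → δ (β ℕ.+ u ℕ.* α))) (S-const 1ℤ))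
    whole : Dec (p ∣ α) → S f ≡ (1ℤ - P * δ β) * (1ℤ - P * δ α) + (P * δ β - 1ℤ)
    whole (yes p∣α) = begin
      S f                                             ≡⟨ linear ⟩
      P * S (λ u → δ (β ℕ.+ u ℕ.* α)) - P * 1ℤ        ≡⟨ cong (λ z → P * z - P * 1ℤ) (trans (Σ-cong (upTo p) same) (S-const (δ β))) ⟩
      P * (P * δ β) - P * 1ℤ                          ≡⟨ ring P (δ β) ⟩
      (1ℤ - P * δ β) * (1ℤ - P * 1ℤ) + (P * δ β - 1ℤ) ≡⟨ cong (λ z → (1ℤ - P * δ β) * (1ℤ - P * z) + (P * δ β - 1ℤ)) (δ-yes p∣α) ⟨
      (1ℤ - P * δ β) * (1ℤ - P * δ α) + (P * δ β - 1ℤ) ∎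
      where
      ring : ∀ P b → P * (P * b) - P * 1ℤ ≡ (1ℤ - P * b) * (1ℤ - P * 1ℤ) + (P * b - 1ℤ)
      ring = solve-∀
      same : ∀ u → δ (β ℕ.+ u ℕ.* α) ≡ δ β
      same u = trans (cong δ (ℕₚ.+-comm β (u ℕ.* α))) (δ-+ (∣n⇒∣m*n u p∣α) β)
    whole (no p∤α) = begin
      S f                                             ≡⟨ linear ⟩
      P * S (λ u → δ (β ℕ.+ u ℕ.* α)) - P * 1ℤ        ≡⟨ cong (λ z → P * z - P * 1ℤ) (S-δ-line p∤α β) ⟩
      P * 1ℤ - P * 1ℤ                                 ≡⟨ ring P (δ β) ⟩
      (1ℤ - P * δ β) * (1ℤ - P * 0ℤ) + (P * δ β - 1ℤ) ≡⟨ cong (λ z → (1ℤ - P * δ β) * (1ℤ - P * z) + (P * δ β - 1ℤ)) (δ-no p∤α) ⟨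
      (1ℤ - P * δ β) * (1ℤ - P * δ α) + (P * δ β - 1ℤ) ∎
      where
      ring : ∀ P b → P * 1ℤ - P * 1ℤ ≡ (1ℤ - P * b) * (1ℤ - P * 0ℤ) + (P * b - 1ℤ)
      ring = solve-∀

  -- Summing `product-of-biases` over the cube leaves only the deviations of the combinations v + u
  -- w with u between 1 and p - 1.
  bias-product : (v w : Vec ℕ n) (b c : ℕ) →
    Σ (cube n) (λ x → bias v b x * bias w c x)
    ≡ Σ (upTo p-1) (λ u → P * hits (comb (suc u) w v) (b ℕ.+ suc u ℕ.* c) - N n)
  bias-product {n} v w b c = begin
    Σ (cube n) (λ x → bias v b x * bias w c x)
      ≡⟨ Σ-cong (cube n) (λ x → product-of-biases (dot w x ℕ.+ c) (dot v x ℕ.+ b)) ⟩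
    Σ (cube n) (λ x → Σ (upTo p-1) (λ u → P * δ (dot v x ℕ.+ b ℕ.+ suc u ℕ.* (dot w x ℕ.+ c)) - 1ℤ))
      ≡⟨ Σ-swap (cube n) (upTo p-1) (λ x u → P * δ (dot v x ℕ.+ b ℕ.+ suc u ℕ.* (dot w x ℕ.+ c)) - 1ℤ) ⟩
    Σ (upTo p-1) (λ u → Σ (cube n) (λ x → P * δ (dot v x ℕ.+ b ℕ.+ suc u ℕ.* (dot w x ℕ.+ c)) - 1ℤ))
      ≡⟨ Σ-cong (upTo p-1) inner ⟩
    Σ (upTo p-1) (λ u → P * hits (comb (suc u) w v) (b ℕ.+ suc u ℕ.* c) - N n) ∎
    where
    open ≡-Reasoning
    rearr : ∀ x b u y c → x ℕ.+ b ℕ.+ u ℕ.* (y ℕ.+ c) ≡ x ℕ.+ u ℕ.* y ℕ.+ (b ℕ.+ u ℕ.* c)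
    rearr = ℕ-Solver.solve-∀
    inner : ∀ u → Σ (cube n) (λ x → P * δ (dot v x ℕ.+ b ℕ.+ suc u ℕ.* (dot w x ℕ.+ c)) - 1ℤ)
                  ≡ P * hits (comb (suc u) w v) (b ℕ.+ suc u ℕ.* c) - N n
    inner u = trans
      (Σ-cong (cube n) (λ x → cong (λ z → P * δ z - 1ℤ) (trans (rearr (dot v x) b (suc u) (dot w x) c)
        (cong (ℕ._+ (b ℕ.+ suc u ℕ.* c)) (sym (dot-comb (suc u) w v x))))))
      (trans (Σ-- (cube n) (λ x → P * δ (dot (comb (suc u) w v) x ℕ.+ (b ℕ.+ suc u ℕ.* c))) (λ _ → 1ℤ))
        (cong₂ _-_ (Σ-* P (cube n) (λ x → δ (dot (comb (suc u) w v) x ℕ.+ (b ℕ.+ suc u ℕ.* c)))) (Σ-cube-1 n)))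

  bias-norm : (v : Vec ℕ n) (b : ℕ) → Σ (cube n) (λ x → bias v b x * bias v b x) ≤ P * P * N n
  bias-norm {n} v b = begin
    Σ (cube n) (λ x → bias v b x * bias v b x) ≤⟨ Σ-mono (cube n) (λ x → pointwise (dot v x ℕ.+ b) (p ∣? (dot v x ℕ.+ b))) ⟩
    Σ (cube n) (λ _ → P * P * 1ℤ)              ≡⟨ Σ-* (P * P) (cube n) (λ _ → 1ℤ) ⟩
    P * P * Σ (cube n) (λ _ → 1ℤ)              ≡⟨ cong (λ z → P * P * z) (Σ-cube-1 n) ⟩
    P * P * N n                                ∎
    where
    open ≤-Reasoning
    0≤P-1 : 0ℤ ≤ P - 1ℤ
    0≤P-1 = i≤j⇒0≤j-i (i<j⇒suc[i]≤j 0<P)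
    pointwise : ∀ z → Dec (p ∣ z) → (1ℤ - P * δ z) * (1ℤ - P * δ z) ≤ P * P * 1ℤ
    pointwise z (yes d) = subst (λ e → (1ℤ - P * e) * (1ℤ - P * e) ≤ P * P * 1ℤ) (sym (δ-yes d))
      (≤-cert (0≤-+ (0≤-+ 0≤P-1 0≤P-1) (0≤+ 1)) (slack P))
      where
      slack : ∀ P → P * P * 1ℤ - (1ℤ - P * 1ℤ) * (1ℤ - P * 1ℤ) ≡ (P - 1ℤ) + (P - 1ℤ) + 1ℤ
      slack = solve-∀
    pointwise z (no d) = subst (λ e → (1ℤ - P * e) * (1ℤ - P * e) ≤ P * P * 1ℤ) (sym (δ-no d))
      (≤-cert (0≤-+ (0≤-sq (P - 1ℤ)) (0≤-+ 0≤P-1 0≤P-1)) (slack P))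
      where
      slack : ∀ P → P * P * 1ℤ - (1ℤ - P * 0ℤ) * (1ℤ - P * 0ℤ) ≡ (P - 1ℤ) * (P - 1ℤ) + ((P - 1ℤ) + (P - 1ℤ))
      slack = solve-∀

  Biased : (Vec Bool n → ℤ) → ℕ → Vec ℕ n → Set
  Biased {n} B L v = ∃ λ b → N n ≤ + L * Σ (cube n) (λ x → B x * bias v b x)

  -- `tolerance` is the factor 2 L² from the orthogonality hypothesis of `bessel`, times p to pay
  -- for the p - 1 summands of `bias-product`. `radius` is the weight that `equidistribution`
  -- requires for this Θ, and `chain-length` is the bound 2 L² q of `bessel` with q = p² from
  -- `bias-norm`.
  tolerance radius chain-length : ℕ → ℕ
  tolerance L = 2 ℕ.* (L ℕ.* L) ℕ.* p
  radius L = tolerance L ℕ.* tolerance L ℕ.* (p ℕ.* p ℕ.* (2 ℕ.* 4 ℕ.^ p))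
  chain-length L = 2 ℕ.* (L ℕ.* L) ℕ.* (p ℕ.* p)

  -- Newest element first: each form is uncovered by all the forms following it.
  Chain : ℕ → List (Vec ℕ n) → Set
  Chain k = AllPairs (λ new old → ¬ Covers k old new)

  private
    pos-tolerance : ∀ L → + tolerance L ≡ + 2 * (+ L * + L) * P
    pos-tolerance L = trans (pos-* (2 ℕ.* (L ℕ.* L)) p)
      (cong (_* P) (trans (pos-* 2 (L ℕ.* L)) (cong (λ z → + 2 * z) (pos-* L L))))

    pos-radius : ∀ L → + radius L ≡ + tolerance L * + tolerance L * (P * P * B)
    pos-radius L = trans (pos-* (tolerance L ℕ.* tolerance L) _) (cong₂ _*_ (pos-* (tolerance L) (tolerance L))
      (trans (pos-* (p ℕ.* p) _) (cong₂ _*_ (pos-* p p) (pos-* 2 (4 ℕ.^ p)))))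

  -- A light combination v + u w would witness that `w` covers `v`. So all of them are heavy, and
  -- `equidistribution` bounds each summand of `bias-product` by 2^n divided by the tolerance.
  almost-orthogonal : ∀ L (v w : Vec ℕ n) b c → ¬ Covers (radius L) w v →
                      + 2 * (+ L * + L) * Σ (cube n) (λ x → bias v b x * bias w c x) ≤ N n
  almost-orthogonal {n} L v w b c uncovered = *-cancelˡ-≤-pos _ _ P {{positive 0<P}} (begin
    P * (+ 2 * (+ L * + L) * I)       ≡⟨ rearr P (+ L) I ⟩
    + 2 * (+ L * + L) * P * I         ≡⟨ cong (_* I) (pos-tolerance L) ⟨
    + tolerance L * I                 ≡⟨ cong (λ z → + tolerance L * z) (bias-product v w b c) ⟩
    + tolerance L * Σ (upTo p-1) f    ≡⟨ Σ-* (+ tolerance L) (upTo p-1) f ⟨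
    Σ (upTo p-1) (λ u → + tolerance L * f u) ≤⟨ Σ-mono∈ (upTo p-1) (λ {u} u∈ → small u (∈-upTo⁻ u∈)) ⟩
    Σ (upTo p-1) (λ _ → N n)          ≡⟨ trans (Σ-const (N n) (upTo p-1)) (cong (λ k → + k * N n) (length-upTo p-1)) ⟩
    + p-1 * N n                       ≤⟨ *-monoʳ-≤-nonNeg (N n) {{nonNegative (0≤N n)}} (+≤+ (ℕₚ.≤-trans (ℕₚ.n≤1+n p-1) (ℕₚ.≤-reflexive (sym p≡)))) ⟩
    P * N n                           ∎)
    where
    open ≤-Reasoning
    I : ℤ
    I = Σ (cube n) (λ x → bias v b x * bias w c x)
    f : ℕ → ℤ
    f u = P * hits (comb (suc u) w v) (b ℕ.+ suc u ℕ.* c) - N n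
    rearr : ∀ P L x → P * (+ 2 * (L * L) * x) ≡ + 2 * (L * L) * P * x
    rearr = solve-∀
    small : ∀ u → u ℕ.< p-1 → + tolerance L * f u ≤ N n
    small u u<p-1 = equidistribution {Θ = tolerance L} (comb (suc u) w v) (b ℕ.+ suc u ℕ.* c)
      (subst (_< + wt (comb (suc u) w v)) (pos-radius L) (+<+ (ℕₚ.≰⇒> (λ light → uncovered (fromℕ< u<p , subst (λ z → wt (comb z w v) ℕ.≤ radius L) (sym (toℕ-fromℕ< u<p)) light)))))
      where
      u<p : suc u ℕ.< p
      u<p = subst (suc u ℕ.<_) (sym p≡) (ℕ.s≤s u<p-1)

  -- Each form is represented by its bias at the residue that witnesses `Biased`; the chain
  -- condition makes these functions almost orthogonal.
  chain-bound : (B : Vec Bool n → ℤ) → (∀ x → B x ≡ 0ℤ ⊎ B x ≡ 1ℤ) → ∀ L (vs : List (Vec ℕ n)) →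
                Chain (radius L) vs → All (Biased B L) vs → length vs ℕ.≤ chain-length L
  chain-bound {n} B B01 L vs chain biased = drop‿+≤+ (begin
    + length vs                        ≡⟨ cong +_ (length-tests biased) ⟨
    + length (tests biased)            ≤⟨ bessel (cube n) B B01 (N n) (Σ-cube-1 n) (0<N n) (+ L) (P * P) (0≤-sq P)
                                            (tests biased) (correlated biased) (norms biased) (orthogonal chain biased) ⟩
    + 2 * (+ L * + L) * (P * P)        ≡⟨ cong₂ _*_ (trans (pos-* 2 (L ℕ.* L)) (cong (λ z → + 2 * z) (pos-* L L))) (pos-* p p) ⟨
    + (2 ℕ.* (L ℕ.* L)) * + (p ℕ.* p)  ≡⟨ pos-* (2 ℕ.* (L ℕ.* L)) (p ℕ.* p) ⟨
    + chain-length L                   ∎)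
    where
    open ≤-Reasoning
    tests : ∀ {vs} → All (Biased B L) vs → List (Vec Bool n → ℤ)
    tests [] = []
    tests (_∷_ {v} (b , _) bs) = bias v b ∷ tests bs
    length-tests : ∀ {vs} (bs : All (Biased B L) vs) → length (tests bs) ≡ length vs
    length-tests [] = refl
    length-tests (_ ∷ bs) = cong suc (length-tests bs)
    correlated : ∀ {vs} (bs : All (Biased B L) vs) → All (λ h → N n ≤ + L * Σ (cube n) (λ x → B x * h x)) (tests bs)
    correlated [] = []
    correlated ((b , large) ∷ bs) = large ∷ correlated bs
    norms : ∀ {vs} (bs : All (Biased B L) vs) → All (λ h → Σ (cube n) (λ x → h x * h x) ≤ P * P * N n) (tests bs)
    norms [] = []
    norms (_∷_ {v} (b , _) bs) = bias-norm v b ∷ norms bs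
    orthogonal-to : ∀ v b {ws} → All (λ w → ¬ Covers (radius L) w v) ws → (bs : All (Biased B L) ws) →
      All (λ k → + 2 * (+ L * + L) * Σ (cube n) (λ x → bias v b x * k x) ≤ N n) (tests bs)
    orthogonal-to v b [] [] = []
    orthogonal-to v b (_∷_ {w} uncovered us) ((c , _) ∷ bs) = almost-orthogonal L v w b c uncovered ∷ orthogonal-to v b us bs
    orthogonal : ∀ {vs} → Chain (radius L) vs → (bs : All (Biased B L) vs) →
      AllPairs (λ h k → + 2 * (+ L * + L) * Σ (cube n) (λ x → h x * k x) ≤ N n) (tests bs)
    orthogonal [] [] = []
    orthogonal (us ∷ chain) (_∷_ {v} (b , _) bs) = orthogonal-to v b us bs ∷ orthogonal chain bs

-- Characters of bounded degree

module LightVectors where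
  open import Data.Bool using (Bool; true; false)
  open import Data.Nat
  open import Data.Nat.Properties
  open import Data.List using (List; []; _∷_; length; map; _++_)
  open import Data.List.Properties using (length-++; length-map)
  open import Data.List.Membership.Propositional using (_∈_)
  open import Data.List.Membership.Propositional.Properties using (∈-map⁺; ∈-++⁺ˡ; ∈-++⁺ʳ)
  open import Data.List.Relation.Unary.Any using (here)
  open import Data.Vec using (Vec; []; _∷_)
  open import Relation.Binary.PropositionalEquality
  open import Defs using (bit)

  pop : ∀ {n} → Vec Bool n → ℕ
  pop [] = 0
  pop (s ∷ S) = bit s + pop S

  light : ∀ n → ℕ → List (Vec Bool n)
  light zero k = [] ∷ []
  light (suc n) zero = map (false ∷_) (light n zero)
  light (suc n) (suc k) = map (false ∷_) (light n (suc k)) ++ map (true ∷_) (light n k)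

  ∈-light : ∀ {n} k (S : Vec Bool n) → pop S ≤ k → S ∈ light n k
  ∈-light k [] _ = here refl
  ∈-light zero (false ∷ S) le = ∈-map⁺ (false ∷_) (∈-light zero S le)
  ∈-light (suc k) (false ∷ S) le = ∈-++⁺ˡ (∈-map⁺ (false ∷_) (∈-light (suc k) S le))
  ∈-light (suc k) (true ∷ S) (s≤s le) = ∈-++⁺ʳ _ (∈-map⁺ (true ∷_) (∈-light k S le))

  -- Induction by Pascal's rule. This count of low-degree characters is what makes the loss in the
  -- theorem grow with `n`, polynomially for fixed degree.
  length-light : ∀ n k → length (light n k) ≤ suc n ^ k
  length-light zero k = ≤-reflexive (sym (^-zeroˡ k))
  length-light (suc n) zero = ≤-trans (≤-reflexive (length-map (false ∷_) (light n zero))) (length-light n zero)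
  length-light (suc n) (suc k) = begin
    length (light (suc n) (suc k))                   ≡⟨ length-++ (map (false ∷_) (light n (suc k))) ⟩
    length (map (false ∷_) (light n (suc k))) + length (map (true ∷_) (light n k))
      ≡⟨ cong₂ _+_ (length-map (false ∷_) (light n (suc k))) (length-map (true ∷_) (light n k)) ⟩
    length (light n (suc k)) + length (light n k)    ≤⟨ +-mono-≤ (length-light n (suc k)) (length-light n k) ⟩
    suc n * suc n ^ k + suc n ^ k                    ≡⟨ +-comm (suc n * suc n ^ k) (suc n ^ k) ⟩
    suc (suc n) * suc n ^ k                          ≤⟨ *-monoʳ-≤ (suc (suc n)) (^-monoˡ-≤ k (n≤1+n (suc n))) ⟩
    suc (suc n) ^ suc k                              ∎
    where open ≤-Reasoning

-- From low-degree Walsh coefficients to counts of light forms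

module Transfer (p : ℕ) (p-prime : Prime p) where
  open import Data.Bool using (Bool; true; false; if_then_else_)
  open import Data.Integer hiding (suc)
  open import Data.Integer.Properties
  open import Data.Integer.Tactic.RingSolver using (solve-∀)
  import Data.Nat as ℕ
  import Data.Nat.Properties as ℕₚ
  open import Data.Nat using (suc)
  open import Data.Nat.Divisibility using (_∣_; _∣?_; ∣m⇒∣m*n)
  open import Data.Vec using (Vec; []; _∷_)
  open import Data.Product using (_,_; _×_)
  open import Relation.Nullary
  open import Relation.Binary.PropositionalEquality
  open import Defs using (cube)
  open ℤΣ
  open CubeSums
  open Residues p p-prime
  open Equidistribution p p-prime
  open Walsh
  open LightVectors

  private
    variable
      n : ℕ

  Within : ℤ → ℤ → Set
  Within t z = - t ≤ z × z ≤ t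


  -- A character that ignores the first coordinate sees only the sum of the two halves of `G`; one
  -- that uses it, as in `coefficient-true`, sees their difference.
  coefficient-false : (G : Vec Bool (suc n) → ℤ) (S : Vec Bool n) →
    coefficient G (false ∷ S) ≡ coefficient (λ x → G (true ∷ x) + G (false ∷ x)) S
  coefficient-false {n} G S = trans (Σ-cube-suc {n} (λ x → G x * χ (false ∷ S) x))
    (trans (sym (Σ-+ (cube n) (λ x → G (true ∷ x) * (1ℤ * χ S x)) (λ x → G (false ∷ x) * (1ℤ * χ S x))))
      (Σ-cong (cube n) (λ x → ring (G (true ∷ x)) (G (false ∷ x)) (χ S x))))
    where
    ring : ∀ g h c → g * (1ℤ * c) + h * (1ℤ * c) ≡ (g + h) * c
    ring = solve-∀

  coefficient-true : (G : Vec Bool (suc n) → ℤ) (S : Vec Bool n) →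
    coefficient G (true ∷ S) ≡ coefficient (λ x → G (false ∷ x) - G (true ∷ x)) S
  coefficient-true {n} G S = trans (Σ-cube-suc {n} (λ x → G x * χ (true ∷ S) x))
    (trans (sym (Σ-+ (cube n) (λ x → G (true ∷ x) * (-1ℤ * χ S x)) (λ x → G (false ∷ x) * (1ℤ * χ S x))))
      (Σ-cong (cube n) (λ x → ring (G (true ∷ x)) (G (false ∷ x)) (χ S x))))
    where
    ring : ∀ g h c → g * (-1ℤ * c) + h * (1ℤ * c) ≡ (h - g) * c
    ring = solve-∀

  -- The indicator of a congruence on w coordinates is a combination of the characters on them.
  transfer : (v : Vec ℕ n) (G : Vec Bool n → ℤ) {τ : ℤ} → 0ℤ ≤ τ →
    (∀ S → pop S ℕ.≤ wt v → Within τ (coefficient G S)) →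
    ∀ b → Within (+ (2 ℕ.^ wt v) * τ) (Σ (cube n) (λ x → G x * δ (dot v x ℕ.+ b)))
  transfer [] G {τ} 0≤τ bound b = by-cases (p ∣? b) (bound [] ℕ.z≤n)
    where
    one : ∀ g → g * 1ℤ + 0ℤ ≡ g
    one = solve-∀
    none : ∀ g → g * 0ℤ + 0ℤ ≡ 0ℤ
    none = solve-∀
    by-cases : Dec (p ∣ b) → Within τ (G [] * 1ℤ + 0ℤ) → Within (+ 1 * τ) (G [] * δ b + 0ℤ)
    by-cases (yes d) = subst₂ Within (sym (*-identityˡ τ)) (cong (λ z → G [] * z + 0ℤ) (sym (δ-yes d)))
    by-cases (no d) _ = subst₂ Within (sym (*-identityˡ τ)) (sym (trans (cong (λ z → G [] * z + 0ℤ) (δ-no d)) (none (G []))))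
      (neg-mono-≤ 0≤τ , 0≤τ)
  transfer {suc n} (a ∷ v) G {τ} 0≤τ bound b = by-cases (p ∣? a) refl
    where
    G₁ G₀ G⁺ G⁻ : Vec Bool n → ℤ
    G₁ x = G (true ∷ x)
    G₀ x = G (false ∷ x)
    G⁺ x = G₁ x + G₀ x
    G⁻ x = G₀ x - G₁ x
    D : (Vec Bool n → ℤ) → ℕ → ℤ
    D H c = Σ (cube n) (λ x → H x * δ (dot v x ℕ.+ c))
    X T : ℤ
    X = Σ (cube (suc n)) (λ x → G x * δ (dot (a ∷ v) x ℕ.+ b))
    T = + (2 ℕ.^ wt v) * τ
    Bound Goal : ℕ → Set
    Bound k = ∀ S → pop S ℕ.≤ k → Within τ (coefficient G S)
    Goal k = Within (+ (2 ℕ.^ k) * τ) X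
    distribute⁺ : ∀ c → D G⁺ c ≡ D G₁ c + D G₀ c
    distribute⁺ c = trans (Σ-cong (cube n) (λ x → *-distribʳ-+ (δ (dot v x ℕ.+ c)) (G₁ x) (G₀ x))) (Σ-+ (cube n) _ _)
    distribute⁻ : ∀ c → D G⁻ c ≡ D G₀ c - D G₁ c
    distribute⁻ c = trans (Σ-cong (cube n) (λ x → minus (G₀ x) (G₁ x) (δ (dot v x ℕ.+ c))))
        (Σ-- (cube n) (λ x → G₀ x * δ (dot v x ℕ.+ c)) (λ x → G₁ x * δ (dot v x ℕ.+ c)))
      where
      minus : ∀ g h d → (g - h) * d ≡ g * d - h * d
      minus = solve-∀
    split : X ≡ Σ (cube n) (λ x → G₁ x * δ (a ℕ.* 1 ℕ.+ dot v x ℕ.+ b)) + D G₀ b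
    split = trans (Σ-cube-suc {n} (λ x → G x * δ (dot (a ∷ v) x ℕ.+ b)))
      (cong (λ z → Σ (cube n) (λ x → G₁ x * δ (a ℕ.* 1 ℕ.+ dot v x ℕ.+ b)) + z)
        (Σ-cong (cube n) (λ x → cong (λ z → G₀ x * δ (z ℕ.+ dot v x ℕ.+ b)) (ℕₚ.*-zeroʳ a))))
    plus-bound : ∀ {k} → Bound k → wt v ℕ.≤ k → ∀ c → Within T (D G⁺ c)
    plus-bound bound w≤k = transfer v G⁺ 0≤τ (λ S S≤ →
      subst (Within τ) (coefficient-false G S) (bound (false ∷ S) (ℕₚ.≤-trans S≤ w≤k)))
    minus-bound : ∀ {k} → Bound k → wt v ℕ.< k → ∀ c → Within T (D G⁻ c)
    minus-bound bound w<k = transfer v G⁻ 0≤τ (λ S S≤ →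
      subst (Within τ) (coefficient-true G S) (bound (true ∷ S) (ℕₚ.≤-trans (ℕ.s≤s S≤) w<k)))
    -- The congruence ignores the first coordinate, so only the sum of the halves matters and
    -- neither the degree nor the bound grows.
    zero-coefficient : p ∣ a → Bound (wt v) → Goal (wt v)
    zero-coefficient p∣a bound = subst (Within T) eq (plus-bound bound ℕₚ.≤-refl b)
      where
      eq : D G⁺ b ≡ X
      eq = trans (distribute⁺ b) (trans (cong (_+ D G₀ b) (Σ-cong (cube n) (λ x →
             cong (λ z → G₁ x * z) (trans (sym (δ-+ (∣m⇒∣m*n 1 p∣a) (dot v x ℕ.+ b))) (cong δ (sym (ℕₚ.+-assoc (a ℕ.* 1) (dot v x) b))))))) (sym split))
    nonzero-coefficient : Bound (suc (wt v)) → Goal (suc (wt v))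
    nonzero-coefficient bound = subst (λ t → Within t X) double
      (≤-cert (halve-≥ (plus-bound bound (ℕₚ.n≤1+n _) (b ℕ.+ a)) (minus-bound bound ℕₚ.≤-refl (b ℕ.+ a)) (plus-bound bound (ℕₚ.n≤1+n _) b) (minus-bound bound ℕₚ.≤-refl b)) refl ,
       ≤-cert (halve-≤ (plus-bound bound (ℕₚ.n≤1+n _) (b ℕ.+ a)) (minus-bound bound ℕₚ.≤-refl (b ℕ.+ a)) (plus-bound bound (ℕₚ.n≤1+n _) b) (minus-bound bound ℕₚ.≤-refl b)) refl)
      where
      double : + 2 * T ≡ + (2 ℕ.^ suc (wt v)) * τ
      double = trans (sym (*-assoc (+ 2) (+ (2 ℕ.^ wt v)) τ)) (cong (_* τ) (sym (pos-* 2 (2 ℕ.^ wt v))))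
      X≡ : X ≡ D G₁ (b ℕ.+ a) + D G₀ b
      X≡ = trans split (cong (_+ D G₀ b) (Σ-cong (cube n) (λ x → cong (λ z → G₁ x * δ z) (move a (dot v x) b))))
        where
        move : ∀ a d b → a ℕ.* 1 ℕ.+ d ℕ.+ b ≡ d ℕ.+ (b ℕ.+ a)
        move = ℕ-Solver.solve-∀
          where import Data.Nat.Tactic.RingSolver as ℕ-Solver
      -- Substituting G₁ = (G⁺ - G⁻)/2 and G₀ = (G⁺ + G⁻)/2 gives four counts for `v`, each within
      -- T, so X is within 2 T. The counts of G⁻ use characters of one degree more, which matches
      -- the growth of the weight by one.
      2X≡ : + 2 * X ≡ ((D G⁺ (b ℕ.+ a) - D G⁻ (b ℕ.+ a)) + D G⁺ b) + D G⁻ b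
      2X≡ = trans (cong (λ z → + 2 * z) X≡) (trans (ring (D G₁ (b ℕ.+ a)) (D G₀ (b ℕ.+ a)) (D G₁ b) (D G₀ b))
        (sym (cong₂ _+_ (cong₂ _+_ (cong₂ _-_ (distribute⁺ (b ℕ.+ a)) (distribute⁻ (b ℕ.+ a))) (distribute⁺ b)) (distribute⁻ b))))
        where
        ring : ∀ x₁ y₁ x₀ y₀ → + 2 * (x₁ + y₀) ≡ (((x₁ + y₁) - (y₁ - x₁)) + (x₀ + y₀)) + (y₀ - x₀)
        ring = solve-∀
      halve-≤ : Within T (D G⁺ (b ℕ.+ a)) → Within T (D G⁻ (b ℕ.+ a)) → Within T (D G⁺ b) → Within T (D G⁻ b) → 0ℤ ≤ + 2 * T - X
      halve-≤ (_ , u₁) (l₂ , _) (_ , u₃) (_ , u₄) = *-cancelˡ-≤-pos 0ℤ (+ 2 * T - X) (+ 2)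
        (subst (0ℤ ≤_) (trans (ring T (D G⁺ (b ℕ.+ a)) (D G⁻ (b ℕ.+ a)) (D G⁺ b) (D G⁻ b)) (trans (cong (λ z → + 2 * (+ 2 * T) - z) (sym 2X≡)) (pull T X)))
          (0≤-+ (0≤-+ (0≤-+ (i≤j⇒0≤j-i u₁) (i≤j⇒0≤j-i l₂)) (i≤j⇒0≤j-i u₃)) (i≤j⇒0≤j-i u₄)))
        where
        ring : ∀ T y₁ y₂ y₃ y₄ → (((T - y₁) + (y₂ - - T)) + (T - y₃)) + (T - y₄) ≡ + 2 * (+ 2 * T) - (((y₁ - y₂) + y₃) + y₄)
        ring = solve-∀
        pull : ∀ T x → + 2 * (+ 2 * T) - + 2 * x ≡ + 2 * (+ 2 * T - x)
        pull = solve-∀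
      halve-≥ : Within T (D G⁺ (b ℕ.+ a)) → Within T (D G⁻ (b ℕ.+ a)) → Within T (D G⁺ b) → Within T (D G⁻ b) → 0ℤ ≤ X - - (+ 2 * T)
      halve-≥ (l₁ , _) (_ , u₂) (l₃ , _) (l₄ , _) = *-cancelˡ-≤-pos 0ℤ (X - - (+ 2 * T)) (+ 2)
        (subst (0ℤ ≤_) (trans (ring T (D G⁺ (b ℕ.+ a)) (D G⁻ (b ℕ.+ a)) (D G⁺ b) (D G⁻ b)) (trans (cong (λ z → z - - (+ 2 * (+ 2 * T))) (sym 2X≡)) (pull T X)))
          (0≤-+ (0≤-+ (0≤-+ (i≤j⇒0≤j-i l₁) (i≤j⇒0≤j-i u₂)) (i≤j⇒0≤j-i l₃)) (i≤j⇒0≤j-i l₄)))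
        where
        ring : ∀ T y₁ y₂ y₃ y₄ → (((y₁ - - T) + (T - y₂)) + (y₃ - - T)) + (y₄ - - T) ≡ (((y₁ - y₂) + y₃) + y₄) - - (+ 2 * (+ 2 * T))
        ring = solve-∀
        pull : ∀ T x → + 2 * x - - (+ 2 * (+ 2 * T)) ≡ + 2 * (x - - (+ 2 * T))
        pull = solve-∀
    by-cases : (d : Dec (p ∣ a)) → d ≡ (p ∣? a) → Goal (wt (a ∷ v))
    by-cases (yes p∣a) eq = subst (λ k → Bound k → Goal k) (cong (λ d → (if does d then 0 else 1) ℕ.+ wt v) eq) (zero-coefficient p∣a) bound
    by-cases (no p∤a) eq = subst (λ k → Bound k → Goal k) (cong (λ d → (if does d then 0 else 1) ℕ.+ wt v) eq) nonzero-coefficient bound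

-- Pigeonhole principles with controlled loss

module Pigeonhole where
  open import Data.Nat
  open import Data.Nat.Properties
  open import Data.Nat.Tactic.RingSolver using (solve-∀)
  open import Data.List using (List; []; _∷_; length; map; filter; cartesianProduct; upTo)
  open import Data.List.Properties using (length-filter; length-++; length-map; length-upTo)
  open import Data.List.Membership.Propositional using (_∈_; _∉_; lose; find)
  open import Data.List.Membership.Propositional.Properties
    using (∈-filter⁺; ∈-filter⁻; ∈-cartesianProduct⁺; ∈-cartesianProduct⁻; ∈-upTo⁺)
  open import Data.List.Relation.Unary.Any using (Any; here; there)
  open import Data.List.Relation.Unary.All as All using (All; []; _∷_)
  open import Data.List.Relation.Unary.All.Properties using (¬All⇒Any¬)
  open import Data.List.Relation.Unary.AllPairs using ([]; _∷_)
  open import Data.List.Relation.Unary.Unique.Propositional using (Unique)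
  open import Data.List.Relation.Unary.Unique.Propositional.Properties using (filter⁺)
  open import Data.Product using (_,_; ∃; _×_; proj₁; proj₂)
  open import Data.Sum using (_⊎_; inj₁; inj₂)
  open import Function using (id; _∘_)
  open import Relation.Nullary
  open import Relation.Nullary.Decidable using (_⊎-dec_)
  open import Relation.Unary using (Decidable)
  open import Relation.Binary.PropositionalEquality

  private
    variable
      A : Set

  -- Preservation of uniqueness is recorded rather than uniqueness itself: the thinning steps work
  -- for arbitrary lists, and repetitions matter only when the final list is turned into a subset.
  _⊑_ : List A → List A → Set
  R′ ⊑ R = (∀ {i} → i ∈ R′ → i ∈ R) × (Unique R → Unique R′)

  ⊑-refl : {R : List A} → R ⊑ R
  ⊑-refl = id , id

  ⊑-trans : {R R′ R″ : List A} → R″ ⊑ R′ → R′ ⊑ R → R″ ⊑ R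
  ⊑-trans (f , u) (g , v) = g ∘ f , u ∘ v

  []-⊑ : {R : List A} → [] ⊑ R
  []-⊑ = (λ ()) , λ _ → []

  filter-⊑ : {P : A → Set} (P? : Decidable P) (R : List A) → filter P? R ⊑ R
  filter-⊑ P? R = (λ i∈ → proj₁ (∈-filter⁻ P? i∈)) , filter⁺ P?

  length-partition : {P : A → Set} (P? : Decidable P) (R : List A) →
    length R ≡ length (filter P? R) + length (filter (¬? ∘ P?) R)
  length-partition P? [] = refl
  length-partition P? (i ∷ R) with P? i
  ... | yes _ = cong suc (length-partition P? R)
  ... | no _ = trans (cong suc (length-partition P? R)) (sym (+-suc _ _))

  private
    length-filter² : {P Q : A → Set} (P? : Decidable P) (Q? : Decidable Q) (R : List A) →
      length (filter P? (filter Q? R)) ≤ length (filter P? R)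
    length-filter² P? Q? [] = z≤n
    length-filter² P? Q? (i ∷ R) with Q? i
    ... | no _ = ≤-trans (length-filter² P? Q? R) (drop i R)
      where
      drop : ∀ i R → length (filter P? R) ≤ length (filter P? (i ∷ R))
      drop i R with P? i
      ... | yes _ = n≤1+n _
      ... | no _ = ≤-refl
    ... | yes _ with P? i
    ...   | yes _ = s≤s (length-filter² P? Q? R)
    ...   | no _ = length-filter² P? Q? R

  -- An element may fit several labels. The first label is compared with the best label among the
  -- elements that do not fit it, and the more popular of the two is kept.
  pigeonhole : {I Λ : Set} {_∼_ : I → Λ → Set} (_∼?_ : ∀ i l → Dec (i ∼ l)) (Ls : List Λ) (R : List I) →
    (∀ {i} → i ∈ R → Any (i ∼_) Ls) →
    R ≡ [] ⊎ ∃ λ l → l ∈ Ls × length R ≤ length Ls * length (filter (_∼? l) R)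
  pigeonhole _∼?_ [] [] labelled = inj₁ refl
  pigeonhole _∼?_ [] (i ∷ R) labelled with () ← labelled (here refl)
  pigeonhole {I} {_∼_ = _∼_} _∼?_ (l ∷ Ls) R labelled = inj₂ (go (pigeonhole _∼?_ Ls R₂ labelled₂))
    where
    R₁ R₂ : List I
    R₁ = filter (_∼? l) R
    R₂ = filter (¬? ∘ (_∼? l)) R
    labelled₂ : ∀ {i} → i ∈ R₂ → Any (i ∼_) Ls
    labelled₂ i∈ with ∈-filter⁻ (¬? ∘ (_∼? l)) {xs = R} i∈
    ... | i∈R , ≁l with labelled i∈R
    ...   | here ∼l = contradiction ∼l ≁l
    ...   | there any = any
    total : length R ≡ length R₁ + length R₂
    total = length-partition (_∼? l) R
    go : (R₂ ≡ [] ⊎ ∃ λ l′ → l′ ∈ Ls × length R₂ ≤ length Ls * length (filter (_∼? l′) R₂)) →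
         ∃ λ l′ → l′ ∈ l ∷ Ls × length R ≤ suc (length Ls) * length (filter (_∼? l′) R)
    go (inj₁ R₂≡[]) = l , here refl , ≤-trans
      (≤-reflexive (trans total (trans (cong (λ z → length R₁ + length z) R₂≡[]) (+-identityʳ _)))) (m≤m+n _ _)
    go (inj₂ (l′ , l′∈ , le)) with ≤-total (length (filter (_∼? l′) R)) (length R₁)
    ... | inj₁ smaller = l , here refl , ≤-trans (≤-reflexive total) (+-monoʳ-≤ (length R₁)
          (≤-trans le (*-monoʳ-≤ (length Ls) (≤-trans (length-filter² (_∼? l′) (¬? ∘ (_∼? l)) R) smaller))))
    ... | inj₂ larger = l′ , there l′∈ , ≤-trans (≤-reflexive total) (+-mono-≤ larger
          (≤-trans le (*-monoʳ-≤ (length Ls) (length-filter² (_∼? l′) (¬? ∘ (_∼? l)) R))))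

  private
    length-cartesianProduct : {A B : Set} (xs : List A) (ys : List B) → length (cartesianProduct xs ys) ≡ length xs * length ys
    length-cartesianProduct [] ys = refl
    length-cartesianProduct (x ∷ xs) ys = trans (length-++ (map (x ,_) ys))
      (cong₂ _+_ (length-map (x ,_) ys) (length-cartesianProduct xs ys))

    len0 : {R : List A} → length R ≤ 0 → R ≡ []
    len0 {R = []} _ = refl

  -- As long as half of the functions have a large value at some point not yet treated, pass to a popular
  -- point and a popular value there; this happens at most T + 1 times.
  module Sparse {I X : Set} (_≟_ : (x y : X) → Dec (x ≡ y)) (Xs : List X)
    (Small : I → X → Set) (small? : ∀ i x → Dec (Small i x))
    (q : I → X → ℕ) (Q : ℕ) (q<Q : ∀ i x → q i x < Q)
    (T : ℕ) (sparse : ∀ i U → Unique U → All (λ x → ¬ Small i x) U → length U ≤ T) where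

    open import Data.List.Membership.DecPropositional _≟_ using (_∈?_)

    Agree : I → I → X → Set
    Agree i j x = (Small i x × Small j x) ⊎ q i x ≡ q j x

    -- The cost of one round: 2 for passing to the unsettled half, and the number of pairs of a
    -- point and a value. The successor keeps it at least 2 even when there are no points.
    loss : ℕ
    loss = 2 * suc (length Xs * Q)

    private
      instance
        loss≢0 : NonZero loss
        loss≢0 = m*n≢0 2 (suc (length Xs * Q))

      Result : ℕ → List I → Set
      Result k R = ∃ λ R′ → R′ ⊑ R × length R ≤ length R′ * loss ^ k ×
                   (∀ {i j x} → i ∈ R′ → j ∈ R′ → x ∈ Xs → Agree i j x)

      empty : ∀ k {R} → R ≡ [] → Result k R
      empty k refl = [] , []-⊑ , z≤n , λ ()

      thin : ∀ k U R → k + length U ≡ suc T → Unique U → (∀ {i} → i ∈ R → All (λ x → ¬ Small i x) U) →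
             (∀ {i j x} → i ∈ R → j ∈ R → x ∈ U → q i x ≡ q j x) → Result k R
      thin zero U [] eq unique large agree = empty 0 refl
      -- `k` counts the rounds left. At 0 the list `U` has T + 1 distinct points, all large for the
      -- index `i`, which contradicts `sparse`.
      thin zero U (i ∷ R) eq unique large agree =
        contradiction (≤-trans (≤-reflexive (sym eq)) (sparse i U unique (large (here refl)))) 1+n≰n
      thin (suc k) U R eq unique large agree = by-size (length R ≤? 2 * length D)
        where
        Settled : I → X → Set
        Settled i x = x ∈ U ⊎ Small i x
        settled? : ∀ i x → Dec (Settled i x)
        settled? i x = (x ∈? U) ⊎-dec small? i x
        done? : ∀ i → Dec (All (Settled i) Xs)
        done? i = All.all? (settled? i) Xs
        D D′ : List I
        D = filter done? R
        D′ = filter (¬? ∘ done?) R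
        Ys : List X
        Ys = filter (¬? ∘ (_∈? U)) Xs
        _∼_ : I → X × ℕ → Set
        i ∼ (x , v) = ¬ Small i x × q i x ≡ v
        _∼?_ : ∀ i l → Dec (i ∼ l)
        i ∼? (x , v) = ¬? (small? i x) ×-dec (q i x Data.Nat.≟ v)
          where
          open import Relation.Nullary.Decidable using (_×-dec_)
          import Data.Nat
        labels : List (X × ℕ)
        labels = cartesianProduct Ys (upTo Q)
        settled-agree : ∀ {i j x} → i ∈ R → j ∈ R → Settled i x → Settled j x → Agree i j x
        settled-agree i∈ j∈ (inj₁ x∈U) _ = inj₂ (agree i∈ j∈ x∈U)
        settled-agree i∈ j∈ (inj₂ _) (inj₁ x∈U) = inj₂ (agree i∈ j∈ x∈U)
        settled-agree i∈ j∈ (inj₂ si) (inj₂ sj) = inj₁ (si , sj)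
        -- An index that is not done is large at some point outside `U`; this point together with
        -- the value of `q` there is its label.
        labelled : ∀ {i} → i ∈ D′ → Any (i ∼_) labels
        labelled {i} i∈ with ∈-filter⁻ (¬? ∘ done?) {xs = R} i∈
        ... | _ , ¬done with find (¬All⇒Any¬ (settled? i) Xs ¬done)
        ...   | x , x∈Xs , unsettled = lose
                (∈-cartesianProduct⁺ (∈-filter⁺ (¬? ∘ (_∈? U)) x∈Xs (unsettled ∘ inj₁)) (∈-upTo⁺ (q<Q i x)))
                (unsettled ∘ inj₂ , refl)
        length-labels : length labels ≤ length Xs * Q
        length-labels = ≤-trans (≤-reflexive (trans (length-cartesianProduct Ys (upTo Q)) (cong (length Ys *_) (length-upTo Q))))
          (*-monoˡ-≤ Q (length-filter (¬? ∘ (_∈? U)) Xs))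
        extend : length R ≤ 2 * length D′ →
                 (D′ ≡ [] ⊎ ∃ λ l → l ∈ labels × length D′ ≤ length labels * length (filter (_∼? l) D′)) → Result (suc k) R
        extend half (inj₁ D′≡[]) = empty (suc k) (len0 (subst (λ z → length R ≤ 2 * length z) D′≡[] half))
        extend half (inj₂ ((x , v) , l∈ , many)) = conclude (thin k (x ∷ U) R₂ (trans (+-suc k (length U)) eq)
            (All.tabulate (λ y∈U x≡y → x∉U (subst (_∈ U) (sym x≡y) y∈U)) ∷ unique) large₂ agree₂)
          where
          R₂ : List I
          R₂ = filter (_∼? (x , v)) D′
          R₂⊑R : R₂ ⊑ R
          R₂⊑R = ⊑-trans (filter-⊑ (_∼? (x , v)) D′) (filter-⊑ (¬? ∘ done?) R)
          ∼v : ∀ {i} → i ∈ R₂ → i ∼ (x , v)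
          ∼v i∈ = proj₂ (∈-filter⁻ (_∼? (x , v)) {xs = D′} i∈)
          x∉U : x ∉ U
          x∉U = proj₂ (∈-filter⁻ (¬? ∘ (_∈? U)) {xs = Xs} (proj₁ (∈-cartesianProduct⁻ Ys (upTo Q) l∈)))
          large₂ : ∀ {i} → i ∈ R₂ → All (λ y → ¬ Small i y) (x ∷ U)
          large₂ i∈ = proj₁ (∼v i∈) ∷ large (proj₁ R₂⊑R i∈)
          agree₂ : ∀ {i j y} → i ∈ R₂ → j ∈ R₂ → y ∈ x ∷ U → q i y ≡ q j y
          agree₂ i∈ j∈ (here refl) = trans (proj₂ (∼v i∈)) (sym (proj₂ (∼v j∈)))
          agree₂ i∈ j∈ (there y∈U) = agree (proj₁ R₂⊑R i∈) (proj₁ R₂⊑R j∈) y∈U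
          conclude : Result k R₂ → Result (suc k) R
          conclude (R′ , R′⊑R₂ , le , ag) = R′ , ⊑-trans R′⊑R₂ R₂⊑R , bound , ag
            where
            open ≤-Reasoning
            rearr : ∀ s r z → 2 * (s * (r * z)) ≡ r * ((2 * s) * z)
            rearr = solve-∀
            bound : length R ≤ length R′ * loss ^ suc k
            bound = begin
              length R                                          ≤⟨ half ⟩
              2 * length D′                                     ≤⟨ *-monoʳ-≤ 2 many ⟩
              2 * (length labels * length R₂)                   ≤⟨ *-monoʳ-≤ 2 (*-mono-≤ (≤-trans length-labels (n≤1+n _)) le) ⟩
              2 * (suc (length Xs * Q) * (length R′ * loss ^ k)) ≡⟨ rearr (suc (length Xs * Q)) (length R′) (loss ^ k) ⟩
              length R′ * loss ^ suc k                          ∎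
        by-size : Dec (length R ≤ 2 * length D) → Result (suc k) R
        by-size (yes half) = D , filter-⊑ done? R , bound , λ {i} {j} i∈ j∈ x∈ →
            settled-agree (in-R i∈) (in-R j∈) (All.lookup (settled i∈) x∈) (All.lookup (settled j∈) x∈)
          where
          open ≤-Reasoning
          in-R : ∀ {i} → i ∈ D → i ∈ R
          in-R = proj₁ (filter-⊑ done? R)
          settled : ∀ {i} → i ∈ D → All (Settled i) Xs
          settled i∈ = proj₂ (∈-filter⁻ done? {xs = R} i∈)
          bound : length R ≤ length D * loss ^ suc k
          bound = begin
            length R                    ≤⟨ half ⟩
            2 * length D                ≡⟨ *-comm 2 (length D) ⟩
            length D * 2                ≤⟨ *-monoʳ-≤ (length D) (≤-trans (m≤m*n 2 (suc (length Xs * Q))) (m≤m*n loss (loss ^ k) {{m^n≢0 loss k}})) ⟩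
            length D * loss ^ suc k     ∎
        by-size (no more) = extend half (pigeonhole _∼?_ labels D′ labelled)
          where
          half : length R ≤ 2 * length D′
          half = +-cancelˡ-≤ (length R) _ _ (begin
            length R + length R          ≡⟨ cong₂ _+_ (length-partition done? R) (length-partition done? R) ⟩
            (length D + length D′) + (length D + length D′) ≡⟨ rearr (length D) (length D′) ⟩
            2 * length D + 2 * length D′ ≤⟨ +-monoˡ-≤ (2 * length D′) (<⇒≤ (≰⇒> more)) ⟩
            length R + 2 * length D′     ∎)
            where
            open ≤-Reasoning
            rearr : ∀ x y → (x + y) + (x + y) ≡ 2 * x + 2 * y
            rearr = solve-∀

    sparse-pigeonhole : (R : List I) → ∃ λ R′ → R′ ⊑ R × length R ≤ length R′ * loss ^ suc T ×
                        (∀ {i j x} → i ∈ R′ → j ∈ R′ → x ∈ Xs → Agree i j x)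
    sparse-pigeonhole R = thin (suc T) [] R (+-identityʳ (suc T)) [] (λ _ → []) (λ _ _ ())

-- Absorbing constants into powers of n + 1

module Powers where
  open import Data.Nat
  open import Data.Nat.Properties
  open import Relation.Binary.PropositionalEquality

  -- Turns constant factors into exponents, since the theorem only allows a power of n + 1 as loss.
  -- The powers of 1 stay bounded, so dimension 0 is treated separately.
  constant≤power : ∀ {n} → 1 ≤ n → ∀ k → k ≤ suc n ^ k
  constant≤power 1≤n zero = z≤n
  constant≤power {n} 1≤n (suc k) = begin
    suc k                        ≤⟨ +-mono-≤ (m^n>0 (suc n) k) (constant≤power 1≤n k) ⟩
    suc n ^ k + suc n ^ k        ≤⟨ +-monoʳ-≤ (suc n ^ k) (m≤n*m (suc n ^ k) n {{>-nonZero 1≤n}}) ⟩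
    suc n ^ suc k                ∎
    where open ≤-Reasoning

-- Making distributions agree around a centre

module LocalAgreement (p : ℕ) (p-prime : Prime p) where
  open import Data.Bool using (Bool)
  import Data.Bool.Properties as Bool
  open import Data.Integer hiding (suc; _/_; _%_)
  open import Data.Integer.Properties
  open import Data.Integer.Tactic.RingSolver using (solve-∀)
  import Data.Nat as ℕ
  import Data.Nat.Properties as ℕₚ
  import Data.Nat.Tactic.RingSolver as ℕ-Solver
  open import Data.Nat using (suc)
  open import Data.Nat.DivMod using (_/_; _%_; m≡m%n+[m/n]*n; m%n<n; m*n/n≡m; /-monoˡ-≤)
  open import Data.Nat.Divisibility using (_∣_; _∣?_; ∣n⇒∣m*n)
  open import Data.Fin using (toℕ)
  open import Data.List using (List; []; _∷_; length; upTo)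
  open import Data.List.Properties using (length-upTo)
  open import Data.List.Membership.Propositional using (_∈_)
  open import Data.List.Relation.Unary.All as All using (All)
  open import Data.List.Relation.Unary.Any using (here; there)
  open import Data.List.Relation.Unary.Unique.Propositional using (Unique)
  open import Data.Vec using (Vec)
  open import Data.Vec.Properties using (≡-dec)
  open import Data.Product using (_,_; ∃; _×_; proj₁; proj₂)
  open import Data.Sum using (_⊎_; inj₁; inj₂)
  open import Relation.Nullary
  open import Relation.Binary.PropositionalEquality
  open import Defs using (cube)
  open ℤΣ
  open CubeSums
  open Pigeonhole
  open Powers
  open LightVectors
  open Residues p p-prime
  open CyclicFunctions p p-prime
  open Equidistribution p p-prime
  open Covering p p-prime
  open Walsh
  open Transfer p p-prime

  within-abs : ∀ {m} z → ∣ z ∣ ℕ.≤ m → Within (+ m) z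
  within-abs (+ k) le = ≤-trans (neg-mono-≤ (0≤+ _)) (0≤+ k) , +≤+ le
  within-abs -[1+ k ] le = neg-mono-≤ (+≤+ le) , ≤-trans -≤+ (0≤+ _)

  within-+ : ∀ {s t y z} → Within s y → Within t z → Within (s + t) (y + z)
  within-+ {s} {t} {y} {z} (l , u) (l′ , u′) =
    subst (_≤ y + z) (sym (neg-distrib-+ s t)) (+-mono-≤ l l′) , +-mono-≤ u u′

  within-neg : ∀ {t z} → Within t z → Within t (- z)
  within-neg {t} {z} (l , u) = neg-mono-≤ u , subst (- z ≤_) (neg-involutive t) (neg-mono-≤ l)

  within-mono : ∀ {s t z} → s ≤ t → Within s z → Within t z
  within-mono s≤t (l , u) = ≤-trans (neg-mono-≤ s≤t) l , ≤-trans u s≤t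

  within-Σ : {X : Set} (xs : List X) {f : X → ℤ} {t : ℤ} → (∀ {x} → x ∈ xs → Within t (f x)) → Within (+ length xs * t) (Σ xs f)
  within-Σ [] w = ≤-refl , ≤-refl
  within-Σ (x ∷ xs) {f} {t} w = subst (λ s → Within s (f x + Σ xs f)) (sym (suc-* (+ length xs) t))
    (within-+ (w (here refl)) (within-Σ xs (λ x∈ → w (there x∈))))

  Indicator : {X : Set} → (X → ℤ) → Set
  Indicator B = ∀ x → B x ≡ 0ℤ ⊎ B x ≡ 1ℤ

  private
    variable
      n : ℕ

  count : (Vec Bool n → ℤ) → Vec ℕ n → ℕ → ℤ
  count {n} B v b = Σ (cube n) (λ x → B x * δ (dot v x ℕ.+ b))

  fibre : (Vec Bool n → ℤ) → Vec ℕ n → ℕ → Vec Bool n → ℤ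
  fibre B e d x = B x * δ (dot e x ℕ.+ d)

  fibre-indicator : {B : Vec Bool n → ℤ} → Indicator B → ∀ e d → Indicator (fibre B e d)
  fibre-indicator {B = B} B01 e d x = by-cases (B01 x) (p ∣? (dot e x ℕ.+ d))
    where
    by-cases : B x ≡ 0ℤ ⊎ B x ≡ 1ℤ → Dec (p ∣ dot e x ℕ.+ d) → fibre B e d x ≡ 0ℤ ⊎ fibre B e d x ≡ 1ℤ
    by-cases (inj₁ eq) _ = inj₁ (cong (_* δ (dot e x ℕ.+ d)) eq)
    by-cases (inj₂ eq) (yes y) = inj₂ (cong₂ _*_ eq (δ-yes y))
    by-cases (inj₂ eq) (no y) = inj₁ (cong₂ _*_ eq (δ-no y))

  -- Where p divides e·x + d, adding u (e·x + d) to v·x + b does not change divisibility by p, and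
  -- it turns `v` into v + u e. If `e` covers `v` through `u`, the new form is light and within
  -- reach of `transfer`.
  count-split : (B : Vec Bool n → ℤ) (e v : Vec ℕ n) (u b : ℕ) →
    count B v b ≡ S (λ d → count (fibre B e d) (comb u e v) (b ℕ.+ u ℕ.* d))
  count-split {n} B e v u b = sym (trans (Σ-swap (upTo p) (cube n) (λ d x → fibre B e d x * δ (dot (comb u e v) x ℕ.+ (b ℕ.+ u ℕ.* d))))
      (Σ-cong (cube n) pointwise))
    where
    open ≡-Reasoning
    rearr : ∀ v u e b d → v ℕ.+ u ℕ.* e ℕ.+ (b ℕ.+ u ℕ.* d) ≡ u ℕ.* (e ℕ.+ d) ℕ.+ (v ℕ.+ b)
    rearr = ℕ-Solver.solve-∀
    same : ∀ x d → Dec (p ∣ dot e x ℕ.+ d) →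
      fibre B e d x * δ (dot (comb u e v) x ℕ.+ (b ℕ.+ u ℕ.* d)) ≡ B x * δ (dot v x ℕ.+ b) * δ (dot e x ℕ.+ d)
    same x d (yes y) = begin
      B x * δ (dot e x ℕ.+ d) * δ (dot (comb u e v) x ℕ.+ (b ℕ.+ u ℕ.* d))
        ≡⟨ cong (λ z → B x * δ (dot e x ℕ.+ d) * z) (trans (cong (λ z → δ (z ℕ.+ (b ℕ.+ u ℕ.* d))) (dot-comb u e v x))
             (trans (cong δ (rearr (dot v x) u (dot e x) b d)) (δ-+ (∣n⇒∣m*n u y) (dot v x ℕ.+ b)))) ⟩
      B x * δ (dot e x ℕ.+ d) * δ (dot v x ℕ.+ b)
        ≡⟨ swap (B x) (δ (dot e x ℕ.+ d)) (δ (dot v x ℕ.+ b)) ⟩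
      B x * δ (dot v x ℕ.+ b) * δ (dot e x ℕ.+ d) ∎
      where
      swap : ∀ a b c → a * b * c ≡ a * c * b
      swap = solve-∀
    same x d (no y) = begin
      B x * δ (dot e x ℕ.+ d) * δ (dot (comb u e v) x ℕ.+ (b ℕ.+ u ℕ.* d))
        ≡⟨ cong (λ z → B x * z * δ (dot (comb u e v) x ℕ.+ (b ℕ.+ u ℕ.* d))) (δ-no y) ⟩
      B x * 0ℤ * δ (dot (comb u e v) x ℕ.+ (b ℕ.+ u ℕ.* d))
        ≡⟨ vanish (B x) (δ (dot (comb u e v) x ℕ.+ (b ℕ.+ u ℕ.* d))) (δ (dot v x ℕ.+ b)) ⟩
      B x * δ (dot v x ℕ.+ b) * 0ℤ
        ≡⟨ cong (λ z → B x * δ (dot v x ℕ.+ b) * z) (δ-no y) ⟨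
      B x * δ (dot v x ℕ.+ b) * δ (dot e x ℕ.+ d) ∎
      where
      vanish : ∀ a b c → a * 0ℤ * b ≡ a * c * 0ℤ
      vanish = solve-∀
    pointwise : ∀ x → S (λ d → fibre B e d x * δ (dot (comb u e v) x ℕ.+ (b ℕ.+ u ℕ.* d))) ≡ B x * δ (dot v x ℕ.+ b)
    pointwise x = begin
      S (λ d → fibre B e d x * δ (dot (comb u e v) x ℕ.+ (b ℕ.+ u ℕ.* d)))
        ≡⟨ Σ-cong (upTo p) (λ d → same x d (p ∣? (dot e x ℕ.+ d))) ⟩
      S (λ d → B x * δ (dot v x ℕ.+ b) * δ (dot e x ℕ.+ d))
        ≡⟨ Σ-* (B x * δ (dot v x ℕ.+ b)) (upTo p) (λ d → δ (dot e x ℕ.+ d)) ⟩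
      B x * δ (dot v x ℕ.+ b) * S (λ d → δ (dot e x ℕ.+ d))
        ≡⟨ cong (λ z → B x * δ (dot v x ℕ.+ b) * z) (S-δ (dot e x)) ⟩
      B x * δ (dot v x ℕ.+ b) * 1ℤ
        ≡⟨ *-identityʳ _ ⟩
      B x * δ (dot v x ℕ.+ b) ∎

  χ-within : (S x : Vec Bool n) → Within 1ℤ (χ S x)
  χ-within S x = within-abs (χ S x) (ℕₚ.≤-reflexive (unit ∣ χ S x ∣ (trans (sym (abs-* (χ S x) (χ S x))) (cong ∣_∣ (χ-sq S x)))))
    where
    unit : ∀ k → k ℕ.* k ≡ 1 → k ≡ 1
    unit k eq = ℕₚ.m*n≡1⇒m≡1 k k eq

  coefficient-within : {B : Vec Bool n → ℤ} → Indicator B → ∀ S → Within (+ (2 ℕ.^ n)) (coefficient B S)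
  coefficient-within {n} {B} B01 S = subst (λ t → Within t (coefficient B S)) (trans (sym (Σ-const 1ℤ (cube n))) (Σ-cube-1 n))
    (within-Σ (cube n) (λ {x} _ → pointwise x))
    where
    pointwise : ∀ x → Within 1ℤ (B x * χ S x)
    pointwise x = by-cases (B01 x)
      where
      by-cases : B x ≡ 0ℤ ⊎ B x ≡ 1ℤ → Within 1ℤ (B x * χ S x)
      by-cases (inj₁ eq) = subst (Within 1ℤ) (sym (cong (_* χ S x) eq)) (-≤+ , +≤+ ℕ.z≤n)
      by-cases (inj₂ eq) = subst (Within 1ℤ) (sym (trans (cong (_* χ S x) eq) (*-identityˡ _))) (χ-within S x)

  private
    pos-%/ : ∀ a m .{{_ : ℕ.NonZero m}} → + a ≡ + (a % m) + + (a / m) * + m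
    pos-%/ a m = trans (cong +_ (m≡m%n+[m/n]*n a m)) (trans (pos-+ (a % m) (a / m ℕ.* m)) (cong (λ z → + (a % m) + z) (pos-* (a / m) m)))

  same-quotient : ∀ a b m .{{_ : ℕ.NonZero m}} → a / m ≡ b / m → Within (+ m) (+ a - + b)
  same-quotient a b m eq = subst (Within (+ m)) (sym diff) (lower , upper)
    where
    r s : ℕ
    r = a % m
    s = b % m
    ring : ∀ r s k → (r + k) - (s + k) ≡ r - s
    ring = solve-∀
    diff : + a - + b ≡ + r - + s
    diff = trans (cong₂ _-_ (pos-%/ a m) (trans (pos-%/ b m) (cong (λ k → + s + + k * + m) (sym eq)))) (ring (+ r) (+ s) (+ (a / m) * + m))
    cancel : ∀ r s m → (r - s) - - m ≡ r + (m - s)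
    cancel = solve-∀
    cancel′ : ∀ r s m → m - (r - s) ≡ s + (m - r)
    cancel′ = solve-∀
    lower : - + m ≤ + r - + s
    lower = ≤-cert (0≤-+ (0≤+ r) (i≤j⇒0≤j-i (+≤+ (ℕₚ.<⇒≤ (m%n<n b m))))) (cancel (+ r) (+ s) (+ m))
    upper : + r - + s ≤ + m
    upper = ≤-cert (0≤-+ (0≤+ s) (i≤j⇒0≤j-i (+≤+ (ℕₚ.<⇒≤ (m%n<n a m))))) (cancel′ (+ r) (+ s) (+ m))

  -- There are p fibres with 2 L² + 1 rounds of thinning each. In the exponent of a single round, 1
  -- pays for the halving, `K` for the characters of degree at most `K`, and 2 L + 2 for the rounded
  -- values.
  local-exponent : ℕ → ℕ → ℕ
  local-exponent K L = (1 ℕ.+ K ℕ.+ suc (suc (2 ℕ.* L))) ℕ.* suc (2 ℕ.* (L ℕ.* L)) ℕ.* p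

  module Thinning {I : Set} {n : ℕ} (B : I → Vec Bool n → ℤ) (B01 : ∀ i → Indicator (B i)) (1≤n : 1 ℕ.≤ n) (K L : ℕ) where

    private instance
      2^n≢0 : ℕ.NonZero (2 ℕ.^ n)
      2^n≢0 = ℕₚ.m^n≢0 2 n

    private
      T Q c : ℕ
      T = 2 ℕ.* (L ℕ.* L)
      Q = suc (2 ℕ.* L)
      c = 1 ℕ.+ K ℕ.+ suc Q

    -- The factor 2 covers both cases of `Agree`: two small coefficients differ by at most twice 2^n
    -- / L, two with equal rounding by at most 2^n / L.
    CoefficientsClose : Vec ℕ n → ℕ → I → I → Set
    CoefficientsClose e d i j = ∀ S → pop S ℕ.≤ K →
      Within (+ 2 * N n) (+ L * (coefficient (fibre (B i) e d) S - coefficient (fibre (B j) e d) S))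

    Thinned : List I → ℕ → (I → I → Set) → Set
    Thinned R k _≈_ = ∃ λ R′ → R′ ⊑ R × length R ℕ.≤ length R′ ℕ.* suc n ℕ.^ k × (∀ {i j} → i ∈ R′ → j ∈ R′ → i ≈ j)

    module _ (e : Vec ℕ n) (d : ℕ) where

      private
        W : I → Vec Bool n → ℤ
        W i S = coefficient (fibre (B i) e d) S

        W-within : ∀ i S → Within (N n) (W i S)
        W-within i S = coefficient-within (fibre-indicator (B01 i) e d) S

        Small : I → Vec Bool n → Set
        Small i S = L ℕ.* ∣ W i S ∣ ℕ.< 2 ℕ.^ n

        shifted : I → Vec Bool n → ℕ
        shifted i S = ∣ W i S + N n ∣

        pos-shifted : ∀ i S → + shifted i S ≡ W i S + N n
        pos-shifted i S = 0≤i⇒+∣i∣≡i (≤-cert (i≤j⇒0≤j-i (proj₁ (W-within i S))) (ring (W i S) (N n)))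
          where
          ring : ∀ w m → (w + m) - 0ℤ ≡ w - - m
          ring = solve-∀

        shifted≤ : ∀ i S → shifted i S ℕ.≤ 2 ℕ.* 2 ℕ.^ n
        shifted≤ i S = drop‿+≤+ (subst₂ _≤_ (sym (pos-shifted i S)) (trans (ring (N n)) (sym (pos-* 2 (2 ℕ.^ n))))
            (+-monoˡ-≤ (N n) (proj₂ (W-within i S))))
          where
          ring : ∀ m → m + m ≡ + 2 * m
          ring = solve-∀

        -- A coefficient lies between -2^n and 2^n. The shift by 2^n makes it a natural number, and
        -- rounding in units of 2^n / L leaves 2 L + 1 possible values.
        q : I → Vec Bool n → ℕ
        q i S = (L ℕ.* shifted i S) / 2 ℕ.^ n

        q<Q : ∀ i S → q i S ℕ.< Q
        q<Q i S = ℕ.s≤s (begin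
          (L ℕ.* shifted i S) / 2 ℕ.^ n          ≤⟨ /-monoˡ-≤ (2 ℕ.^ n) (ℕₚ.*-monoʳ-≤ L (shifted≤ i S)) ⟩
          (L ℕ.* (2 ℕ.* 2 ℕ.^ n)) / 2 ℕ.^ n      ≡⟨ cong (_/ 2 ℕ.^ n) (ring L (2 ℕ.^ n)) ⟩
          (2 ℕ.* L ℕ.* 2 ℕ.^ n) / 2 ℕ.^ n        ≡⟨ m*n/n≡m (2 ℕ.* L) (2 ℕ.^ n) ⟩
          2 ℕ.* L                                ∎)
          where
          open ℕₚ.≤-Reasoning
          ring : ∀ l m → l ℕ.* (2 ℕ.* m) ≡ 2 ℕ.* l ℕ.* m
          ring = ℕ-Solver.solve-∀

        sparse : ∀ i U → Unique U → All (λ S → ¬ Small i S) U → length U ℕ.≤ T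
        sparse i U unique large = few-large-coefficients (fibre (B i) e d) (fibre-indicator (B01 i) e d) L U unique
          (All.map (λ {S} ¬small → subst (N n ≤_) (pos-* L ∣ W i S ∣) (+≤+ (ℕₚ.≮⇒≥ ¬small))) large)

        open Sparse (≡-dec Bool._≟_) (light n K) Small (λ i S → L ℕ.* ∣ W i S ∣ ℕ.<? 2 ℕ.^ n) q Q q<Q T sparse

        loss≤ : loss ℕ.≤ suc n ℕ.^ c
        loss≤ = begin
          2 ℕ.* suc (length (light n K) ℕ.* Q)
            ≤⟨ ℕₚ.*-monoʳ-≤ 2 (ℕₚ.+-mono-≤ (ℕₚ.m^n>0 (suc n) K) (ℕₚ.*-monoˡ-≤ Q (length-light n K))) ⟩
          2 ℕ.* (suc n ℕ.^ K ℕ.+ suc n ℕ.^ K ℕ.* Q)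
            ≡⟨ cong (2 ℕ.*_) (ℕₚ.*-suc (suc n ℕ.^ K) Q) ⟨
          2 ℕ.* (suc n ℕ.^ K ℕ.* suc Q)
            ≤⟨ ℕₚ.*-mono-≤ (ℕ.s≤s 1≤n) (ℕₚ.*-monoʳ-≤ (suc n ℕ.^ K) (constant≤power 1≤n (suc Q))) ⟩
          suc n ℕ.* (suc n ℕ.^ K ℕ.* suc n ℕ.^ suc Q)
            ≡⟨ cong (suc n ℕ.*_) (ℕₚ.^-distribˡ-+-* (suc n) K (suc Q)) ⟨
          suc n ℕ.^ c ∎
          where open ℕₚ.≤-Reasoning

        agree⇒close : ∀ i j S → Agree i j S → Within (+ 2 * N n) (+ L * (W i S - W j S))
        agree⇒close i j S (inj₁ (small-i , small-j)) = subst₂ Within (two (N n)) (sym (dist (+ L) (W i S) (W j S)))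
            (within-+ (scaled i small-i) (within-neg (scaled j small-j)))
          where
          two : ∀ m → m + m ≡ + 2 * m
          two = solve-∀
          dist : ∀ l a b → l * (a - b) ≡ l * a - l * b
          dist = solve-∀
          scaled : ∀ k → Small k S → Within (N n) (+ L * W k S)
          scaled k small = within-abs (+ L * W k S) (ℕₚ.≤-trans (ℕₚ.≤-reflexive (abs-* (+ L) (W k S))) (ℕₚ.<⇒≤ small))
        agree⇒close i j S (inj₂ eq) = within-mono N≤2N (subst (Within (N n)) shift
            (same-quotient (L ℕ.* shifted i S) (L ℕ.* shifted j S) (2 ℕ.^ n) eq))
          where
          ring : ∀ l a b m → l * (a + m) - l * (b + m) ≡ l * (a - b)
          ring = solve-∀
          shift : + (L ℕ.* shifted i S) - + (L ℕ.* shifted j S) ≡ + L * (W i S - W j S)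
          shift = trans (cong₂ _-_ (trans (pos-* L (shifted i S)) (cong (λ z → + L * z) (pos-shifted i S)))
                                   (trans (pos-* L (shifted j S)) (cong (λ z → + L * z) (pos-shifted j S))))
                        (ring (+ L) (W i S) (W j S) (N n))
          slack : ∀ m → + 2 * m - m ≡ m
          slack = solve-∀
          N≤2N : N n ≤ + 2 * N n
          N≤2N = ≤-cert (0≤N n) (slack (N n))

      thin-fibre : (R : List I) → Thinned R (c ℕ.* suc T) (CoefficientsClose e d)
      thin-fibre R = go (sparse-pigeonhole R)
        where
        go : (∃ λ R′ → R′ ⊑ R × length R ℕ.≤ length R′ ℕ.* loss ℕ.^ suc T × (∀ {i j x} → i ∈ R′ → j ∈ R′ → x ∈ light n K → Agree i j x)) →
             Thinned R (c ℕ.* suc T) (CoefficientsClose e d)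
        go (R′ , R′⊑R , le , agree) = R′ , R′⊑R ,
          ℕₚ.≤-trans le (ℕₚ.*-monoʳ-≤ (length R′) (ℕₚ.≤-trans (ℕₚ.^-monoˡ-≤ (suc T) loss≤) (ℕₚ.≤-reflexive (ℕₚ.^-*-assoc (suc n) c (suc T))))) ,
          λ {i} {j} i∈ j∈ S S≤K → agree⇒close i j S (agree i∈ j∈ (∈-light K S S≤K))

    AllClose : Vec ℕ n → List ℕ → I → I → Set
    AllClose e ds i j = ∀ {d} → d ∈ ds → CoefficientsClose e d i j

    thin-fibres : (e : Vec ℕ n) (ds : List ℕ) (R : List I) → Thinned R (c ℕ.* suc T ℕ.* length ds) (AllClose e ds)
    thin-fibres e [] R = R , ⊑-refl , ℕₚ.≤-reflexive (sym (trans (cong (λ z → length R ℕ.* suc n ℕ.^ z) (ℕₚ.*-zeroʳ (c ℕ.* suc T))) (ℕₚ.*-identityʳ _))) , λ _ _ ()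
    thin-fibres e (d ∷ ds) R = first (thin-fibre e d R)
      where
      k : ℕ
      k = c ℕ.* suc T
      second : ∀ {R₁} → R₁ ⊑ R → length R ℕ.≤ length R₁ ℕ.* suc n ℕ.^ k → (∀ {i j} → i ∈ R₁ → j ∈ R₁ → CoefficientsClose e d i j) →
               Thinned R₁ (k ℕ.* length ds) (AllClose e ds) → Thinned R (k ℕ.* suc (length ds)) (AllClose e (d ∷ ds))
      second {R₁} R₁⊑R le₁ close₁ (R₂ , R₂⊑R₁ , le₂ , close₂) = R₂ , ⊑-trans R₂⊑R₁ R₁⊑R , bound , close
        where
        bound : length R ℕ.≤ length R₂ ℕ.* suc n ℕ.^ (k ℕ.* suc (length ds))
        bound = begin
          length R                                                            ≤⟨ le₁ ⟩
          length R₁ ℕ.* suc n ℕ.^ k                                           ≤⟨ ℕₚ.*-monoˡ-≤ (suc n ℕ.^ k) le₂ ⟩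
          length R₂ ℕ.* suc n ℕ.^ (k ℕ.* length ds) ℕ.* suc n ℕ.^ k           ≡⟨ ring (length R₂) (suc n ℕ.^ (k ℕ.* length ds)) (suc n ℕ.^ k) ⟩
          length R₂ ℕ.* (suc n ℕ.^ k ℕ.* suc n ℕ.^ (k ℕ.* length ds))         ≡⟨ cong (length R₂ ℕ.*_) (ℕₚ.^-distribˡ-+-* (suc n) k (k ℕ.* length ds)) ⟨
          length R₂ ℕ.* suc n ℕ.^ (k ℕ.+ k ℕ.* length ds)                     ≡⟨ cong (λ z → length R₂ ℕ.* suc n ℕ.^ z) (ℕₚ.*-suc k (length ds)) ⟨
          length R₂ ℕ.* suc n ℕ.^ (k ℕ.* suc (length ds))                     ∎
          where
          open ℕₚ.≤-Reasoning
          ring : ∀ a b c → a ℕ.* b ℕ.* c ≡ a ℕ.* (c ℕ.* b)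
          ring = ℕ-Solver.solve-∀
        close : ∀ {i j} → i ∈ R₂ → j ∈ R₂ → AllClose e (d ∷ ds) i j
        close i∈ j∈ (here refl) = close₁ (proj₁ R₂⊑R₁ i∈) (proj₁ R₂⊑R₁ j∈)
        close i∈ j∈ (there d∈) = close₂ i∈ j∈ d∈
      first : Thinned R k (CoefficientsClose e d) → Thinned R (k ℕ.* suc (length ds)) (AllClose e (d ∷ ds))
      first (R₁ , R₁⊑R , le₁ , close₁) = second R₁⊑R le₁ close₁ (thin-fibres e ds R₁)

    -- The bound is the product of the number p of fibres, the factor 2^K lost in `transfer`, and
    -- the error in `CoefficientsClose`.
    CountsClose : I → I → Vec ℕ n → Set
    CountsClose i j v = ∀ b → Within (P * (+ (2 ℕ.^ K) * (+ 2 * N n))) (+ L * (count (B i) v b - count (B j) v b))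

    CloseAround : Vec ℕ n → I → I → Set
    CloseAround e i j = ∀ v → Covers K e v → CountsClose i j v

    thin-around : (e : Vec ℕ n) (R : List I) → Thinned R (local-exponent K L) (CloseAround e)
    thin-around e R = go (thin-fibres e (upTo p) R)
      where
      go : Thinned R (c ℕ.* suc T ℕ.* length (upTo p)) (AllClose e (upTo p)) → Thinned R (local-exponent K L) (CloseAround e)
      go (R′ , R′⊑R , le , close) = R′ , R′⊑R ,
        subst (λ k → length R ℕ.≤ length R′ ℕ.* suc n ℕ.^ (c ℕ.* suc T ℕ.* k)) (length-upTo p) le ,
        λ {i} {j} i∈ j∈ v cov → counts i j v cov (λ d∈ → close i∈ j∈ d∈)
        where
        counts : ∀ i j v → Covers K e v → (∀ {d} → d ∈ upTo p → CoefficientsClose e d i j) → CountsClose i j v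
        counts i j v (û , light-ψ) close b = subst₂ Within (cong (λ k → + k * (+ (2 ℕ.^ K) * (+ 2 * N n))) (length-upTo p)) (sym total)
            (within-Σ (upTo p) each)
          where
          open ≡-Reasoning
          u : ℕ
          u = toℕ û
          ψ : Vec ℕ n
          ψ = comb u e v
          -- `transfer` accepts any integer function, so it is applied directly to the scaled
          -- difference of the two fibres.
          G : ℕ → Vec Bool n → ℤ
          G d x = + L * (fibre (B i) e d x - fibre (B j) e d x)
          linear : ∀ d (h : Vec Bool n → ℤ) → Σ (cube n) (λ x → G d x * h x)
                   ≡ + L * (Σ (cube n) (λ x → fibre (B i) e d x * h x) - Σ (cube n) (λ x → fibre (B j) e d x * h x))
          linear d h = trans (Σ-cong (cube n) (λ x → ring (+ L) (fibre (B i) e d x) (fibre (B j) e d x) (h x)))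
            (trans (Σ-* (+ L) (cube n) (λ x → fibre (B i) e d x * h x - fibre (B j) e d x * h x))
              (cong (λ z → + L * z) (Σ-- (cube n) (λ x → fibre (B i) e d x * h x) (λ x → fibre (B j) e d x * h x))))
            where
            ring : ∀ l a b h → l * (a - b) * h ≡ l * (a * h - b * h)
            ring = solve-∀
          f : ℕ → ℤ
          f d = + L * (count (fibre (B i) e d) ψ (b ℕ.+ u ℕ.* d) - count (fibre (B j) e d) ψ (b ℕ.+ u ℕ.* d))
          each : ∀ {d} → d ∈ upTo p → Within (+ (2 ℕ.^ K) * (+ 2 * N n)) (f d)
          each {d} d∈ = within-mono
            (*-monoʳ-≤-nonNeg (+ 2 * N n) {{nonNegative 0≤2N}} (+≤+ (ℕₚ.^-monoʳ-≤ 2 light-ψ)))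
            (subst (Within (+ (2 ℕ.^ wt ψ) * (+ 2 * N n))) (linear d (λ x → δ (dot ψ x ℕ.+ (b ℕ.+ u ℕ.* d))))
              (transfer ψ (G d) 0≤2N (λ S S≤ → subst (Within (+ 2 * N n)) (sym (linear d (χ S))) (close d∈ S (ℕₚ.≤-trans S≤ light-ψ))) (b ℕ.+ u ℕ.* d)))
            where
            0≤2N : 0ℤ ≤ + 2 * N n
            0≤2N = 0≤-* (0≤+ 2) (0≤N n)
          total : + L * (count (B i) v b - count (B j) v b) ≡ S f
          total = begin
            + L * (count (B i) v b - count (B j) v b)
              ≡⟨ cong (λ z → + L * z) (cong₂ _-_ (count-split (B i) e v u b) (count-split (B j) e v u b)) ⟩
            + L * (S (λ d → count (fibre (B i) e d) ψ (b ℕ.+ u ℕ.* d)) - S (λ d → count (fibre (B j) e d) ψ (b ℕ.+ u ℕ.* d)))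
              ≡⟨ cong (λ z → + L * z) (Σ-- (upTo p) (λ d → count (fibre (B i) e d) ψ (b ℕ.+ u ℕ.* d)) (λ d → count (fibre (B j) e d) ψ (b ℕ.+ u ℕ.* d))) ⟨
            + L * S (λ d → count (fibre (B i) e d) ψ (b ℕ.+ u ℕ.* d) - count (fibre (B j) e d) ψ (b ℕ.+ u ℕ.* d))
              ≡⟨ Σ-* (+ L) (upTo p) (λ d → count (fibre (B i) e d) ψ (b ℕ.+ u ℕ.* d) - count (fibre (B j) e d) ψ (b ℕ.+ u ℕ.* d)) ⟨
            S f ∎

-- Sums of natural numbers

module NaturalSums where
  open import Data.Nat
  open import Data.Nat.Properties
  open import Data.List using (List; []; _∷_; length)
  open import Relation.Binary.PropositionalEquality

  open BigSum _≤_ _+_ _*_ 0 1 +-*-isCommutativeSemiring ≤-refl +-mono-≤ public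

  Σ-const : {X : Set} (c : ℕ) (xs : List X) → Σ xs (λ _ → c) ≡ length xs * c
  Σ-const c [] = refl
  Σ-const c (x ∷ xs) = cong (c +_) (Σ-const c xs)

-- Thinning a family until few bad pairs remain

module Iteration where
  open import Data.Nat
  open import Data.Nat.Properties
  open import Data.Nat.Tactic.RingSolver using (solve-∀)
  open import Data.List using (List; []; _∷_; length; filter)
  open import Data.List.Membership.Propositional using (_∈_; find)
  open import Data.List.Membership.Propositional.Properties using (∈-filter⁻)
  open import Data.List.Relation.Unary.Any as Any using (Any; here; there)
  open import Data.List.Relation.Unary.All as All using (All; []; _∷_)
  open import Data.List.Relation.Unary.All.Properties using (¬Any⇒All¬)
  open import Data.List.Relation.Unary.AllPairs using (AllPairs; []; _∷_)
  open import Data.List.Relation.Binary.Pointwise using (Pointwise; []; _∷_; Pointwise-length)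
  open import Data.Product using (_,_; ∃; _×_; proj₁; proj₂)
  open import Data.Sum using (_⊎_; inj₁; inj₂)
  open import Relation.Nullary
  open import Relation.Nullary.Decidable using (_×-dec_)
  open import Relation.Binary.PropositionalEquality
  open Pigeonhole
  open NaturalSums

  -- Here `I` indexes the sets and `Φ` stands for the forms; `Spec i φ` means that φ is biased on
  -- the set i, and `Close i j φ` that its distributions on two sets nearly agree. `search` makes
  -- badness and maximality of chains decidable.
  module _ {I Φ : Set} (search : {P : Φ → Set} → (∀ φ → Dec (P φ)) → Dec (∃ P))
    (Spec : I → Φ → Set) (spec? : ∀ i φ → Dec (Spec i φ))
    (Close : I → I → Φ → Set) (close? : ∀ i j φ → Dec (Close i j φ)) where

    Bad : I → I → Set
    Bad i j = ∃ λ φ → (Spec i φ × Spec j φ) × ¬ Close i j φ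

    bad? : ∀ i j → Dec (Bad i j)
    bad? i j = search (λ φ → (spec? i φ ×-dec spec? j φ) ×-dec ¬? (close? i j φ))

    bad-degree : List I → I → ℕ
    bad-degree R i = length (filter (bad? i) R)

    module _ (Cov Cov₂ : Φ → Φ → Set) (cov? : ∀ e φ → Dec (Cov e φ))
      (cov-trans : ∀ {c ψ φ} → Cov c ψ → Cov ψ φ → Cov₂ c φ)
      (M : ℕ) (bounded : ∀ i vs → AllPairs (λ new old → ¬ Cov old new) vs → All (Spec i) vs → length vs ≤ M)
      (F : ℕ) {{F≢0 : NonZero F}}
      (local : ∀ e R → ∃ λ R′ → R′ ⊑ R × length R ≤ length R′ * F × (∀ {i j} → i ∈ R′ → j ∈ R′ → ∀ φ → Cov₂ e φ → Close i j φ))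
      (E : ℕ) {{E≢0 : NonZero E}} where

      -- The loss of one round: E for passing to the bad partners of one index, at most M for the
      -- choice of a centre, and F for the agreement around it.
      Z : ℕ
      Z = E * (suc M * F)

      private
        instance
          Z≢0 : NonZero Z
          Z≢0 = m*n≢0 E (suc M * F) {{E≢0}} {{m*n≢0 (suc M) F}}

        Chain : List Φ → Set
        Chain = AllPairs (λ new old → ¬ Cov old new)

        Maximal : I → Set
        Maximal i = ∃ λ es → length es ≤ M × (∀ φ → Spec i φ → Any (λ e → Cov e φ) es)

        -- Greedy construction: an uncovered form of the spectrum extends the chain, and the length
        -- bound M stops this. Once no such form exists, the chain covers the spectrum.
        maximal-chain : ∀ i k es → k + length es ≡ suc M → Chain es → All (Spec i) es → Maximal i
        maximal-chain i zero es eq chain spec =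
          contradiction (≤-trans (≤-reflexive (sym eq)) (bounded i es chain spec)) 1+n≰n
        maximal-chain i (suc k) es eq chain spec with search (λ φ → spec? i φ ×-dec ¬? (Any.any? (λ e → cov? e φ) es))
        ... | yes (φ , spec-φ , uncovered) =
              maximal-chain i k (φ ∷ es) (trans (+-suc k (length es)) eq) (¬Any⇒All¬ es uncovered ∷ chain) (spec-φ ∷ spec)
        ... | no none = es , bounded i es chain spec , λ φ spec-φ → covered φ spec-φ (Any.any? (λ e → cov? e φ) es)
          where
          covered : ∀ φ → Spec i φ → Dec (Any (λ e → Cov e φ) es) → Any (λ e → Cov e φ) es
          covered φ spec-φ (yes any) = any
          covered φ spec-φ (no ¬any) = contradiction (φ , spec-φ , ¬any) none

        Result : ℕ → List I → Set
        Result k R = ∃ λ R′ → R′ ⊑ R × length R ≤ length R′ * Z ^ k × E * Σ R′ (bad-degree R′) ≤ length R′ * length R′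

        -- Since chains in a spectrum are bounded by M, these chains bound the number of steps.
        Matched : List Φ → I → Set
        Matched cs i = ∃ λ ψs → Pointwise (λ ψ c → Cov c ψ) ψs cs × Chain ψs × All (Spec i) ψs

        iterate : ∀ k cs R → k + length cs ≡ suc M → (∀ {i} → i ∈ R → Matched cs i) →
                  (∀ {i j c} → i ∈ R → j ∈ R → c ∈ cs → ∀ φ → Cov₂ c φ → Close i j φ) → Result k R
        iterate zero cs [] eq matched agreed = [] , []-⊑ , z≤n , ≤-reflexive (*-zeroʳ E)
        -- After M + 1 rounds a remaining index would own a chain of M + 1 forms in its spectrum, so
        -- none remains.
        iterate zero cs (i ∷ R) eq matched agreed with matched (here refl)
        ... | ψs , pw , chain , spec =
              contradiction (≤-trans (≤-reflexive (sym (trans (Pointwise-length pw) eq))) (bounded i ψs chain spec)) 1+n≰n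
        iterate (suc k) cs R eq matched agreed = by-degree (Any.any? (λ i → length R ≤? E * bad-degree R i) R)
          where
          by-degree : Dec (Any (λ i → length R ≤ E * bad-degree R i) R) → Result (suc k) R
          by-degree (no none) = R , ⊑-refl , m≤m*n (length R) (Z ^ suc k) {{m^n≢0 Z (suc k)}} , (begin
            E * Σ R (bad-degree R)          ≡⟨ Σ-* E R (bad-degree R) ⟨
            Σ R (λ i → E * bad-degree R i)  ≤⟨ Σ-mono∈ R (λ i∈ → <⇒≤ (≰⇒> (All.lookup (¬Any⇒All¬ R none) i∈))) ⟩
            Σ R (λ _ → length R)            ≡⟨ Σ-const (length R) R ⟩
            length R * length R             ∎)
            where open ≤-Reasoning
          by-degree (yes many) with find many
          ... | i₀ , i₀∈R , many-bad with maximal-chain i₀ (suc M) [] (+-identityʳ (suc M)) [] []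
          ...   | es , es≤M , covering = go (pigeonhole _∼?_ es P labelled)
            where
            P : List I
            P = filter (bad? i₀) R
            -- The label of `j` is a centre covering some form that makes the pair bad; the form
            -- itself may vary with `j`.
            _∼_ : I → Φ → Set
            j ∼ e = ∃ λ φ → ((Spec i₀ φ × Spec j φ) × ¬ Close i₀ j φ) × Cov e φ
            _∼?_ : ∀ j e → Dec (j ∼ e)
            j ∼? e = search (λ φ → ((spec? i₀ φ ×-dec spec? j φ) ×-dec ¬? (close? i₀ j φ)) ×-dec cov? e φ)
            labelled : ∀ {j} → j ∈ P → Any (j ∼_) es
            labelled j∈ with proj₂ (∈-filter⁻ (bad? i₀) {xs = R} j∈)
            ... | φ , (spec₀ , spec-j) , ¬close = Any.map (λ cov → φ , ((spec₀ , spec-j) , ¬close) , cov) (covering φ spec₀)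
            go : (P ≡ [] ⊎ ∃ λ e → e ∈ es × length P ≤ length es * length (filter (_∼? e) P)) → Result (suc k) R
            go (inj₁ P≡[]) = [] , []-⊑ , ≤-trans many-bad (≤-reflexive (trans (cong (λ z → E * length z) P≡[]) (*-zeroʳ E))) , ≤-reflexive (*-zeroʳ E)
            go (inj₂ (e , e∈ , large)) = thinned (local e R₁)
              where
              R₁ : List I
              R₁ = filter (_∼? e) P
              R₁⊑R : R₁ ⊑ R
              R₁⊑R = ⊑-trans (filter-⊑ (_∼? e) P) (filter-⊑ (bad? i₀) R)
              extend : ∀ {j} → j ∈ R₁ → Matched (e ∷ cs) j
              extend j∈ with proj₂ (∈-filter⁻ (_∼? e) {xs = P} j∈) | matched (proj₁ R₁⊑R j∈)
              ... | φ , ((spec₀ , spec-j) , ¬close) , cov | ψs , pw , chain , spec =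
                    φ ∷ ψs , cov ∷ pw , uncovered pw (λ c∈ → agreed i₀∈R (proj₁ R₁⊑R j∈) c∈) ∷ chain , spec-j ∷ spec
                where
                -- `agreed` is applied to the pair of i₀ and the new index: both lie in `R`, and
                -- closeness on φ would contradict the choice of φ.
                uncovered : ∀ {ψs cs} → Pointwise (λ ψ c → Cov c ψ) ψs cs → (∀ {c} → c ∈ cs → ∀ φ → Cov₂ c φ → Close i₀ _ φ) →
                            All (λ ψ → ¬ Cov ψ φ) ψs
                uncovered [] _ = []
                uncovered (c∼ψ ∷ pw) agr = (λ ψ∼φ → ¬close (agr (here refl) φ (cov-trans c∼ψ ψ∼φ))) ∷ uncovered pw (λ c∈ → agr (there c∈))
              thinned : (∃ λ R′ → R′ ⊑ R₁ × length R₁ ≤ length R′ * F × (∀ {i j} → i ∈ R′ → j ∈ R′ → ∀ φ → Cov₂ e φ → Close i j φ)) → Result (suc k) R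
              thinned (R₂ , R₂⊑R₁ , le , close) = conclude (iterate k (e ∷ cs) R₂ (trans (+-suc k (length cs)) eq) (λ i∈ → extend (proj₁ R₂⊑R₁ i∈)) agreed₂)
                where
                R₂⊑R : R₂ ⊑ R
                R₂⊑R = ⊑-trans R₂⊑R₁ R₁⊑R
                agreed₂ : ∀ {i j c} → i ∈ R₂ → j ∈ R₂ → c ∈ e ∷ cs → ∀ φ → Cov₂ c φ → Close i j φ
                agreed₂ i∈ j∈ (here refl) = close i∈ j∈
                agreed₂ i∈ j∈ (there c∈) = agreed (proj₁ R₂⊑R i∈) (proj₁ R₂⊑R j∈) c∈
                conclude : Result k R₂ → Result (suc k) R
                conclude (R′ , R′⊑R₂ , le′ , few) = R′ , ⊑-trans R′⊑R₂ R₂⊑R , bound , few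
                  where
                  open ≤-Reasoning
                  rearr : ∀ e m r z f → e * (m * (r * z * f)) ≡ r * (e * (m * f) * z)
                  rearr = solve-∀
                  bound : length R ≤ length R′ * Z ^ suc k
                  bound = begin
                    length R                                   ≤⟨ many-bad ⟩
                    E * length P                               ≤⟨ *-monoʳ-≤ E large ⟩
                    E * (length es * length R₁)                ≤⟨ *-monoʳ-≤ E (*-mono-≤ (≤-trans es≤M (n≤1+n M)) le) ⟩
                    E * (suc M * (length R₂ * F))              ≤⟨ *-monoʳ-≤ E (*-monoʳ-≤ (suc M) (*-monoˡ-≤ F le′)) ⟩
                    E * (suc M * (length R′ * Z ^ k * F))      ≡⟨ rearr E (suc M) (length R′) (Z ^ k) F ⟩
                    length R′ * Z ^ suc k                      ∎

      few-bad-pairs : (R : List I) → ∃ λ R′ → R′ ⊑ R × length R ≤ length R′ * Z ^ suc M × E * Σ R′ (bad-degree R′) ≤ length R′ * length R′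
      few-bad-pairs R = iterate (suc M) [] R (+-identityʳ (suc M)) (λ _ → [] , [] , [] , []) (λ _ _ ())

-- Most tuples contain no bad pair

module Tuples where
  open import Data.Bool using (if_then_else_)
  open import Data.Nat
  open import Data.Nat.Properties
  open import Data.Nat.Tactic.RingSolver using (solve-∀)
  open import Data.Fin using (zero; suc)
  open import Data.List using (List; []; _∷_; length; filter; map; concatMap)
  open import Data.List.Membership.Propositional using (_∈_)
  open import Data.List.Membership.Propositional.Properties using (∈-filter⁻; ∈-map⁻; ∈-++⁻)
  open import Data.List.Relation.Unary.Any using (here; there)
  import Data.List.Relation.Unary.All as All
  open import Data.List.Relation.Unary.AllPairs using ([]; _∷_)
  open import Data.List.Relation.Unary.Unique.Propositional using (Unique)
  open import Data.List.Relation.Unary.Unique.Propositional.Properties using (map⁺; ++⁺)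
  open import Data.Vec using (Vec; []; _∷_; lookup)
  open import Data.Vec.Properties using (∷-injectiveʳ; ∷-injectiveˡ)
  open import Data.Product using (_,_; ∃; _×_; proj₂)
  open import Data.Sum using (inj₁; inj₂)
  open import Data.Unit using (⊤; tt)
  open import Relation.Nullary
  open import Relation.Binary.PropositionalEquality
  open import Defs using (allVec)
  open Pigeonhole
  open NaturalSums

  private
    variable
      A : Set

  ∈-allVec-suc : ∀ (R : List A) m (xs : List A) {t : Vec A (suc m)} →
    t ∈ concatMap (λ x → map (x ∷_) (allVec R m)) xs → ∃ λ x → ∃ λ t′ → x ∈ xs × t′ ∈ allVec R m × t ≡ x ∷ t′
  ∈-allVec-suc R m (x ∷ xs) t∈ with ∈-++⁻ (map (x ∷_) (allVec R m)) t∈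
  ... | inj₁ t∈map with ∈-map⁻ (x ∷_) t∈map
  ...   | t′ , t′∈ , eq = x , t′ , here refl , t′∈ , eq
  ∈-allVec-suc R m (x ∷ xs) t∈ | inj₂ t∈rest with ∈-allVec-suc R m xs t∈rest
  ... | y , t′ , y∈ , t′∈ , eq = y , t′ , there y∈ , t′∈ , eq

  allVec-entries : ∀ (R : List A) m {t : Vec A m} → t ∈ allVec R m → ∀ j → lookup t j ∈ R
  allVec-entries R (suc m) t∈ j with ∈-allVec-suc R m R t∈
  allVec-entries R (suc m) t∈ zero    | x , t′ , x∈ , t′∈ , refl = x∈
  allVec-entries R (suc m) t∈ (suc j) | x , t′ , x∈ , t′∈ , refl = allVec-entries R m t′∈ j

  allVec-unique : ∀ (R : List A) m → Unique R → Unique (allVec R m)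
  allVec-unique R zero _ = All.[] ∷ []
  allVec-unique {A} R (suc m) unique = go R unique
    where
    go : ∀ xs → Unique xs → Unique (concatMap (λ x → map (x ∷_) (allVec R m)) xs)
    go [] _ = []
    go (x ∷ xs) (x∉xs ∷ unique-xs) = ++⁺ (map⁺ ∷-injectiveʳ (allVec-unique R m unique)) (go xs unique-xs) disjoint
      where
      disjoint : ∀ {t} → ¬ (t ∈ map (x ∷_) (allVec R m) × t ∈ concatMap (λ x → map (x ∷_) (allVec R m)) xs)
      disjoint (t∈x , t∈xs) with ∈-map⁻ (x ∷_) t∈x | ∈-allVec-suc R m xs t∈xs
      ... | t′ , _ , refl | y , _ , y∈ , _ , eq = All.lookup x∉xs y∈ (∷-injectiveˡ eq)

  Σ-allVec-suc : ∀ (R : List A) m (f : Vec A (suc m) → ℕ) →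
    Σ (allVec R (suc m)) f ≡ Σ R (λ x → Σ (allVec R m) (λ t → f (x ∷ t)))
  Σ-allVec-suc R m f = trans (Σ-concatMap (λ x → map (x ∷_) (allVec R m)) R f) (Σ-cong R (λ x → Σ-map (x ∷_) (allVec R m) f))

  length-Σ : (xs : List A) → length xs ≡ Σ xs (λ _ → 1)
  length-Σ xs = sym (trans (Σ-const 1 xs) (*-identityʳ _))

  length-allVec : ∀ (R : List A) m → length (allVec R m) ≡ length R ^ m
  length-allVec R zero = refl
  length-allVec R (suc m) = begin
    length (allVec R (suc m))                   ≡⟨ length-Σ (allVec R (suc m)) ⟩
    Σ (allVec R (suc m)) (λ _ → 1)              ≡⟨ Σ-allVec-suc R m (λ _ → 1) ⟩
    Σ R (λ _ → Σ (allVec R m) (λ _ → 1))        ≡⟨ Σ-const _ R ⟩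
    length R * Σ (allVec R m) (λ _ → 1)         ≡⟨ cong (length R *_) (trans (sym (length-Σ (allVec R m))) (length-allVec R m)) ⟩
    length R ^ suc m                            ∎
    where open ≡-Reasoning

  module _ {I : Set} {Bad : I → I → Set} (bad? : ∀ i j → Dec (Bad i j)) where

    -- Pairs are tested with the earlier entry first, the order in which `PairsClose` compares the
    -- one-sided relation of closeness.
    NoBadPair : ∀ {m} → Vec I m → Set
    NoBadPair [] = ⊤
    NoBadPair (x ∷ t) = (∀ j → ¬ Bad x (lookup t j)) × NoBadPair t

    private
      β : I → I → ℕ
      β i j = if does (bad? i j) then 1 else 0

      degree : ∀ {m} → I → Vec I m → ℕ
      degree x [] = 0
      degree x (y ∷ t) = β x y + degree x t

      badness : ∀ {m} → Vec I m → ℕ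
      badness [] = 0
      badness (x ∷ t) = degree x t + badness t

      β≡0 : ∀ i j → β i j ≡ 0 → ¬ Bad i j
      β≡0 i j eq with bad? i j
      ... | no ¬bad = ¬bad

      degree≡0 : ∀ {m} x (t : Vec I m) → degree x t ≡ 0 → ∀ j → ¬ Bad x (lookup t j)
      degree≡0 x (y ∷ t) eq zero = β≡0 x y (m+n≡0⇒m≡0 (β x y) eq)
      degree≡0 x (y ∷ t) eq (suc j) = degree≡0 x t (m+n≡0⇒n≡0 (β x y) eq) j

      badness≡0 : ∀ {m} (t : Vec I m) → badness t ≡ 0 → NoBadPair t
      badness≡0 [] eq = tt
      badness≡0 (x ∷ t) eq = degree≡0 x t (m+n≡0⇒m≡0 (degree x t) eq) , badness≡0 t (m+n≡0⇒n≡0 (degree x t) eq)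

      length-filter-bad : ∀ i R → length (filter (bad? i) R) ≡ Σ R (β i)
      length-filter-bad i [] = refl
      length-filter-bad i (j ∷ R) with bad? i j
      ... | yes _ = cong suc (length-filter-bad i R)
      ... | no _ = length-filter-bad i R

      length-filter-nonzero : (f : A → ℕ) (xs : List A) → length (filter (λ x → ¬? (f x ≟ 0)) xs) ≤ Σ xs f
      length-filter-nonzero f [] = z≤n
      length-filter-nonzero f (x ∷ xs) with f x
      ... | zero = length-filter-nonzero f xs
      ... | suc k = s≤s (≤-trans (length-filter-nonzero f xs) (m≤n+m _ k))

    module GoodTuples (E : ℕ) (R : List I) (few : E * Σ R (λ i → length (filter (bad? i) R)) ≤ length R * length R) where

      private
        r : ℕ
        r = length R

        pairs : ℕ
        pairs = Σ R (λ i → Σ R (β i))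

        few′ : E * pairs ≤ r * r
        few′ = subst (λ z → E * z ≤ r * r) (Σ-cong R (λ i → length-filter-bad i R)) few

        -- Each of the `m` positions contributes r^(m-1) times the number of bad pairs, and that
        -- number is at most r² / E.
        degrees : ∀ m → E * Σ R (λ x → Σ (allVec R m) (degree x)) ≤ m * (r * r ^ m)
        degrees zero = ≤-reflexive (trans (cong (E *_) (Σ-zero R)) (*-zeroʳ E))
        degrees (suc m) = begin
          E * Σ R (λ x → Σ (allVec R (suc m)) (degree x))
            ≡⟨ cong (E *_) split ⟩
          E * (r ^ m * pairs + r * D)
            ≡⟨ distribute E (r ^ m) pairs r D ⟩
          r ^ m * (E * pairs) + r * (E * D)
            ≤⟨ +-mono-≤ (*-monoʳ-≤ (r ^ m) few′) (*-monoʳ-≤ r (degrees m)) ⟩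
          r ^ m * (r * r) + r * (m * (r * r ^ m))
            ≡⟨ collect r (r ^ m) m ⟩
          suc m * (r * r ^ suc m) ∎
          where
          open ≤-Reasoning
          D : ℕ
          D = Σ R (λ x → Σ (allVec R m) (degree x))
          distribute : ∀ e x p r d → e * (x * p + r * d) ≡ x * (e * p) + r * (e * d)
          distribute = solve-∀
          collect : ∀ r x m → x * (r * r) + r * (m * (r * x)) ≡ (1 + m) * (r * (r * x))
          collect = solve-∀
          inner : ∀ x y → Σ (allVec R m) (λ t → β x y + degree x t) ≡ r ^ m * β x y + Σ (allVec R m) (degree x)
          inner x y = trans (Σ-+ (allVec R m) (λ _ → β x y) (degree x))
            (cong (_+ Σ (allVec R m) (degree x)) (trans (Σ-const (β x y) (allVec R m)) (cong (_* β x y) (length-allVec R m))))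
          split : Σ R (λ x → Σ (allVec R (suc m)) (degree x)) ≡ r ^ m * pairs + r * D
          split = begin-equality
            Σ R (λ x → Σ (allVec R (suc m)) (degree x))
              ≡⟨ Σ-cong R (λ x → trans (Σ-allVec-suc R m (degree x)) (Σ-cong R (inner x))) ⟩
            Σ R (λ x → Σ R (λ y → r ^ m * β x y + Σ (allVec R m) (degree x)))
              ≡⟨ Σ-cong R (λ x → trans (Σ-+ R (λ y → r ^ m * β x y) (λ _ → Σ (allVec R m) (degree x)))
                   (cong₂ _+_ (Σ-* (r ^ m) R (β x)) (Σ-const (Σ (allVec R m) (degree x)) R))) ⟩
            Σ R (λ x → r ^ m * Σ R (β x) + r * Σ (allVec R m) (degree x))
              ≡⟨ trans (Σ-+ R (λ x → r ^ m * Σ R (β x)) (λ x → r * Σ (allVec R m) (degree x)))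
                   (cong₂ _+_ (Σ-* (r ^ m) R (λ x → Σ R (β x))) (Σ-* r R (λ x → Σ (allVec R m) (degree x)))) ⟩
            r ^ m * pairs + r * D ∎

        -- Linearity of expectation: there are at most m² pairs of positions, and a random pair of
        -- indices is bad with probability at most 1/E.
        badnesses : ∀ m → E * Σ (allVec R m) badness ≤ m * m * r ^ m
        badnesses zero = ≤-reflexive (*-zeroʳ E)
        badnesses (suc m) = begin
          E * Σ (allVec R (suc m)) badness
            ≡⟨ cong (E *_) (trans (Σ-allVec-suc R m badness) (Σ-cong R (λ x → Σ-+ (allVec R m) (degree x) badness))) ⟩
          E * Σ R (λ x → Σ (allVec R m) (degree x) + Σ (allVec R m) badness)
            ≡⟨ cong (E *_) (trans (Σ-+ R (λ x → Σ (allVec R m) (degree x)) (λ _ → Σ (allVec R m) badness)) (cong (D +_) (Σ-const (Σ (allVec R m) badness) R))) ⟩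
          E * (D + r * Σ (allVec R m) badness)
            ≡⟨ distribute E D r (Σ (allVec R m) badness) ⟩
          E * D + r * (E * Σ (allVec R m) badness)
            ≤⟨ +-mono-≤ (degrees m) (*-monoʳ-≤ r (badnesses m)) ⟩
          m * (r * r ^ m) + r * (m * m * r ^ m)
            ≡⟨ collect m r (r ^ m) ⟩
          (m + m * m) * r ^ suc m
            ≤⟨ *-monoˡ-≤ (r ^ suc m) (m≤n+m (m + m * m) (suc m)) ⟩
          (suc m + (m + m * m)) * r ^ suc m
            ≡⟨ cong (λ z → (suc m + z) * r ^ suc m) (*-suc m m) ⟨
          suc m * suc m * r ^ suc m ∎
          where
          open ≤-Reasoning
          D : ℕ
          D = Σ R (λ x → Σ (allVec R m) (degree x))
          distribute : ∀ e d r b → e * (d + r * b) ≡ e * d + r * (e * b)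
          distribute = solve-∀
          collect : ∀ m r x → m * (r * x) + r * (m * m * x) ≡ (m + m * m) * (r * x)
          collect = solve-∀

      good-tuples : ∀ m → List (Vec I m)
      good-tuples m = filter (λ t → badness t ≟ 0) (allVec R m)

      good-tuples-unique : ∀ m → Unique R → Unique (good-tuples m)
      good-tuples-unique m unique = proj₂ (filter-⊑ (λ t → badness t ≟ 0) (allVec R m)) (allVec-unique R m unique)

      good-tuples-good : ∀ m {t} → t ∈ good-tuples m → (∀ j → lookup t j ∈ R) × NoBadPair t
      good-tuples-good m {t} t∈ with ∈-filter⁻ (λ t → badness t ≟ 0) {xs = allVec R m} t∈
      ... | t∈all , eq = allVec-entries R m t∈all , badness≡0 t eq

      -- Markov's inequality: a tuple that is not good has badness at least 1.
      many-good-tuples : ∀ m → E * r ^ m ≤ E * length (good-tuples m) + m * m * r ^ m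
      many-good-tuples m = begin
        E * r ^ m                                       ≡⟨ cong (E *_) (trans (sym (length-allVec R m)) (length-partition (λ t → badness t ≟ 0) (allVec R m))) ⟩
        E * (length (good-tuples m) + length bad)       ≡⟨ *-distribˡ-+ E _ _ ⟩
        E * length (good-tuples m) + E * length bad     ≤⟨ +-monoʳ-≤ (E * length (good-tuples m))
                                                             (≤-trans (*-monoʳ-≤ E (length-filter-nonzero badness (allVec R m))) (badnesses m)) ⟩
        E * length (good-tuples m) + m * m * r ^ m      ∎
        where
        open ≤-Reasoning
        bad : List (Vec I m)
        bad = filter (λ t → ¬? (badness t ≟ 0)) (allVec R m)

-- Rational inequalities from natural numbers

module Fractions where
  open import Data.Integer using (+_)
  import Data.Integer as ℤ
  import Data.Integer.Properties as ℤₚ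
  import Data.Nat as ℕ
  import Data.Nat.Properties as ℕₚ
  import Data.Nat.Tactic.RingSolver as ℕ-Solver
  open import Data.Nat using (zero; suc)
  open import Data.Rational
  open import Data.Rational.Properties
  open import Data.List using (List; []; _∷_; map; length)
  open import Data.Nat.ListAction using (sum)
  open import Data.Product using (_,_; ∃; _×_)
  open import Data.Sum using (_⊎_; inj₁; inj₂)
  open import Data.Rational.Unnormalised using (mkℚᵘ; *≡*; *≤*) renaming (_≃_ to _≃ᵘ_)
  import Data.Rational.Unnormalised as ℚᵘ
  import Data.Rational.Unnormalised.Properties as ℚᵘₚ
  open import Algebra.Structures using (IsCommutativeRing)
  open import Level using (0ℓ)
  open import Relation.Nullary.Decidable using (dec⇒maybe)
  open import Relation.Binary.PropositionalEquality
  open import Defs using (frac)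
  import Tactic.RingSolver as Solver
  import Tactic.RingSolver.Core.AlmostCommutativeRing as ACR

  open BigSum _≤_ _+_ _*_ 0ℚ 1ℚ (IsCommutativeRing.isCommutativeSemiring +-*-isCommutativeRing) ≤-refl +-mono-≤ public

  ⟦_⟧ : ℕ → ℚ
  ⟦ k ⟧ = frac k 1

  private
    toℚᵘ-frac : ∀ a b → toℚᵘ (frac a (suc b)) ≃ᵘ mkℚᵘ (+ a) b
    toℚᵘ-frac a b = toℚᵘ-fromℚᵘ (mkℚᵘ (+ a) b)

  ⟦⟧-+ : ∀ a b → ⟦ a ℕ.+ b ⟧ ≡ ⟦ a ⟧ + ⟦ b ⟧
  ⟦⟧-+ a b = toℚᵘ-injective (begin
    toℚᵘ ⟦ a ℕ.+ b ⟧            ≈⟨ toℚᵘ-frac (a ℕ.+ b) 0 ⟩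
    mkℚᵘ (+ (a ℕ.+ b)) 0        ≈⟨ *≡* (cong (ℤ._* ℤ.1ℤ) (trans (ℤₚ.pos-+ a b) (sym (cong₂ ℤ._+_ (ℤₚ.*-identityʳ (+ a)) (ℤₚ.*-identityʳ (+ b)))))) ⟩
    mkℚᵘ (+ a) 0 ℚᵘ.+ mkℚᵘ (+ b) 0 ≈⟨ ℚᵘₚ.+-cong (toℚᵘ-frac a 0) (toℚᵘ-frac b 0) ⟨
    toℚᵘ ⟦ a ⟧ ℚᵘ.+ toℚᵘ ⟦ b ⟧  ≈⟨ toℚᵘ-homo-+ ⟦ a ⟧ ⟦ b ⟧ ⟨
    toℚᵘ (⟦ a ⟧ + ⟦ b ⟧)        ∎)
    where open ℚᵘₚ.≃-Reasoning

  ⟦⟧-* : ∀ a b → ⟦ a ℕ.* b ⟧ ≡ ⟦ a ⟧ * ⟦ b ⟧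
  ⟦⟧-* a b = toℚᵘ-injective (begin
    toℚᵘ ⟦ a ℕ.* b ⟧            ≈⟨ toℚᵘ-frac (a ℕ.* b) 0 ⟩
    mkℚᵘ (+ (a ℕ.* b)) 0        ≈⟨ *≡* (cong (ℤ._* ℤ.1ℤ) (ℤₚ.pos-* a b)) ⟩
    mkℚᵘ (+ a) 0 ℚᵘ.* mkℚᵘ (+ b) 0 ≈⟨ ℚᵘₚ.*-cong (toℚᵘ-frac a 0) (toℚᵘ-frac b 0) ⟨
    toℚᵘ ⟦ a ⟧ ℚᵘ.* toℚᵘ ⟦ b ⟧  ≈⟨ toℚᵘ-homo-* ⟦ a ⟧ ⟦ b ⟧ ⟨
    toℚᵘ (⟦ a ⟧ * ⟦ b ⟧)        ∎)
    where open ℚᵘₚ.≃-Reasoning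

  frac-cancel : ∀ a b → 1 ℕ.≤ b → frac a b * ⟦ b ⟧ ≡ ⟦ a ⟧
  frac-cancel a (suc b) _ = toℚᵘ-injective (begin
    toℚᵘ (frac a (suc b) * ⟦ suc b ⟧)           ≈⟨ toℚᵘ-homo-* (frac a (suc b)) ⟦ suc b ⟧ ⟩
    toℚᵘ (frac a (suc b)) ℚᵘ.* toℚᵘ ⟦ suc b ⟧   ≈⟨ ℚᵘₚ.*-cong (toℚᵘ-frac a b) (toℚᵘ-frac (suc b) 0) ⟩
    mkℚᵘ (+ a) b ℚᵘ.* mkℚᵘ (+ suc b) 0          ≈⟨ *≡* (trans (ℤₚ.*-identityʳ (+ a ℤ.* + suc b)) (cong (λ z → + a ℤ.* + suc z) (sym (ℕₚ.*-identityʳ b)))) ⟩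
    mkℚᵘ (+ a) 0                                ≈⟨ toℚᵘ-frac a 0 ⟨
    toℚᵘ ⟦ a ⟧                                  ∎)
    where open ℚᵘₚ.≃-Reasoning

  ⟦⟧-mono : ∀ {a b} → a ℕ.≤ b → ⟦ a ⟧ ≤ ⟦ b ⟧
  ⟦⟧-mono {a} {b} a≤b = toℚᵘ-cancel-≤ (ℚᵘₚ.≤-respˡ-≃ (ℚᵘₚ.≃-sym (toℚᵘ-frac a 0)) (ℚᵘₚ.≤-respʳ-≃ (ℚᵘₚ.≃-sym (toℚᵘ-frac b 0))
    (*≤* (ℤₚ.*-monoʳ-≤-nonNeg ℤ.1ℤ (ℤ.+≤+ a≤b)))))

  ⟦⟧-reflect : ∀ {a b} → ⟦ a ⟧ ≤ ⟦ b ⟧ → a ℕ.≤ b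
  ⟦⟧-reflect {a} {b} le = ℤₚ.drop‿+≤+ (subst₂ ℤ._≤_ (ℤₚ.*-identityʳ (+ a)) (ℤₚ.*-identityʳ (+ b))
    (ℚᵘₚ.drop-*≤* (ℚᵘₚ.≤-respˡ-≃ (toℚᵘ-frac a 0) (ℚᵘₚ.≤-respʳ-≃ (toℚᵘ-frac b 0) (toℚᵘ-mono-≤ le)))))

  ring : ACR.AlmostCommutativeRing 0ℓ 0ℓ
  ring = ACR.fromCommutativeRing +-*-commutativeRing (λ x → dec⇒maybe (0ℚ ≟ x))

  ≤-cert : ∀ {x y e} → 0ℚ ≤ e → y - x ≡ e → x ≤ y
  ≤-cert {x} {y} {e} 0≤e eq = subst₂ _≤_ (+-identityʳ x) (trans (cong (λ z → x + z) (sym eq)) (recombine x y)) (+-monoʳ-≤ x 0≤e)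
    where
    recombine : ∀ x y → x + (y - x) ≡ y
    recombine = Solver.solve-∀ ring

  ≤⇒0≤- : ∀ {x y} → x ≤ y → 0ℚ ≤ y - x
  ≤⇒0≤- {x} {y} x≤y = subst (_≤ y - x) (+-inverseʳ x) (+-monoˡ-≤ (- x) x≤y)

  *-monoˡ : ∀ {c x y} → 0ℚ ≤ c → x ≤ y → c * x ≤ c * y
  *-monoˡ {c} 0≤c = *-monoˡ-≤-nonNeg c {{nonNegative 0≤c}}

  0≤-* : ∀ {x y} → 0ℚ ≤ x → 0ℚ ≤ y → 0ℚ ≤ x * y
  0≤-* {x} {y} 0≤x 0≤y = subst (_≤ x * y) (*-zeroʳ x) (*-monoˡ 0≤x 0≤y)

  0≤-+ : ∀ {x y} → 0ℚ ≤ x → 0ℚ ≤ y → 0ℚ ≤ x + y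
  0≤-+ = +-mono-≤

  0≤1 : 0ℚ ≤ 1ℚ
  0≤1 = ⟦⟧-mono {0} {1} ℕ.z≤n

  0≤-sq : ∀ x → 0ℚ ≤ x * x
  0≤-sq x = by-sign (≤-total 0ℚ x)
    where
    neg-sq : ∀ x → (- x) * (- x) ≡ x * x
    neg-sq = Solver.solve-∀ ring
    by-sign : 0ℚ ≤ x ⊎ x ≤ 0ℚ → 0ℚ ≤ x * x
    by-sign (inj₁ 0≤x) = 0≤-* 0≤x 0≤x
    by-sign (inj₂ x≤0) = subst (0ℚ ≤_) (neg-sq x) (0≤-* (neg-antimono-≤ x≤0) (neg-antimono-≤ x≤0))

  frac-nonneg : ∀ a b → 0ℚ ≤ frac a b
  frac-nonneg a zero = ≤-refl
  frac-nonneg a (suc b) = nonNegative⁻¹ (frac a (suc b)) {{normalize-nonNeg a (suc b)}}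

  ⟦⟧-positive : ∀ {k} → 1 ℕ.≤ k → Positive ⟦ k ⟧
  ⟦⟧-positive 1≤k = positive (<-≤-trans (positive⁻¹ 1ℚ) (⟦⟧-mono 1≤k))

  ≤-clear : ∀ {x y k} → 1 ℕ.≤ k → x * ⟦ k ⟧ ≤ y * ⟦ k ⟧ → x ≤ y
  ≤-clear {k = k} 1≤k = *-cancelʳ-≤-pos ⟦ k ⟧ {{⟦⟧-positive 1≤k}}

  ≡-clear : ∀ {x y k} → 1 ℕ.≤ k → x * ⟦ k ⟧ ≡ y * ⟦ k ⟧ → x ≡ y
  ≡-clear 1≤k eq = ≤-antisym (≤-clear 1≤k (≤-reflexive eq)) (≤-clear 1≤k (≤-reflexive (sym eq)))

  frac-+ : ∀ a c {b} → 1 ℕ.≤ b → frac (a ℕ.+ c) b ≡ frac a b + frac c b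
  frac-+ a c {b} 1≤b = ≡-clear 1≤b (begin
    frac (a ℕ.+ c) b * ⟦ b ⟧                ≡⟨ frac-cancel (a ℕ.+ c) b 1≤b ⟩
    ⟦ a ℕ.+ c ⟧                             ≡⟨ ⟦⟧-+ a c ⟩
    ⟦ a ⟧ + ⟦ c ⟧                           ≡⟨ cong₂ _+_ (frac-cancel a b 1≤b) (frac-cancel c b 1≤b) ⟨
    frac a b * ⟦ b ⟧ + frac c b * ⟦ b ⟧     ≡⟨ *-distribʳ-+ ⟦ b ⟧ (frac a b) (frac c b) ⟨
    (frac a b + frac c b) * ⟦ b ⟧           ∎)
    where open ≡-Reasoning

  frac-0 : ∀ {b} → 1 ℕ.≤ b → frac 0 b ≡ 0ℚ
  frac-0 {b} 1≤b = ≡-clear 1≤b (trans (frac-cancel 0 b 1≤b) (sym (*-zeroˡ ⟦ b ⟧)))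

  frac-1 : ∀ {b} → 1 ℕ.≤ b → frac b b ≡ 1ℚ
  frac-1 {b} 1≤b = ≡-clear 1≤b (trans (frac-cancel b b 1≤b) (sym (*-identityˡ ⟦ b ⟧)))

  frac-mono : ∀ {a c b} → 1 ℕ.≤ b → a ℕ.≤ c → frac a b ≤ frac c b
  frac-mono {a} {c} {b} 1≤b a≤c = ≤-clear 1≤b (subst₂ _≤_ (sym (frac-cancel a b 1≤b)) (sym (frac-cancel c b 1≤b)) (⟦⟧-mono a≤c))

  -- The bridge between the cleared inequalities `Unif` and `Close` of the counting argument and the
  -- probabilities in the correlation.
  frac-≤-+ : ∀ a b c d H → 1 ℕ.≤ b → 1 ℕ.≤ d → 1 ℕ.≤ H →
             a ℕ.* d ℕ.* H ℕ.≤ c ℕ.* b ℕ.* H ℕ.+ b ℕ.* d → frac a b ≤ frac c d + frac 1 H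
  frac-≤-+ a b c d H 1≤b 1≤d 1≤H le = ≤-clear 1≤b (≤-clear 1≤d (≤-clear 1≤H (begin
    frac a b * ⟦ b ⟧ * ⟦ d ⟧ * ⟦ H ⟧
      ≡⟨ cong (λ z → z * ⟦ d ⟧ * ⟦ H ⟧) (frac-cancel a b 1≤b) ⟩
    ⟦ a ⟧ * ⟦ d ⟧ * ⟦ H ⟧
      ≡⟨ trans (⟦⟧-* (a ℕ.* d) H) (cong (_* ⟦ H ⟧) (⟦⟧-* a d)) ⟨
    ⟦ a ℕ.* d ℕ.* H ⟧
      ≤⟨ ⟦⟧-mono le ⟩
    ⟦ c ℕ.* b ℕ.* H ℕ.+ b ℕ.* d ⟧
      ≡⟨ trans (⟦⟧-+ (c ℕ.* b ℕ.* H) (b ℕ.* d)) (cong₂ _+_ (trans (⟦⟧-* (c ℕ.* b) H) (cong (_* ⟦ H ⟧) (⟦⟧-* c b))) (⟦⟧-* b d)) ⟩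
    ⟦ c ⟧ * ⟦ b ⟧ * ⟦ H ⟧ + ⟦ b ⟧ * ⟦ d ⟧
      ≡⟨ cong (λ z → ⟦ c ⟧ * ⟦ b ⟧ * ⟦ H ⟧ + z) (*-identityʳ (⟦ b ⟧ * ⟦ d ⟧)) ⟨
    ⟦ c ⟧ * ⟦ b ⟧ * ⟦ H ⟧ + ⟦ b ⟧ * ⟦ d ⟧ * 1ℚ
      ≡⟨ cong₂ (λ y z → y * ⟦ b ⟧ * ⟦ H ⟧ + ⟦ b ⟧ * ⟦ d ⟧ * z) (frac-cancel c d 1≤d) (frac-cancel 1 H 1≤H) ⟨
    frac c d * ⟦ d ⟧ * ⟦ b ⟧ * ⟦ H ⟧ + ⟦ b ⟧ * ⟦ d ⟧ * (frac 1 H * ⟦ H ⟧)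
      ≡⟨ rearr (frac c d) (frac 1 H) ⟦ b ⟧ ⟦ d ⟧ ⟦ H ⟧ ⟩
    (frac c d + frac 1 H) * ⟦ b ⟧ * ⟦ d ⟧ * ⟦ H ⟧ ∎)))
    where
    open ≤-Reasoning
    rearr : ∀ x h b d H → x * d * b * H + b * d * (h * H) ≡ (x + h) * b * d * H
    rearr = Solver.solve-∀ ring

  Σ-frac : {X : Set} (xs : List X) (f : X → ℕ) {b : ℕ} → 1 ℕ.≤ b → Σ xs (λ x → frac (f x) b) ≡ frac (sum (map f xs)) b
  Σ-frac [] f 1≤b = sym (frac-0 1≤b)
  Σ-frac (x ∷ xs) f {b} 1≤b = trans (cong (λ z → frac (f x) b + z) (Σ-frac xs f 1≤b)) (sym (frac-+ (f x) (sum (map f xs)) 1≤b))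

  Σ-const : {X : Set} (c : ℚ) (xs : List X) → Σ xs (λ _ → c) ≡ ⟦ length xs ⟧ * c
  Σ-const c [] = sym (*-zeroˡ c)
  Σ-const c (x ∷ xs) = trans (cong (λ z → c + z) (Σ-const c xs))
    (trans (distribute ⟦ length xs ⟧ c) (cong (_* c) (sym (⟦⟧-+ 1 (length xs)))))
    where
    distribute : ∀ l c → c + l * c ≡ (1ℚ + l) * c
    distribute = Solver.solve-∀ ring

  -- The numerator of a positive rational is at least 1, so the reciprocal of its denominator is a
  -- lower bound.
  unit-fraction-below : ∀ q → 0ℚ < q → ∃ λ D → 1 ℕ.≤ D × frac 1 D ≤ q
  unit-fraction-below q@(mkℚ (+ suc a) d _) 0<q = suc d , ℕ.s≤s ℕ.z≤n ,
    subst (frac 1 (suc d) ≤_) (↥p/↧p≡p q) (frac-mono {1} {suc a} {suc d} (ℕ.s≤s ℕ.z≤n) (ℕ.s≤s ℕ.z≤n))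
  unit-fraction-below q@(mkℚ (+ zero) d _) 0<q with () ← Data.Rational.positive 0<q
  unit-fraction-below q@(mkℚ ℤ.-[1+ a ] d _) 0<q with () ← Data.Rational.positive 0<q

  frac-1-anti : ∀ D k → 1 ℕ.≤ D → 1 ℕ.≤ k → frac 1 (D ℕ.* k) ≤ frac 1 D
  frac-1-anti D k 1≤D 1≤k = ≤-clear {k = D ℕ.* k} 1≤Dk (begin
    frac 1 (D ℕ.* k) * ⟦ D ℕ.* k ⟧   ≡⟨ frac-cancel 1 (D ℕ.* k) 1≤Dk ⟩
    ⟦ 1 ⟧                            ≤⟨ ⟦⟧-mono 1≤k ⟩
    ⟦ k ⟧                            ≡⟨ *-identityˡ ⟦ k ⟧ ⟨
    1ℚ * ⟦ k ⟧                       ≡⟨ cong (_* ⟦ k ⟧) (frac-cancel 1 D 1≤D) ⟨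
    frac 1 D * ⟦ D ⟧ * ⟦ k ⟧         ≡⟨ trans (*-assoc (frac 1 D) ⟦ D ⟧ ⟦ k ⟧) (cong (λ z → frac 1 D * z) (sym (⟦⟧-* D k))) ⟩
    frac 1 D * ⟦ D ℕ.* k ⟧           ∎)
    where
    open ≤-Reasoning
    1≤Dk : 1 ℕ.≤ D ℕ.* k
    1≤Dk = ℕₚ.*-mono-≤ 1≤D 1≤k

  common-unit-fraction : ∀ {x y z} → 0ℚ < x → 0ℚ < y → 0ℚ < z →
    ∃ λ D → 1 ℕ.≤ D × frac 1 D ≤ x × frac 1 D ≤ y × frac 1 D ≤ z
  common-unit-fraction {x} {y} {z} 0<x 0<y 0<z
    with unit-fraction-below x 0<x | unit-fraction-below y 0<y | unit-fraction-below z 0<z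
  ... | a , 1≤a , a≤x | b , 1≤b , b≤y | c , 1≤c , c≤z = a ℕ.* (b ℕ.* c) , ℕₚ.*-mono-≤ 1≤a (ℕₚ.*-mono-≤ 1≤b 1≤c) ,
    ≤-trans (frac-1-anti a (b ℕ.* c) 1≤a (ℕₚ.*-mono-≤ 1≤b 1≤c)) a≤x ,
    ≤-trans (subst (λ k → frac 1 k ≤ frac 1 b) (second a b c) (frac-1-anti b (a ℕ.* c) 1≤b (ℕₚ.*-mono-≤ 1≤a 1≤c))) b≤y ,
    ≤-trans (subst (λ k → frac 1 k ≤ frac 1 c) (third a b c) (frac-1-anti c (a ℕ.* b) 1≤c (ℕₚ.*-mono-≤ 1≤a 1≤b))) c≤z
    where
    second : ∀ a b c → b ℕ.* (a ℕ.* c) ≡ a ℕ.* (b ℕ.* c)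
    second = ℕ-Solver.solve-∀
    third : ∀ a b c → c ℕ.* (a ℕ.* b) ≡ a ℕ.* (b ℕ.* c)
    third = ℕ-Solver.solve-∀

-- Correlation of pairwise close distributions

module Correlation where
  import Data.Nat as ℕ
  import Data.Nat.Properties as ℕₚ
  open import Data.Nat using (zero; suc)
  open import Data.Fin using (Fin; zero; suc)
  open import Data.Rational
  open import Data.Rational.Properties
  open import Data.List using (allFin)
  open import Data.List.Properties using (length-tabulate)
  open import Data.Vec using (Vec; []; _∷_; lookup)
  open import Data.Product using (_,_; ∃; _×_)
  open import Data.Sum using (_⊎_; inj₁; inj₂)
  open import Data.Unit using (⊤)
  open import Relation.Binary.PropositionalEquality
  open import Defs using (frac)
  import Tactic.RingSolver as Solver
  open Fractions

  module PairwiseClose {I : Set} (p : ℕ) (1≤p : 1 ℕ.≤ p) (f : I → Fin p → ℚ)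
    (0≤f : ∀ j d → 0ℚ ≤ f j d) (f≤1 : ∀ j d → f j d ≤ 1ℚ) (Σf≡1 : ∀ j → Σ (allFin p) (f j) ≡ 1ℚ)
    (η : ℚ) (0≤η : 0ℚ ≤ η) where

    ι P : ℚ
    ι = frac 1 p
    P = ⟦ p ⟧

    -- One-sided: no residue is much rarer than 1/p. Lower bounds on the factors are what a lower
    -- bound on the sum of their products requires.
    Uniform : I → Set
    Uniform j = ∀ d → ι ≤ f j d + η

    Close : I → I → Set
    Close i j = ∀ d → f i d ≤ f j d + η

    PairsClose : ∀ {m} → Vec I m → Set
    PairsClose [] = ⊤
    PairsClose (x ∷ t) = (Uniform x ⊎ (∀ k → Uniform (lookup t k) ⊎ Close x (lookup t k))) × PairsClose t

    Π : ∀ {m} → Vec I m → Fin p → ℚ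
    Π [] d = 1ℚ
    Π (j ∷ t) d = f j d * Π t d

    private
      Σ-1 : ∀ c → Σ (allFin p) (λ _ → c) ≡ P * c
      Σ-1 c = trans (Σ-const c (allFin p)) (cong (λ k → ⟦ k ⟧ * c) (length-tabulate (λ (d : Fin p) → d)))

      ιP≡1 : ι * P ≡ 1ℚ
      ιP≡1 = frac-cancel 1 p 1≤p

      record Distribution (q : Fin p → ℚ) : Set where
        field
          nonneg : ∀ d → 0ℚ ≤ q d
          ≤one : ∀ d → q d ≤ 1ℚ
          total : Σ (allFin p) q ≡ 1ℚ
      open Distribution

      Follows : (Fin p → ℚ) → ∀ {m} → Vec I m → Set
      Follows q t = ∀ k → Uniform (lookup t k) ⊎ (∀ d → q d ≤ f (lookup t k) d + η)

      -- The first entry not known to be uniform supplies `q`; every later entry is uniform or close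
      -- to it. If all entries are uniform, the uniform distribution serves.
      reference : ∀ {m} (t : Vec I m) → PairsClose t → ∃ λ q → Distribution q × Follows q t
      reference [] _ = (λ _ → ι) , record
        { nonneg = λ _ → frac-nonneg 1 p
        ; ≤one = λ _ → subst (ι ≤_) (frac-1 1≤p) (frac-mono 1≤p 1≤p)
        ; total = trans (Σ-1 ι) (trans (*-comm P ι) ιP≡1) } , λ ()
      reference (x ∷ t) (inj₂ close , _) = f x , record { nonneg = 0≤f x ; ≤one = f≤1 x ; total = Σf≡1 x } , follows
        where
        follows : Follows (f x) (x ∷ t)
        follows zero = inj₂ (λ d → subst (_≤ f x d + η) (+-identityʳ (f x d)) (+-monoʳ-≤ (f x d) 0≤η))
        follows (suc k) = close k
      reference (x ∷ t) (inj₁ uniform , pairs) = extend (reference t pairs)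
        where
        extend : (∃ λ q → Distribution q × Follows q t) → ∃ λ q → Distribution q × Follows q (x ∷ t)
        extend (q , dist , follows) = q , dist , λ { zero → inj₁ uniform ; (suc k) → follows k }

      -- w is the product of the approximating distributions; its lower bound is Bernoulli's inequality for
      -- (P q)^r, where r counts the factors different from ι.
      record Approximation (q : Fin p → ℚ) {m : ℕ} (t : Vec I m) : Set where
        field
          r : ℚ
          w : Fin p → ℚ
          0≤r : 0ℚ ≤ r
          0≤w : ∀ d → 0ℚ ≤ w d
          w≤1 : ∀ d → w d ≤ 1ℚ
          w≤Π : ∀ d → w d ≤ Π t d + ⟦ m ⟧ * η
          bernoulli : ∀ d → 1ℚ + r * (P * q d - 1ℚ) ≤ ⟦ p ℕ.^ m ⟧ * w d

      approximate : ∀ {q} → Distribution q → ∀ {m} (t : Vec I m) → Follows q t → Approximation q t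
      approximate {q} dist [] _ = record
        { r = 0ℚ ; w = λ _ → 1ℚ ; 0≤r = ≤-refl ; 0≤w = λ _ → 0≤1 ; w≤1 = λ _ → ≤-refl
        ; w≤Π = λ _ → ≤-reflexive (zero-error η) ; bernoulli = λ d → ≤-reflexive (zero-power P (q d)) }
        where
        zero-error : ∀ η → 1ℚ ≡ 1ℚ + 0ℚ * η
        zero-error = Solver.solve-∀ ring
        zero-power : ∀ P q → 1ℚ + 0ℚ * (P * q - 1ℚ) ≡ 1ℚ * 1ℚ
        zero-power = Solver.solve-∀ ring
      approximate {q} dist {suc m} (x ∷ t) follows = extend (follows zero)
        where
        open Approximation (approximate dist t (λ k → follows (suc k)))
        err : ℚ
        err = ⟦ m ⟧ * η
        0≤err : 0ℚ ≤ err
        0≤err = 0≤-* (frac-nonneg m 1) 0≤η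
        -- Replacing one more factor costs another η and no more, because `f x d` and `w d` lie
        -- between 0 and 1.
        below : ∀ {g} d → g ≤ f x d + η → g * w d ≤ f x d * Π t d + ⟦ suc m ⟧ * η
        below {g} d g≤ = ≤-cert
          (0≤-+ (0≤-+ (0≤-+ (0≤-* (0≤f x d) (≤⇒0≤- (w≤Π d))) (0≤-* (≤⇒0≤- (f≤1 x d)) 0≤err))
                      (0≤-* (0≤w d) (≤⇒0≤- g≤))) (0≤-* (≤⇒0≤- (w≤1 d)) 0≤η))
          (trans (cong (λ z → f x d * Π t d + z * η - g * w d) (⟦⟧-+ 1 m)) (slack (f x d) (Π t d) ⟦ m ⟧ η g (w d)))
          where
          slack : ∀ f π m η g w → f * π + (1ℚ + m) * η - g * w
            ≡ ((f * ((π + m * η) - w) + (1ℚ - f) * (m * η)) + w * ((f + η) - g)) + (1ℚ - w) * η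
          slack = Solver.solve-∀ ring
        at-most-1 : ∀ {g} d → 0ℚ ≤ g → g ≤ 1ℚ → g * w d ≤ 1ℚ
        at-most-1 {g} d 0≤g g≤1 = ≤-cert (0≤-+ (≤⇒0≤- g≤1) (0≤-* 0≤g (≤⇒0≤- (w≤1 d)))) (slack g (w d))
          where
          slack : ∀ g w → 1ℚ - g * w ≡ (1ℚ - g) + g * (1ℚ - w)
          slack = Solver.solve-∀ ring
        power : ⟦ p ℕ.^ suc m ⟧ ≡ P * ⟦ p ℕ.^ m ⟧
        power = ⟦⟧-* p (p ℕ.^ m)
        extend : Uniform x ⊎ (∀ d → q d ≤ f x d + η) → Approximation q (x ∷ t)
        extend (inj₁ uniform) = record
          { r = r ; w = λ d → ι * w d ; 0≤r = 0≤r
          ; 0≤w = λ d → 0≤-* (frac-nonneg 1 p) (0≤w d)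
          ; w≤1 = λ d → at-most-1 d (frac-nonneg 1 p) (subst (ι ≤_) (frac-1 1≤p) (frac-mono 1≤p 1≤p))
          ; w≤Π = λ d → below d (uniform d)
          ; bernoulli = λ d → ≤-trans (bernoulli d) (≤-reflexive (sym (same d))) }
          where
          regroup : ∀ P k ι w → P * k * (ι * w) ≡ ι * P * (k * w)
          regroup = Solver.solve-∀ ring
          same : ∀ d → ⟦ p ℕ.^ suc m ⟧ * (ι * w d) ≡ ⟦ p ℕ.^ m ⟧ * w d
          same d = trans (cong (_* (ι * w d)) power) (trans (regroup P ⟦ p ℕ.^ m ⟧ ι (w d))
            (trans (cong (_* (⟦ p ℕ.^ m ⟧ * w d)) ιP≡1) (*-identityˡ _)))
        extend (inj₂ close) = record
          { r = 1ℚ + r ; w = λ d → q d * w d ; 0≤r = 0≤-+ 0≤1 0≤r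
          ; 0≤w = λ d → 0≤-* (nonneg dist d) (0≤w d)
          ; w≤1 = λ d → at-most-1 d (nonneg dist d) (≤one dist d)
          ; w≤Π = λ d → below d (close d)
          -- The induction hypothesis is multiplied by P q; the surplus over the next linear bound
          -- is r (P q - 1)².
          ; bernoulli = λ d → ≤-cert
              (0≤-+ (0≤-* (0≤-* (frac-nonneg p 1) (nonneg dist d)) (≤⇒0≤- (bernoulli d))) (0≤-* 0≤r (0≤-sq (P * q d - 1ℚ))))
              (trans (cong (λ z → z * (q d * w d) - (1ℚ + (1ℚ + r) * (P * q d - 1ℚ))) power) (slack P (q d) ⟦ p ℕ.^ m ⟧ (w d) r)) }
          where
          slack : ∀ P q k w r → P * k * (q * w) - (1ℚ + (1ℚ + r) * (P * q - 1ℚ))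
            ≡ P * q * (k * w - (1ℚ + r * (P * q - 1ℚ))) + r * ((P * q - 1ℚ) * (P * q - 1ℚ))
          slack = Solver.solve-∀ ring

    -- Summed over the residues, the linear terms of Bernoulli's bound cancel because P q - 1 has
    -- sum 0. Hence the products `w` sum to at least p^(-m), and each of the p residues carries an
    -- error of (m + 1) η.
    correlation-bound : ∀ {m} (t : Vec I (suc m)) → PairsClose t →
                        frac 1 (p ℕ.^ m) ≤ Σ (allFin p) (Π t) + P * (⟦ suc m ⟧ * η)
    correlation-bound {m} t pairs = go (reference t pairs)
      where
      open ≤-Reasoning
      go : (∃ λ q → Distribution q × Follows q t) → frac 1 (p ℕ.^ m) ≤ Σ (allFin p) (Π t) + P * (⟦ suc m ⟧ * η)
      go (q , dist , follows) = ≤-clear {k = p ℕ.^ m} 1≤p^m (≤-clear {k = p} 1≤p (begin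
        frac 1 (p ℕ.^ m) * ⟦ p ℕ.^ m ⟧ * P       ≡⟨ cong (_* P) (frac-cancel 1 (p ℕ.^ m) 1≤p^m) ⟩
        1ℚ * P                                   ≡⟨ trans (*-identityˡ P) (sym lower-total) ⟩
        Σ (allFin p) (λ d → 1ℚ + r * (P * q d - 1ℚ)) ≤⟨ Σ-mono (allFin p) bernoulli ⟩
        Σ (allFin p) (λ d → ⟦ p ℕ.^ suc m ⟧ * w d) ≡⟨ Σ-* ⟦ p ℕ.^ suc m ⟧ (allFin p) w ⟩
        ⟦ p ℕ.^ suc m ⟧ * Σ (allFin p) w         ≤⟨ *-monoˡ (frac-nonneg (p ℕ.^ suc m) 1) (Σ-mono (allFin p) w≤Π) ⟩
        ⟦ p ℕ.^ suc m ⟧ * Σ (allFin p) (λ d → Π t d + ⟦ suc m ⟧ * η)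
          ≡⟨ cong₂ _*_ (⟦⟧-* p (p ℕ.^ m)) (trans (Σ-+ (allFin p) (Π t) (λ _ → ⟦ suc m ⟧ * η)) (cong (λ z → Σ (allFin p) (Π t) + z) (Σ-1 (⟦ suc m ⟧ * η)))) ⟩
        P * ⟦ p ℕ.^ m ⟧ * (Σ (allFin p) (Π t) + P * (⟦ suc m ⟧ * η))
          ≡⟨ regroup P ⟦ p ℕ.^ m ⟧ (Σ (allFin p) (Π t) + P * (⟦ suc m ⟧ * η)) ⟩
        (Σ (allFin p) (Π t) + P * (⟦ suc m ⟧ * η)) * ⟦ p ℕ.^ m ⟧ * P ∎))
        where
        open Approximation (approximate dist t follows)
        1≤p^m : 1 ℕ.≤ p ℕ.^ m
        1≤p^m = ℕₚ.m^n>0 p {{ℕ.>-nonZero 1≤p}} m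
        regroup : ∀ P k s → P * k * s ≡ s * k * P
        regroup = Solver.solve-∀ ring
        affine : ∀ r P q → 1ℚ + r * (P * q - 1ℚ) ≡ (1ℚ - r) + r * P * q
        affine = Solver.solve-∀ ring
        collect : ∀ P r → P * (1ℚ - r) + r * P * 1ℚ ≡ P
        collect = Solver.solve-∀ ring
        lower-total : Σ (allFin p) (λ d → 1ℚ + r * (P * q d - 1ℚ)) ≡ P
        lower-total = trans (Σ-cong (allFin p) (λ d → affine r P (q d))) (trans (Σ-+ (allFin p) (λ _ → 1ℚ - r) (λ d → r * P * q d))
          (trans (cong₂ _+_ (Σ-1 (1ℚ - r)) (trans (Σ-* (r * P) (allFin p) q) (cong (λ z → r * P * z) (total dist)))) (collect P r)))

-- Lists without repetition as subsets

module ListSubset where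
  open import Data.Nat using (suc)
  open import Data.Fin using (Fin; zero; suc; _≟_)
  open import Data.Fin.Subset using (Subset; ⊥; ∣_∣; inside; _∈_; _∉_)
  open import Data.Fin.Subset.Properties using (∉⊥; ∣⊥∣≡0)
  open import Data.List using (List; []; _∷_; length)
  open import Data.List.Membership.Propositional using () renaming (_∈_ to _∈ᴸ_)
  import Data.List.Relation.Unary.All as All
  open import Data.List.Relation.Unary.AllPairs using ([]; _∷_)
  open import Data.List.Relation.Unary.Any using (here; there)
  open import Data.List.Relation.Unary.Unique.Propositional using (Unique)
  open import Data.Vec using (_∷_; _[_]≔_; here; there)
  open import Data.Vec.Properties using ([]≔-updates; []≔-minimal; lookup∘update′; []=⇒lookup; lookup⇒[]=)
  open import Data.Bool using (true; false)
  open import Relation.Nullary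
  open import Relation.Binary.PropositionalEquality

  fromList : ∀ {s} → List (Fin s) → Subset s
  fromList [] = ⊥
  fromList (i ∷ R) = fromList R [ i ]≔ inside

  ∈-fromList⁺ : ∀ {s} {i : Fin s} {R} → i ∈ᴸ R → i ∈ fromList R
  ∈-fromList⁺ {R = j ∷ R} (here refl) = []≔-updates (fromList R) j
  ∈-fromList⁺ {i = i} {R = j ∷ R} (there i∈) with i ≟ j
  ... | yes refl = []≔-updates (fromList R) j
  ... | no i≢j = []≔-minimal (fromList R) i j i≢j (∈-fromList⁺ i∈)

  ∈-fromList⁻ : ∀ {s} {i : Fin s} R → i ∈ fromList R → i ∈ᴸ R
  ∈-fromList⁻ [] i∈ = contradiction i∈ ∉⊥
  ∈-fromList⁻ {i = i} (j ∷ R) i∈ with i ≟ j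
  ... | yes refl = here refl
  ... | no i≢j = there (∈-fromList⁻ R (lookup⇒[]= i (fromList R)
          (trans (sym (lookup∘update′ i≢j (fromList R) inside)) ([]=⇒lookup i∈))))

  private
    ∣insert∣ : ∀ {s} (i : Fin s) (S : Subset s) → i ∉ S → ∣ S [ i ]≔ inside ∣ ≡ suc ∣ S ∣
    ∣insert∣ zero (true ∷ S) i∉ = contradiction here i∉
    ∣insert∣ zero (false ∷ S) i∉ = refl
    ∣insert∣ (suc i) (true ∷ S) i∉ = cong suc (∣insert∣ i S (λ i∈ → i∉ (there i∈)))
    ∣insert∣ (suc i) (false ∷ S) i∉ = ∣insert∣ i S (λ i∈ → i∉ (there i∈))

  ∣fromList∣ : ∀ {s} {R : List (Fin s)} → Unique R → ∣ fromList R ∣ ≡ length R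
  ∣fromList∣ {s} [] = ∣⊥∣≡0 s
  ∣fromList∣ {R = i ∷ R} (i∉R ∷ unique) = trans
    (∣insert∣ i (fromList R) (λ i∈ → All.lookup i∉R (∈-fromList⁻ R i∈) refl))
    (cong suc (∣fromList∣ unique))

open import Data.Nat using (NonZero)

-- Forms as coefficient vectors and their counts

module FormCounts (p : ℕ) .{{p≢0 : NonZero p}} (p-prime : Prime p) where
  open import Data.Bool using (Bool; true; false; _∧_)
  open import Data.Integer using (ℤ; +_)
  import Data.Integer as ℤ
  import Data.Integer.Properties as ℤₚ
  open import Data.Nat hiding (_≟_)
  open import Data.Nat.Properties hiding (_≟_)
  open import Data.Nat.Divisibility using (_∣_; divides)
  open import Data.Nat.DivMod using (_mod_; _%_; _/_; m≡m%n+[m/n]*n; m%n<n)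
  open import Data.Nat.ListAction using (sum)
  open import Data.Nat.Tactic.RingSolver using (solve-∀)
  open import Data.Fin using (Fin; zero; suc; toℕ; _≟_)
  open import Data.Fin.Properties using (toℕ-fromℕ<; toℕ-injective; toℕ<n; any?)
  open import Data.List using (List; []; _∷_; map; allFin; tabulate)
  open import Data.List.Properties using (map-tabulate)
  open import Data.Vec using (Vec; []; _∷_; replicate)
  import Data.Vec as Vec
  open import Data.Product using (_,_; ∃)
  open import Data.Sum using (inj₁; inj₂)
  open import Function using (_∘_)
  open import Relation.Nullary
  open import Relation.Nullary.Decidable using (⌊_⌋; isYes≗does; map′)
  open import Relation.Binary.PropositionalEquality
  open import Defs
  open NaturalSums
  open Residues p p-prime
  open Equidistribution p p-prime using (dot)
  open LocalAgreement p p-prime using (count; Indicator)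

  private
    variable
      n : ℕ

  vec : Form p n → Vec ℕ n
  vec = Vec.map toℕ

  ind : SubCube n → Vec Bool n → ℤ
  ind A x = + bit (A x)

  ind-indicator : (A : SubCube n) → Indicator (ind A)
  ind-indicator A x with A x
  ... | true = inj₂ refl
  ... | false = inj₁ refl

  cnt : SubCube n → Form p n → Fin p → ℕ
  cnt {n} A φ d = sum (map (λ x → bit (A x ∧ ⌊ evalForm φ x ≟ d ⌋)) (cube n))

  pos-Σ : {X : Set} (xs : List X) (f : X → ℕ) → + Σ xs f ≡ ℤΣ.Σ xs (λ x → + f x)
  pos-Σ [] f = refl
  pos-Σ (x ∷ xs) f = trans (ℤₚ.pos-+ (f x) (Σ xs f)) (cong (λ z → + f x ℤ.+ z) (pos-Σ xs f))

  private
    evaluate : Form p n → Vec Bool n → ℕ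
    evaluate φ x = Vec.foldr (λ _ → ℕ) _+_ 0 (Vec.zipWith (λ c b → toℕ c * bit b) φ x)

    evaluate-dot : (φ : Form p n) (x : Vec Bool n) → evaluate φ x ≡ dot (vec φ) x
    evaluate-dot [] [] = refl
    evaluate-dot (c ∷ φ) (b ∷ x) = cong (_+_ (toℕ c * bit b)) (evaluate-dot φ x)

    toℕ-mod : ∀ k → toℕ (k mod p) ≡ k % p
    toℕ-mod k = toℕ-fromℕ< (m%n<n k p)

    mod⇒∣ : ∀ k (d : Fin p) → k mod p ≡ d → p ∣ k + (p ∸ toℕ d)
    mod⇒∣ k d refl = divides (suc (k / p)) (begin
      k + (p ∸ toℕ (k mod p))              ≡⟨ cong (λ z → k + (p ∸ z)) (toℕ-mod k) ⟩
      k + (p ∸ k % p)                      ≡⟨ cong (_+ (p ∸ k % p)) (m≡m%n+[m/n]*n k p) ⟩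
      k % p + k / p * p + (p ∸ k % p)      ≡⟨ rearr (k % p) (k / p * p) (p ∸ k % p) ⟩
      k % p + (p ∸ k % p) + k / p * p      ≡⟨ cong (_+ k / p * p) (m+[n∸m]≡n (<⇒≤ (m%n<n k p))) ⟩
      p + k / p * p                        ∎)
      where
      open ≡-Reasoning
      rearr : ∀ r q s → r + q + s ≡ r + s + q
      rearr = solve-∀

    ∣⇒mod : ∀ k (d : Fin p) → p ∣ k + (p ∸ toℕ d) → k mod p ≡ d
    -- Both residues are below p and solve the congruence (p - d) + u = 0 modulo p, which has only
    -- one such solution.
    ∣⇒mod k d p∣ = toℕ-injective (unique-solution {1} {p ∸ toℕ d} p∤1 (toℕ<n (k mod p)) (toℕ<n d)
        (subst (p ∣_) (trans (+-comm _ (p ∸ toℕ d)) (cong (_+_ (p ∸ toℕ d)) (sym (trans (*-identityʳ _) (toℕ-mod k))))) reduced)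
        (divides 1 (trans (cong (_+_ (p ∸ toℕ d)) (*-identityʳ (toℕ d))) (trans (m∸n+n≡m (<⇒≤ (toℕ<n d))) (sym (*-identityˡ p))))))
      where
      p∤1 : ¬ p ∣ 1
      p∤1 p∣1 = Data.Nat.Primality.¬prime[1] (subst Prime (Data.Nat.Divisibility.∣1⇒≡1 p∣1) p-prime)
        where
        import Data.Nat.Primality
        import Data.Nat.Divisibility
      rearr : ∀ r q s → r + q + s ≡ q + (r + s)
      rearr = solve-∀
      reduced : p ∣ k % p + (p ∸ toℕ d)
      reduced = ∣-cancel {k / p * p}
        (subst (p ∣_) (trans (cong (_+ (p ∸ toℕ d)) (m≡m%n+[m/n]*n k p)) (rearr (k % p) (k / p * p) (p ∸ toℕ d))) p∣)
        (divides (k / p) refl)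

  -- `count` tests whether p divides v·x + b, so the equation φ(x) = d corresponds to the shift b =
  -- p - d.
  cnt-count : (A : SubCube n) (φ : Form p n) (d : Fin p) → + cnt A φ d ≡ count (ind A) (vec φ) (p ∸ toℕ d)
  cnt-count {n} A φ d = trans (pos-Σ (cube n) _) (ℤΣ.Σ-cong (cube n) pointwise)
    where
    pointwise : ∀ x → + bit (A x ∧ ⌊ evalForm φ x ≟ d ⌋) ≡ ind A x ℤ.* δ (dot (vec φ) x + (p ∸ toℕ d))
    pointwise x with A x
    ... | false = refl
    ... | true with evalForm φ x ≟ d
    ...   | yes eq = sym (trans (ℤₚ.*-identityˡ _) (δ-yes (subst (λ k → p ∣ k + (p ∸ toℕ d)) (evaluate-dot φ x) (mod⇒∣ (evaluate φ x) d eq))))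
    ...   | no neq = sym (trans (ℤₚ.*-identityˡ _) (δ-no (λ p∣ → neq (∣⇒mod (evaluate φ x) d (subst (λ k → p ∣ k + (p ∸ toℕ d)) (sym (evaluate-dot φ x)) p∣)))))

  -- Presents the size as a count, so that closeness of sizes is a case of `CountsClose`.
  size-count : (A : SubCube n) → + size A ≡ count (ind A) (replicate n 0) 0
  size-count {n} A = trans (pos-Σ (cube n) _) (ℤΣ.Σ-cong (cube n) (λ x → sym (trans
      (cong (λ z → ind A x ℤ.* z) (δ-yes (subst (p ∣_) (sym (trans (+-identityʳ _) (zero-dot x))) (divides 0 refl)))) (ℤₚ.*-identityʳ _))))
    where
    zero-dot : ∀ {n} (x : Vec Bool n) → dot (replicate n 0) x ≡ 0
    zero-dot [] = refl
    zero-dot (b ∷ x) = zero-dot x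

  cnt≤size : (A : SubCube n) (φ : Form p n) (d : Fin p) → cnt A φ d ≤ size A
  cnt≤size {n} A φ d = Σ-mono (cube n) (λ x → conj (A x) ⌊ evalForm φ x ≟ d ⌋)
    where
    conj : ∀ a b → bit (a ∧ b) ≤ bit a
    conj true true = ≤-refl
    conj true false = z≤n
    conj false b = ≤-refl

  Σ-cnt : (A : SubCube n) (φ : Form p n) → Σ (allFin p) (cnt A φ) ≡ size A
  Σ-cnt {n} A φ = trans (Σ-swap (allFin p) (cube n) (λ d x → bit (A x ∧ ⌊ evalForm φ x ≟ d ⌋))) (Σ-cong (cube n) (λ x → inner (A x) (evalForm φ x)))
    where
    Σ-tabulate : ∀ {k} {X : Set} (g : Fin k → X) (f : X → ℕ) → Σ (tabulate g) f ≡ Σ (allFin k) (f ∘ g)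
    Σ-tabulate g f = cong sum (trans (map-tabulate g f) (sym (map-tabulate (λ i → i) (f ∘ g))))
    point : ∀ {k} (e : Fin k) → Σ (allFin k) (λ d → bit ⌊ e ≟ d ⌋) ≡ 1
    point {suc k} zero = cong suc (trans (Σ-tabulate {k} suc (λ d → bit ⌊ zero ≟ d ⌋)) (Σ-zero (allFin k)))
    point {suc k} (suc e) = trans (Σ-tabulate {k} suc (λ d → bit ⌊ suc e ≟ d ⌋)) (trans (Σ-cong (allFin k) same) (point e))
      where
      same : ∀ d → bit ⌊ suc e ≟ suc d ⌋ ≡ bit ⌊ e ≟ d ⌋
      same d = cong bit (trans (isYes≗does (suc e ≟ suc d)) (sym (isYes≗does (e ≟ d))))
    inner : ∀ a (e : Fin p) → Σ (allFin p) (λ d → bit (a ∧ ⌊ e ≟ d ⌋)) ≡ bit a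
    inner true e = point e
    inner false e = Σ-zero (allFin p)

  search : {P : Form p n → Set} → (∀ φ → Dec (P φ)) → Dec (∃ P)
  search {zero} P? = map′ (λ pf → [] , pf) (λ { ([] , pf) → pf }) (P? [])
  search {suc n} P? = map′ (λ { (c , φ , pf) → (c ∷ φ) , pf }) (λ { ((c ∷ φ) , pf) → c , φ , pf })
    (any? (λ c → search (λ φ → P? (c ∷ φ))))

open import Data.Nat using (_≤_)

-- Constants and the subfamily with few bad pairs

module Assembly (p : ℕ) .{{p≢0 : NonZero p}} (p-prime : Prime p) (m-1 D : ℕ) (1≤D : 1 ≤ D) where
  open import Data.Bool using (Bool; true; _∧_)
  open import Data.Integer using (ℤ; +_; 0ℤ; 1ℤ; +≤+)
  import Data.Integer as ℤ
  import Data.Integer.Properties as ℤₚ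
  import Data.Integer.Tactic.RingSolver as ℤ-Solver
  open import Data.Nat hiding (_≤_; NonZero)
  open import Data.Nat.Properties
  open import Data.Nat.Tactic.RingSolver using (solve-∀)
  open import Data.Fin using (Fin; toℕ)
  open import Data.Fin.Properties using (all?; ¬∀⟶∃¬)
  open import Data.List using ([]; length; allFin; map; filter)
  open import Data.List.Properties using (length-tabulate; filter-none; length-map)
  open import Data.List.Membership.Propositional using (_∈_)
  open import Data.List.Relation.Unary.All as All using (All)
  import Data.List.Relation.Unary.All.Properties as All
  open import Data.List.Relation.Unary.AllPairs using (AllPairs)
  import Data.List.Relation.Unary.AllPairs.Properties as AllPairs
  open import Data.Vec using (Vec; []; replicate)
  open import Data.Product using (_,_; ∃; _×_; proj₁; proj₂)
  open import Relation.Nullary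
  open import Relation.Binary.PropositionalEquality
  open import Defs
  open Powers
  open Pigeonhole
  open NaturalSums
  open Iteration
  open CubeSums
  open Residues p p-prime
  open CyclicFunctions p p-prime using (P)
  open Equidistribution p p-prime using (N; dot)
  open Covering p p-prime
  open Spectrum p p-prime
  open Transfer p p-prime using (Within)
  open LocalAgreement p p-prime
  open FormCounts p p-prime

  1≤p : 1 ≤ p
  1≤p = >-nonZero⁻¹ p

  -- 1/H is the tolerance on probabilities, chosen with p m / H = 1/D. A form that is biased by 1/H on a set
  -- of density 1/D correlates with it at level 1/L₁, and Walsh coefficients known up to 1/L₂ determine the
  -- distribution of a form near a given centre up to 1/H.
  m H L₁ k₀ M K c₀ L₂ E C : ℕ
  m = suc m-1
  H = p * m * D
  L₁ = D * H
  k₀ = radius L₁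
  M = chain-length L₁
  K = k₀ + k₀
  c₀ = 4 * (p * 2 ^ K)
  L₂ = c₀ * D * H
  E = m * m * D
  C = suc ((E + (suc M + local-exponent K L₂)) * suc M)

  private
    1≤m : 1 ≤ m
    1≤m = s≤s z≤n

  1≤H : 1 ≤ H
  1≤H = *-mono-≤ (*-mono-≤ 1≤p 1≤m) 1≤D

  instance
    E≢0 : NonZero E
    E≢0 = >-nonZero (*-mono-≤ (*-mono-≤ 1≤m 1≤m) 1≤D)

  module Family {n s : ℕ} (A : Fin s → SubCube n) (nonempty : ∀ i → 1 ≤ size (A i)) (dense : ∀ i → 2 ^ n ≤ D * size (A i)) where

    -- The inequality 1/p ≤ probability + 1/H with denominators cleared, in the literal shape
    -- expected by `frac-≤-+`; hence the factor 1.
    Unif : Fin s → Form p n → Set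
    Unif i φ = ∀ d → 1 * size (A i) * H ≤ cnt (A i) φ d * p * H + p * size (A i)

    unif? : ∀ i φ → Dec (Unif i φ)
    unif? i φ = all? (λ d → _ ≤? _)

    Close : Fin s → Fin s → Form p n → Set
    Close i j φ = ∀ d → cnt (A i) φ d * size (A j) * H ≤ cnt (A j) φ d * size (A i) * H + size (A i) * size (A j)

    close? : ∀ i j φ → Dec (Close i j φ)
    close? i j φ = all? (λ d → _ ≤? _)

    Spec : Fin s → Form p n → Set
    Spec i φ = ¬ Unif i φ

    spec? : ∀ i φ → Dec (Spec i φ)
    spec? i φ = ¬? (unif? i φ)

    bad-pair? : ∀ i j → Dec (Bad search Spec spec? Close close? i j)
    bad-pair? = bad? search Spec spec? Close close?

    private
      B : Fin s → Vec Bool n → ℤ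
      B i = ind (A i)

      bias-sum : ∀ i φ d → ℤΣ.Σ (cube n) (λ x → B i x ℤ.* bias (vec φ) (p ∸ toℕ d) x) ≡ + size (A i) ℤ.- P ℤ.* + cnt (A i) φ d
      bias-sum i φ d = begin
        ℤΣ.Σ (cube n) (λ x → B i x ℤ.* bias (vec φ) b x)
          ≡⟨ ℤΣ.Σ-cong (cube n) (λ x → expand (B i x) P (δ (dot (vec φ) x + b))) ⟩
        ℤΣ.Σ (cube n) (λ x → B i x ℤ.- P ℤ.* (B i x ℤ.* δ (dot (vec φ) x + b)))
          ≡⟨ ℤΣ.Σ-- (cube n) (B i) (λ x → P ℤ.* (B i x ℤ.* δ (dot (vec φ) x + b))) ⟩
        ℤΣ.Σ (cube n) (B i) ℤ.- ℤΣ.Σ (cube n) (λ x → P ℤ.* (B i x ℤ.* δ (dot (vec φ) x + b)))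
          ≡⟨ cong₂ ℤ._-_ (sym (pos-Σ (cube n) (λ x → bit (A i x)))) (trans (ℤΣ.Σ-* P (cube n) (λ x → B i x ℤ.* δ (dot (vec φ) x + b))) (cong (λ z → P ℤ.* z) (sym (cnt-count (A i) φ d)))) ⟩
        + size (A i) ℤ.- P ℤ.* + cnt (A i) φ d ∎
        where
        open ≡-Reasoning
        b : ℕ
        b = p ∸ toℕ d
        expand : ∀ a P e → a ℤ.* (1ℤ ℤ.- P ℤ.* e) ≡ a ℤ.- P ℤ.* (a ℤ.* e)
        expand = ℤ-Solver.solve-∀

      -- At a residue violating `Unif`, H (size - p cnt) exceeds p size and thus size. Multiplying
      -- by D and using D size ≥ 2^n gives a bias at level L₁ = D H.
      spec⇒biased : ∀ i φ → Spec i φ → Biased (B i) L₁ (vec φ)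
      spec⇒biased i φ spec = go (¬∀⟶∃¬ p _ (λ d → _ ≤? _) spec)
        where
        go : (∃ λ d → ¬ (1 * size (A i) * H ≤ cnt (A i) φ d * p * H + p * size (A i))) → Biased (B i) L₁ (vec φ)
        go (d , deficient) = p ∸ toℕ d , subst (N n ℤ.≤_) eq (ℤₚ.≤-trans (+≤+ (dense i)) (ℤΣ.≤-cert
            (ℤΣ.0≤-+ (ℤΣ.0≤-* (ℤΣ.0≤+ D) (ℤₚ.i≤j⇒0≤j-i (subst₂ ℤ._≤_ lhs rhs (+≤+ (<⇒≤ (≰⇒> deficient))))))
                     (ℤΣ.0≤-* (ℤΣ.0≤-* (ℤΣ.0≤+ D) (ℤΣ.0≤+ (size (A i)))) (ℤₚ.i≤j⇒0≤j-i (+≤+ 1≤p))))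
            (trans (cong (λ z → + D ℤ.* + H ℤ.* (+ size (A i) ℤ.- P ℤ.* + cnt (A i) φ d) ℤ.- z) (ℤₚ.pos-* D (size (A i)))) (slack (+ D) (+ H) (+ size (A i)) P (+ cnt (A i) φ d)))))
          where
          eq : + D ℤ.* + H ℤ.* (+ size (A i) ℤ.- P ℤ.* + cnt (A i) φ d) ≡ + L₁ ℤ.* ℤΣ.Σ (cube n) (λ x → B i x ℤ.* bias (vec φ) (p ∸ toℕ d) x)
          eq = sym (cong₂ ℤ._*_ (ℤₚ.pos-* D H) (bias-sum i φ d))
          lhs : + (cnt (A i) φ d * p * H + p * size (A i)) ≡ + cnt (A i) φ d ℤ.* P ℤ.* + H ℤ.+ P ℤ.* + size (A i)
          lhs = trans (ℤₚ.pos-+ (cnt (A i) φ d * p * H) (p * size (A i)))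
            (cong₂ ℤ._+_ (trans (ℤₚ.pos-* (cnt (A i) φ d * p) H) (cong (ℤ._* + H) (ℤₚ.pos-* (cnt (A i) φ d) p))) (ℤₚ.pos-* p (size (A i))))
          rhs : + (1 * size (A i) * H) ≡ + size (A i) ℤ.* + H
          rhs = trans (cong (λ z → + (z * H)) (*-identityˡ (size (A i)))) (ℤₚ.pos-* (size (A i)) H)
          slack : ∀ D H a P c → D ℤ.* H ℤ.* (a ℤ.- P ℤ.* c) ℤ.- D ℤ.* a
            ≡ D ℤ.* (a ℤ.* H ℤ.- (c ℤ.* P ℤ.* H ℤ.+ P ℤ.* a)) ℤ.+ D ℤ.* a ℤ.* (P ℤ.- 1ℤ)
          slack = ℤ-Solver.solve-∀

      Cov Cov₂ : Form p n → Form p n → Set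
      Cov e φ = Covers k₀ (vec e) (vec φ)
      Cov₂ e φ = Covers K (vec e) (vec φ)

      bounded : ∀ i φs → AllPairs (λ new old → ¬ Cov old new) φs → All (Spec i) φs → length φs ≤ M
      bounded i φs chain spec = subst (_≤ M) (length-map vec φs)
        (chain-bound (B i) (ind-indicator (A i)) L₁ (map vec φs) (AllPairs.map⁺ chain) (All.map⁺ (All.map (λ {φ} → spec⇒biased i φ) spec)))

    -- The loss (E (M + 1) F)^(M + 1) of the iteration becomes a power of n + 1: `constant≤power`
    -- absorbs E and M + 1, and F already is such a power. The outer successor in `C` makes the
    -- exponent positive.
    few-bad : 1 ≤ n → ∃ λ R → R ⊑ allFin s × s ≤ length R * suc n ^ C ×
              E * Σ R (λ i → length (filter (bad-pair? i) R)) ≤ length R * length R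
    few-bad 1≤n = go (few-bad-pairs search Spec spec? Close close? Cov Cov₂ (λ e φ → covers? k₀ (vec e) (vec φ))
        (λ {c} {ψ} {φ} → covers-trans {c = vec c} {vec ψ} {vec φ}) M bounded F {{m^n≢0 (suc n) (local-exponent K L₂)}} local E (allFin s))
      where
      open Thinning B (λ i → ind-indicator (A i)) 1≤n K L₂
      F : ℕ
      F = suc n ^ local-exponent K L₂
      t : ℤ
      t = P ℤ.* (+ (2 ^ K) ℤ.* (+ 2 ℤ.* N n))
      -- With counts x, y and sizes a, b one has x b - y a = a (x - y) - x (a - b). Both gaps are at
      -- most t / L₂ in absolute value and x ≤ a, so the total is at most 2 a t / L₂. The factor c₀
      -- = 4 p 2^K makes this a N / (D H), which is at most a b / H by density.
      counts⇒close : ∀ i j φ → CountsClose i j (vec φ) → CountsClose i j (replicate n 0) → Close i j φ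
      counts⇒close i j φ close-φ close-0 d = ℤₚ.drop‿+≤+ (subst₂ ℤ._≤_ (sym lhs) (sym rhs)
          (ℤₚ.*-cancelˡ-≤-pos _ _ c₁ {{ℤ.positive 0<c₁}} (ℤΣ.≤-cert nonneg (slack P (+ (2 ^ K)) (+ D) (+ H) (N n) x y a b))))
        where
        x y a b c₁ : ℤ
        x = + cnt (A i) φ d
        y = + cnt (A j) φ d
        a = + size (A i)
        b = + size (A j)
        c₁ = + 4 ℤ.* (P ℤ.* + (2 ^ K)) ℤ.* + D
        0<c₁ : 0ℤ ℤ.< c₁
        0<c₁ = subst (0ℤ ℤ.<_) (trans (ℤₚ.pos-* c₀ D) (cong (ℤ._* + D) (trans (ℤₚ.pos-* 4 (p * 2 ^ K)) (cong (λ z → + 4 ℤ.* z) (ℤₚ.pos-* p (2 ^ K))))))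
          (ℤ.+<+ (*-mono-≤ {1} {c₀} {1} {D} (*-mono-≤ {1} {4} {1} (s≤s z≤n) (*-mono-≤ 1≤p (m^n>0 2 K))) 1≤D))
        pos-L₂ : + L₂ ≡ c₁ ℤ.* + H
        pos-L₂ = trans (ℤₚ.pos-* (c₀ * D) H) (cong (ℤ._* + H) (trans (ℤₚ.pos-* c₀ D) (cong (ℤ._* + D) (trans (ℤₚ.pos-* 4 (p * 2 ^ K)) (cong (λ z → + 4 ℤ.* z) (ℤₚ.pos-* p (2 ^ K)))))))
        triple : ∀ u v w → + (u * v * w) ≡ + u ℤ.* + v ℤ.* + w
        triple u v w = trans (ℤₚ.pos-* (u * v) w) (cong (ℤ._* + w) (ℤₚ.pos-* u v))
        lhs : + (cnt (A i) φ d * size (A j) * H) ≡ x ℤ.* b ℤ.* + H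
        lhs = triple (cnt (A i) φ d) (size (A j)) H
        rhs : + (cnt (A j) φ d * size (A i) * H + size (A i) * size (A j)) ≡ y ℤ.* a ℤ.* + H ℤ.+ a ℤ.* b
        rhs = trans (ℤₚ.pos-+ (cnt (A j) φ d * size (A i) * H) (size (A i) * size (A j))) (cong₂ ℤ._+_ (triple (cnt (A j) φ d) (size (A i)) H) (ℤₚ.pos-* (size (A i)) (size (A j))))
        count-gap : c₁ ℤ.* + H ℤ.* (x ℤ.- y) ℤ.≤ t
        count-gap = subst (ℤ._≤ t) (cong₂ ℤ._*_ pos-L₂ (cong₂ ℤ._-_ (sym (cnt-count (A i) φ d)) (sym (cnt-count (A j) φ d))))
          (proj₂ (close-φ (p ∸ toℕ d)))
        size-gap : ℤ.- t ℤ.≤ c₁ ℤ.* + H ℤ.* (a ℤ.- b)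
        size-gap = subst (ℤ.- t ℤ.≤_) (cong₂ ℤ._*_ pos-L₂ (cong₂ ℤ._-_ (sym (size-count (A i))) (sym (size-count (A j)))))
          (proj₁ (close-0 0))
        dense-b : N n ℤ.≤ + D ℤ.* b
        dense-b = subst (N n ℤ.≤_) (ℤₚ.pos-* D (size (A j))) (+≤+ (dense j))
        0≤t : 0ℤ ℤ.≤ t
        0≤t = ℤΣ.0≤-* (ℤΣ.0≤+ p) (ℤΣ.0≤-* (ℤΣ.0≤+ (2 ^ K)) (ℤΣ.0≤-* (ℤΣ.0≤+ 2) (ℤΣ.0≤+ (2 ^ n))))
        nonneg : 0ℤ ℤ.≤ ((a ℤ.* (t ℤ.- c₁ ℤ.* + H ℤ.* (x ℤ.- y)) ℤ.+ x ℤ.* (c₁ ℤ.* + H ℤ.* (a ℤ.- b) ℤ.- ℤ.- t))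
                          ℤ.+ + 4 ℤ.* (P ℤ.* + (2 ^ K)) ℤ.* a ℤ.* (+ D ℤ.* b ℤ.- N n)) ℤ.+ (a ℤ.- x) ℤ.* t
        nonneg = ℤΣ.0≤-+ (ℤΣ.0≤-+ (ℤΣ.0≤-+
            (ℤΣ.0≤-* (ℤΣ.0≤+ (size (A i))) (ℤₚ.i≤j⇒0≤j-i count-gap))
            (ℤΣ.0≤-* (ℤΣ.0≤+ (cnt (A i) φ d)) (ℤₚ.i≤j⇒0≤j-i size-gap)))
            (ℤΣ.0≤-* (ℤΣ.0≤-* (ℤΣ.0≤-* (ℤΣ.0≤+ 4) (ℤΣ.0≤-* (ℤΣ.0≤+ p) (ℤΣ.0≤+ (2 ^ K)))) (ℤΣ.0≤+ (size (A i)))) (ℤₚ.i≤j⇒0≤j-i dense-b)))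
            (ℤΣ.0≤-* (ℤₚ.i≤j⇒0≤j-i (+≤+ (cnt≤size (A i) φ d))) 0≤t)
        slack : ∀ P k D H N x y a b →
          + 4 ℤ.* (P ℤ.* k) ℤ.* D ℤ.* (y ℤ.* a ℤ.* H ℤ.+ a ℤ.* b) ℤ.- + 4 ℤ.* (P ℤ.* k) ℤ.* D ℤ.* (x ℤ.* b ℤ.* H)
          ≡ ((a ℤ.* (P ℤ.* (k ℤ.* (+ 2 ℤ.* N)) ℤ.- + 4 ℤ.* (P ℤ.* k) ℤ.* D ℤ.* H ℤ.* (x ℤ.- y))
              ℤ.+ x ℤ.* (+ 4 ℤ.* (P ℤ.* k) ℤ.* D ℤ.* H ℤ.* (a ℤ.- b) ℤ.- ℤ.- (P ℤ.* (k ℤ.* (+ 2 ℤ.* N)))))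
             ℤ.+ + 4 ℤ.* (P ℤ.* k) ℤ.* a ℤ.* (D ℤ.* b ℤ.- N)) ℤ.+ (a ℤ.- x) ℤ.* (P ℤ.* (k ℤ.* (+ 2 ℤ.* N)))
        slack = ℤ-Solver.solve-∀
      local : ∀ e R → ∃ λ R′ → R′ ⊑ R × length R ≤ length R′ * F × (∀ {i j} → i ∈ R′ → j ∈ R′ → ∀ φ → Cov₂ e φ → Close i j φ)
      local e R = convert (thin-around (vec e) R)
        where
        convert : Thinned R (local-exponent K L₂) (CloseAround (vec e)) →
                  ∃ λ R′ → R′ ⊑ R × length R ≤ length R′ * F × (∀ {i j} → i ∈ R′ → j ∈ R′ → ∀ φ → Cov₂ e φ → Close i j φ)
        convert (R′ , R′⊑R , le , close) = R′ , R′⊑R , le , λ {i} {j} i∈ j∈ φ cov →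
          counts⇒close i j φ (close i∈ j∈ (vec φ) cov) (close i∈ j∈ (replicate n 0) (covers-zero K (vec e)))
      go : (∃ λ R → R ⊑ allFin s × length (allFin s) ≤ length R * (E * (suc M * F)) ^ suc M ×
             E * Σ R (λ i → length (filter (bad-pair? i) R)) ≤ length R * length R) →
           ∃ λ R → R ⊑ allFin s × s ≤ length R * suc n ^ C × E * Σ R (λ i → length (filter (bad-pair? i) R)) ≤ length R * length R
      go (R , R⊑ , le , few) = R , R⊑ , (begin
          s                                                ≡⟨ length-tabulate (λ (i : Fin s) → i) ⟨
          length (allFin s)                                ≤⟨ le ⟩
          length R * (E * (suc M * F)) ^ suc M             ≤⟨ *-monoʳ-≤ (length R) (^-monoˡ-≤ (suc M) (*-mono-≤ (constant≤power 1≤n E) (*-monoˡ-≤ F (constant≤power 1≤n (suc M))))) ⟩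
          length R * (suc n ^ E * (suc n ^ suc M * F)) ^ suc M ≡⟨ cong (λ z → length R * (suc n ^ E * z) ^ suc M) (^-distribˡ-+-* (suc n) (suc M) (local-exponent K L₂)) ⟨
          length R * (suc n ^ E * suc n ^ (suc M + local-exponent K L₂)) ^ suc M ≡⟨ cong (λ z → length R * z ^ suc M) (^-distribˡ-+-* (suc n) E _) ⟨
          length R * (suc n ^ (E + (suc M + local-exponent K L₂))) ^ suc M ≡⟨ cong (length R *_) (^-*-assoc (suc n) (E + (suc M + local-exponent K L₂)) (suc M)) ⟩
          length R * suc n ^ ((E + (suc M + local-exponent K L₂)) * suc M) ≤⟨ *-monoʳ-≤ (length R) (^-monoʳ-≤ (suc n) (n≤1+n ((E + (suc M + local-exponent K L₂)) * suc M))) ⟩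
          length R * suc n ^ C                             ∎) , few
        where open ≤-Reasoning

    -- Meant for dimension 0, where (n + 1)^C = 1 and the whole index set has to be kept.
    few-bad-if-close : (∀ i j φ → Close i j φ) → ∃ λ R → R ⊑ allFin s × s ≤ length R * suc n ^ C ×
                       E * Σ R (λ i → length (filter (bad-pair? i) R)) ≤ length R * length R
    few-bad-if-close close = allFin s , ⊑-refl ,
      ≤-trans (≤-reflexive (sym (length-tabulate (λ (i : Fin s) → i)))) (m≤m*n (length (allFin s)) (suc n ^ C) {{m^n≢0 (suc n) C}}) ,
      ≤-trans (≤-reflexive (trans (cong (E *_) none) (*-zeroʳ E))) z≤n
      where
      none : Σ (allFin s) (λ i → length (filter (bad-pair? i) (allFin s))) ≡ 0
      none = trans (Σ-cong (allFin s) (λ i → cong length (filter-none (bad-pair? i) {xs = allFin s} (All.universal (λ { j (φ , _ , ¬close) → ¬close (close i j φ) }) (allFin s)))))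
        (Σ-zero (allFin s))

  -- The cube of dimension 0 is a single point, so all non-empty subsets coincide and so do their
  -- distributions.
  point-close : ∀ {s} (A : Fin s → SubCube 0) nonempty dense i j φ → Family.Close A nonempty dense i j φ
  point-close A nonempty dense i j φ d = subst₂ (λ a c → c * size (A j) * H ≤ cnt (A j) φ d * a * H + a * size (A j))
      (cong (λ b → bit b + 0) same) (cong (λ b → bit (b ∧ ⌊ evalForm φ [] ≟ᶠ d ⌋) + 0) same)
      (m≤m+n (cnt (A j) φ d * size (A j) * H) (size (A j) * size (A j)))
    where
    open import Data.Fin using () renaming (_≟_ to _≟ᶠ_)
    open import Relation.Nullary.Decidable using (⌊_⌋)
    full : ∀ k → A k [] ≡ true
    full k with A k [] | nonempty k
    ... | true | _ = refl
    same : A j [] ≡ A i []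
    same = trans (full j) (sym (full i))

-- Correlations and proportions as rational numbers

module Conclusion (p : ℕ) .{{p≢0 : NonZero p}} (p-prime : Prime p) (m-1 D : ℕ) (1≤D : 1 ≤ D) where
  import Data.Nat as ℕ
  import Data.Nat.Properties as ℕₚ
  open import Data.Nat using (zero; suc; _^_)
  open import Data.Fin using (Fin; zero; suc)
  open import Data.Fin.Subset using (_∈_; ∣_∣)
  open import Data.List using (map; allFin; length; filter)
  open import Data.List.Relation.Unary.All as All using (All)
  open import Data.List.Relation.Unary.Unique.Propositional using (Unique)
  open import Data.List.Relation.Unary.Unique.Propositional.Properties using (allFin⁺)
  open import Data.List.Properties using (map-tabulate)
  open import Data.Vec using (Vec; []; _∷_; lookup)
  open import Data.Rational hiding (NonZero; ∣_∣) renaming (_≤_ to _≤ℚ_)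
  open import Data.Rational.Properties
  open import Data.Product using (_,_; _×_; ∃; ∃-syntax; proj₁; proj₂)
  open import Data.Sum using (_⊎_; inj₁; inj₂)
  open import Data.Unit using (tt)
  open import Relation.Nullary
  open import Relation.Binary.PropositionalEquality
  open import Defs
  open Fractions
  open Tuples using (NoBadPair; module GoodTuples)
  open Pigeonhole using (_⊑_)
  open ListSubset
  open FormCounts p p-prime
  open Assembly p p-prime m-1 D 1≤D
  import Tactic.RingSolver as Solver

  dense-count : ∀ {n} {δ : ℚ} (A : SubCube n) → frac 1 D ≤ℚ δ → δ ≤ℚ density A → 2 ^ n ≤ D ℕ.* size A
  dense-count {n} A D≤δ δ≤ = ⟦⟧-reflect (begin
    ⟦ 2 ^ n ⟧                                    ≡⟨ *-identityˡ ⟦ 2 ^ n ⟧ ⟨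
    1ℚ * ⟦ 2 ^ n ⟧                               ≡⟨ cong (_* ⟦ 2 ^ n ⟧) (trans (*-comm ⟦ D ⟧ (frac 1 D)) (frac-cancel 1 D 1≤D)) ⟨
    ⟦ D ⟧ * frac 1 D * ⟦ 2 ^ n ⟧                 ≤⟨ *-monoʳ-≤-nonNeg ⟦ 2 ^ n ⟧ {{nonNegative (frac-nonneg (2 ^ n) 1)}} (*-monoˡ (frac-nonneg D 1) (≤-trans D≤δ δ≤)) ⟩
    ⟦ D ⟧ * frac (size A) (2 ^ n) * ⟦ 2 ^ n ⟧    ≡⟨ *-assoc ⟦ D ⟧ (frac (size A) (2 ^ n)) ⟦ 2 ^ n ⟧ ⟩
    ⟦ D ⟧ * (frac (size A) (2 ^ n) * ⟦ 2 ^ n ⟧)  ≡⟨ cong (λ z → ⟦ D ⟧ * z) (frac-cancel (size A) (2 ^ n) (ℕₚ.m^n>0 2 n)) ⟩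
    ⟦ D ⟧ * ⟦ size A ⟧                           ≡⟨ ⟦⟧-* D (size A) ⟨
    ⟦ D ℕ.* size A ⟧                             ∎)
    where open ≤-Reasoning

  prodℚ-lookup : {X : Set} {k : ℕ} (g : X → ℚ) (t : Vec X k) → prodℚ (map (λ i → g (lookup t i)) (allFin k)) ≡ Data.Vec.foldr (λ _ → ℚ) (λ x z → g x * z) 1ℚ t
  prodℚ-lookup g [] = refl
  prodℚ-lookup {k = suc k} g (x ∷ t) = cong (λ z → g x * z) (trans
    (cong prodℚ (trans (map-tabulate {n = k} suc (λ i → g (lookup (x ∷ t) i))) (sym (map-tabulate {n = k} (λ i → i) (λ i → g (lookup t i))))))
    (prodℚ-lookup g t))

  module _ {n s : ℕ} (A : Fin s → SubCube n) (nonempty : ∀ i → 1 ≤ size (A i)) (dense : ∀ i → 2 ^ n ≤ D ℕ.* size (A i)) where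
    open Family A nonempty dense

    no-bad-pair⇒correlated : (t : Vec (Fin s) m) → NoBadPair bad-pair? t → {ν : ℚ} → frac 1 D ≤ℚ ν → (φ : Form p n) →
                             - ν ≤ℚ cor m (λ j → A (lookup t j)) φ
    no-bad-pair⇒correlated t good {ν} D≤ν φ = ≤-cert (0≤-+ (≤⇒0≤- bound) (≤⇒0≤- D≤ν)) (slack corr (frac 1 (p ^ m-1)) ν (frac 1 D))
      where
      f : Fin s → Fin p → ℚ
      f i = prob (A i) φ
      η corr : ℚ
      η = frac 1 H
      corr = Σ (allFin p) (λ d → prodℚ (map (λ i → f (lookup t i) d) (allFin m)))
      0≤f : ∀ i d → 0ℚ ≤ℚ f i d
      0≤f i d = frac-nonneg (cnt (A i) φ d) (size (A i))
      f≤1 : ∀ i d → f i d ≤ℚ 1ℚ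
      f≤1 i d = subst (f i d ≤ℚ_) (frac-1 (nonempty i)) (frac-mono (nonempty i) (cnt≤size (A i) φ d))
      Σf≡1 : ∀ i → Σ (allFin p) (f i) ≡ 1ℚ
      Σf≡1 i = trans (Σ-frac (allFin p) (cnt (A i) φ) (nonempty i)) (trans (cong (λ k → frac k (size (A i))) (Σ-cnt (A i) φ)) (frac-1 (nonempty i)))
      module Corr = Correlation.PairwiseClose p 1≤p f 0≤f f≤1 Σf≡1 η (frac-nonneg 1 H)
      uniform : ∀ {i} → Unif i φ → Corr.Uniform i
      uniform {i} unif d = frac-≤-+ 1 p (cnt (A i) φ d) (size (A i)) H 1≤p (nonempty i) 1≤H (unif d)
      close : ∀ {i j} → Close i j φ → Corr.Close i j
      close {i} {j} cl d = frac-≤-+ (cnt (A i) φ d) (size (A i)) (cnt (A j) φ d) (size (A j)) H (nonempty i) (nonempty j) 1≤H (cl d)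
      pairs : ∀ {k} (t : Vec (Fin s) k) → NoBadPair bad-pair? t → Corr.PairsClose t
      pairs [] _ = tt
      pairs (x ∷ t) (no-bad , rest) = head (unif? x φ) , pairs t rest
        where
        head : Dec (Unif x φ) → Corr.Uniform x ⊎ (∀ k → Corr.Uniform (lookup t k) ⊎ Corr.Close x (lookup t k))
        head (yes ux) = inj₁ (uniform ux)
        head (no ¬ux) = inj₂ (λ k → tail k (unif? (lookup t k) φ) (close? x (lookup t k) φ))
          where
          tail : ∀ k → Dec (Unif (lookup t k) φ) → Dec (Close x (lookup t k) φ) → Corr.Uniform (lookup t k) ⊎ Corr.Close x (lookup t k)
          tail k (yes uk) _ = inj₁ (uniform uk)
          tail k (no _) (yes cl) = inj₂ (close cl)
          -- A form biased on both sets and not close is exactly a witness of a bad pair.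
          tail k (no ¬uk) (no ¬cl) = contradiction (φ , (¬ux , ¬uk) , ¬cl) (no-bad k)
      Π-fold : ∀ {k} (t : Vec (Fin s) k) d → Corr.Π t d ≡ Data.Vec.foldr (λ _ → ℚ) (λ x z → f x d * z) 1ℚ t
      Π-fold [] d = refl
      Π-fold (x ∷ t) d = cong (λ z → f x d * z) (Π-fold t d)
      error : ⟦ p ⟧ * (⟦ m ⟧ * η) ≡ frac 1 D
      error = ≡-clear 1≤D (begin
        ⟦ p ⟧ * (⟦ m ⟧ * η) * ⟦ D ⟧     ≡⟨ regroup ⟦ p ⟧ ⟦ m ⟧ η ⟦ D ⟧ ⟩
        η * (⟦ p ⟧ * ⟦ m ⟧ * ⟦ D ⟧)     ≡⟨ cong (λ z → η * z) (trans (⟦⟧-* (p ℕ.* m) D) (cong (_* ⟦ D ⟧) (⟦⟧-* p m))) ⟨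
        η * ⟦ H ⟧                       ≡⟨ frac-cancel 1 H 1≤H ⟩
        ⟦ 1 ⟧                           ≡⟨ frac-cancel 1 D 1≤D ⟨
        frac 1 D * ⟦ D ⟧                ∎)
        where
        open ≡-Reasoning
        regroup : ∀ p m η D → p * (m * η) * D ≡ η * (p * m * D)
        regroup = Solver.solve-∀ ring
      bound : frac 1 (p ^ m-1) ≤ℚ corr + frac 1 D
      bound = subst₂ (λ x y → frac 1 (p ^ m-1) ≤ℚ x + y)
        (Σ-cong (allFin p) (λ d → trans (Π-fold t d) (sym (prodℚ-lookup (λ i → f i d) t)))) error
        (Corr.correlation-bound t (pairs t good))
      slack : ∀ c κ ν e → (c - κ) - (- ν) ≡ ((c + e) - κ) + (ν - e)
      slack = Solver.solve-∀ ring

  -- Since E = m² D, the loss m² r^m / E is r^m / D, and 1/D ≤ ε.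
  many-tuples : ∀ {ε} (r T : ℕ) → frac 1 D ≤ℚ ε → E ℕ.* r ^ m ≤ E ℕ.* T ℕ.+ m ℕ.* m ℕ.* r ^ m →
                (1ℚ - ε) * frac (r ^ m) 1 ≤ℚ frac T 1
  many-tuples {ε} r T D≤ε many = ≤-trans
      (*-monoʳ-≤-nonNeg ⟦ r ^ m ⟧ {{nonNegative (frac-nonneg (r ^ m) 1)}} (+-monoʳ-≤ 1ℚ (neg-antimono-≤ D≤ε)))
      (≤-clear 1≤D (≤-cert (≤⇒0≤- cleared) (trans (expand ⟦ T ⟧ ⟦ D ⟧ (frac 1 D) ⟦ r ^ m ⟧)
        (cong (λ z → (⟦ D ⟧ * ⟦ T ⟧ + z * ⟦ r ^ m ⟧) - ⟦ D ⟧ * ⟦ r ^ m ⟧) (frac-cancel 1 D 1≤D)))))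
    where
    cancelled : D ℕ.* r ^ m ≤ D ℕ.* T ℕ.+ r ^ m
    cancelled = ℕₚ.*-cancelˡ-≤ (m ℕ.* m) (subst₂ _≤_ (ℕₚ.*-assoc (m ℕ.* m) D (r ^ m))
        (trans (cong (ℕ._+ m ℕ.* m ℕ.* r ^ m) (ℕₚ.*-assoc (m ℕ.* m) D T)) (sym (ℕₚ.*-distribˡ-+ (m ℕ.* m) (D ℕ.* T) (r ^ m)))) many)
    cleared : ⟦ D ⟧ * ⟦ r ^ m ⟧ ≤ℚ ⟦ D ⟧ * ⟦ T ⟧ + 1ℚ * ⟦ r ^ m ⟧
    cleared = subst₂ _≤ℚ_ (⟦⟧-* D (r ^ m)) (trans (⟦⟧-+ (D ℕ.* T) (r ^ m)) (cong₂ _+_ (⟦⟧-* D T) (sym (*-identityˡ ⟦ r ^ m ⟧)))) (⟦⟧-mono cancelled)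
    expand : ∀ T D e x → T * D - (1ℚ - e) * x * D ≡ (D * T + e * D * x) - D * x
    expand = Solver.solve-∀ ring

  Conclusion-for : ∀ (ν ε : ℚ) {n s} → (Fin s → SubCube n) → Set
  Conclusion-for ν ε {n} {s} A = ∃[ R ] (s ≤ ∣ R ∣ ℕ.* (suc n ^ C) ×
    ∃[ T ] (Unique T ×
    All (λ (t : Vec (Fin s) m) → (∀ j → lookup t j ∈ R) × ((φ : Form p n) → - ν ≤ℚ cor m (λ j → A (lookup t j)) φ)) T ×
    (1ℚ - ε) * frac (∣ R ∣ ^ m) 1 ≤ℚ frac (length T) 1))

  module _ {δ ν ε : ℚ} (D≤δ : frac 1 D ≤ℚ δ) (D≤ν : frac 1 D ≤ℚ ν) (D≤ε : frac 1 D ≤ℚ ε) where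

    private
      from-few-bad : ∀ {n s} (A : Fin s → SubCube n) (nonempty : ∀ i → 1 ≤ size (A i)) (dense : ∀ i → 2 ^ n ≤ D ℕ.* size (A i)) →
        (∃ λ R → R ⊑ allFin s × s ≤ length R ℕ.* suc n ^ C ×
          E ℕ.* NaturalSums.Σ R (λ i → length (filter (Family.bad-pair? A nonempty dense i) R)) ≤ length R ℕ.* length R) →
        Conclusion-for ν ε A
      from-few-bad {n} {s} A nonempty dense (R , (_ , unique) , large , few) =
        fromList R , subst (λ k → s ≤ k ℕ.* suc n ^ C) (sym card) large ,
        good-tuples m , good-tuples-unique m (unique (allFin⁺ s)) ,
        All.tabulate (λ {t} t∈ → (λ j → ∈-fromList⁺ (proj₁ (good-tuples-good m t∈) j)) ,
                                 no-bad-pair⇒correlated A nonempty dense t (proj₂ (good-tuples-good m t∈)) D≤ν) ,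
        subst (λ k → (1ℚ - ε) * frac (k ^ m) 1 ≤ℚ frac (length (good-tuples m)) 1) (sym card)
          (many-tuples (length R) (length (good-tuples m)) D≤ε (many-good-tuples m))
        where
        open GoodTuples (Family.bad-pair? A nonempty dense) E R few
        card : ∣ fromList R ∣ ≡ length R
        card = ∣fromList∣ (unique (allFin⁺ s))

      by-dimension : ∀ n {s} (A : Fin s → SubCube n) → (∀ i → 1 ≤ size (A i)) → (∀ i → 2 ^ n ≤ D ℕ.* size (A i)) → Conclusion-for ν ε A
      by-dimension zero A nonempty dense = from-few-bad A nonempty dense
        (Family.few-bad-if-close A nonempty dense (point-close A nonempty dense))
      by-dimension (suc n) A nonempty dense = from-few-bad A nonempty dense
        (Family.few-bad A nonempty dense (ℕ.s≤s ℕ.z≤n))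

    conclusion : (n s : ℕ) → 1 ≤ s → (A : Fin s → SubCube n) →
      (∀ i → 1 ≤ size (A i)) → (∀ i → δ ≤ℚ density (A i)) → Conclusion-for ν ε A
    conclusion n s _ A nonempty δ≤ = by-dimension n A nonempty (λ i → dense-count (A i) D≤δ (δ≤ i))

open import Data.Nat using (suc; _*_; _^_; _<_; s≤s; z≤n)
open import Data.Fin using (Fin)
open import Data.Fin.Subset using (_∈_; ∣_∣)
open import Data.Vec using (Vec; lookup)
open import Data.List using (length)
open import Data.List.Relation.Unary.All using (All)
open import Data.List.Relation.Unary.Unique.Propositional using (Unique)
open import Data.Product using (∃-syntax; _×_; _,_; proj₁; proj₂)
open import Data.Rational using (ℚ; 0ℚ; 1ℚ; _-_; -_) renaming (_≤_ to _≤ℚ_; _<_ to _<ℚ_; _*_ to _*ℚ_)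

mainTheorem1 : (p : ℕ) → .{{_ : NonZero p}} → Prime p → (m : ℕ) → 2 ≤ m →
    (δ ν ε : ℚ) → 0ℚ <ℚ δ → 0ℚ <ℚ ν → 0ℚ <ℚ ε →
    ∃[ C ] (0 < C ×
    ((n s : ℕ) → 1 ≤ s → (A : Fin s → SubCube n) →
    (∀ i → 1 ≤ size (A i)) → (∀ i → δ ≤ℚ density (A i)) →
    ∃[ R ] (s ≤ ∣ R ∣ * (suc n ^ C) ×
    ∃[ T ] (Unique T ×
    All (λ (t : Vec (Fin s) m) →
    (∀ j → lookup t j ∈ R) ×
    ((φ : Form p n) → - ν ≤ℚ cor m (λ j → A (lookup t j)) φ)) T ×
    (1ℚ - ε) *ℚ frac (∣ R ∣ ^ m) 1 ≤ℚ frac (length T) 1))))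
mainTheorem1 p p-prime (suc m-1) _ δ ν ε 0<δ 0<ν 0<ε =
  Assembly.C p p-prime m-1 D 1≤D , s≤s z≤n ,
  Conclusion.conclusion p p-prime m-1 D 1≤D (proj₁ (proj₂ (proj₂ common))) (proj₁ (proj₂ (proj₂ (proj₂ common)))) (proj₂ (proj₂ (proj₂ (proj₂ common))))
  where
  common : ∃[ D ] (1 ≤ D × frac 1 D ≤ℚ δ × frac 1 D ≤ℚ ν × frac 1 D ≤ℚ ε)
  common = Fractions.common-unit-fraction 0<δ 0<ν 0<ε
  D : ℕ
  D = proj₁ common
  1≤D : 1 ≤ D
  1≤D = proj₁ (proj₂ common)
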